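{- There exist absolute constants $a,b,\gamma>0$ such that the following holds. Let $A$ be a finite multiset of $n$ points in $\mathbb{R}^d$, and let $\varepsilon,\delta\in(0,1)$. Algorithm $\textsc{MeanEstimate}(\varepsilon,\delta)$ (with parameters $a,b$), using $\textsc{FastGD}$ with $T\geq \gamma\log\log\delta^{ -1}$ iterations as its aggregation routine, outputs a $(1+\varepsilon)$-approximate mean of $A$ with probability at least $1-\delta$. Moreover, with $T=\Theta(\log\log\delta^{ -1})$, its running time is $$O\left(\left(\varepsilon^{ -1}+\log\log\delta^{ -1}\right)\cdot\log\delta^{ -1}\cdot d\right).$$
   Context: For a finite multiset $A\subset\mathbb{R}^d$ with $|A|=n$, let $\mu=\frac1n\sum_{p\in A}p$ be its mean and $\mathrm{Opt}=\min_{c\in\mathbb{R}^d}\sum_{p\in A}\|p-c\|^2=\sum_{p\in A}\|p-\mu\|^2$ (Euclidean norm). A point $c\in\mathbb{R}^d$ is a $(1+\varepsilon)$-approximate mean if $\sum_{p\in A}\|p-c\|^2\le(1+\varepsilon)\mathrm{Opt}$. Algorithm $\textsc{MeanEstimate}(\varepsilon,\delta)$ with parameters $a,b$: for $i=1,\dots,k$ where $k=b\log\delta^{ -1}$, draw a sample $S_i$ of $a\varepsilon^{ -1}$ points independently and uniformly at random from $A$, and compute $\hat\mu_i=\frac{1}{|S_i|}\sum_{p\in S_i}p$; then output $\textsc{Aggregate}(\hat\mu_1,\dots,\hat\mu_k)$ (integrality of $k$ and $a\varepsilon^{ -1}$ is ignored). Algorithm $\textsc{FastGD}(P)$ for $P=\{\hat\mu_1,\dots,\hat\mu_k\}$: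 let $c_0$ be the coordinate-wise median of $P$ (its $l$-th coordinate is a median of the $l$-th coordinates of the points of $P$). For $j=1,\dots,T$: compute $g=\nabla(c_{j-1})$ where $\nabla(q)=\sum_{p\in P,\,p\ne q}\frac{q-p}{\|q-p\|}$; orthogonally project every point of $P$ onto the line $\{c_{j-1}-tg: t\in\mathbb{R}\}$; let $c_j$ be a median of these projected points along that line. Output $c_T$. Running time is measured in the standard RAM model, with each sample drawn in $O(d)$ time.
   Formalization: In the running-time bound and in T = Θ(log log δ⁻¹), log log δ⁻¹ is read as max(log log δ⁻¹, 0), and in the bound log δ⁻¹ is read as max(log δ⁻¹, 1) (base 2), since for δ > 1/2 the printed bound can be negative or tend to 0; for δ ≤ 1/2 nothing changes. -}

module Defs where

open import Algebra.Bundles using (CommutativeRing; Semiring)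
import Algebra.Construct.NaturalChoice.Max as Max
import Algebra.Definitions.RawSemiring as RawSemiringDefinitions
open import Data.Bool.Base using (if_then_else_)
open import Data.Fin.Base using (Fin)
open import Data.List.Base
  using (List; []; _∷_; length; filter; cartesianProductWith; allFin)
open import Data.Nat.Base as ℕ using (ℕ; zero; suc; ⌊_/2⌋; _≤ᵇ_; _<ᵇ_; _∸_)
open import Data.Product.Base using (_×_; _,_; ∃; ∃-syntax)
open import Data.Vec.Functional using (Vector; foldr)
open import Level using (0ℓ)
open import Relation.Binary.Bundles using (DecTotalOrder)
import Relation.Binary.Construct.NonStrictToStrict as ToStrict
open import Relation.Binary.Core using (Rel)
open import Relation.Binary.PropositionalEquality.Core using (_≢_)
open import Relation.Binary.Structures using (IsDecTotalOrder)
open import Relation.Nullary.Decidable using (does)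
open import Relation.Nullary.Negation using (¬_)
open import Relation.Unary using (Pred; Decidable)

-- A Dedekind-complete ordered field with decidable order; classically there
-- is exactly one, up to isomorphism.  It serves as ℝ.
-- `_⁻¹` and `sup` are total: `0# ⁻¹`, and the `sup` of an empty or unbounded
-- predicate, are unspecified.
record Reals : Set₁ where
  field
    commutativeRing : CommutativeRing 0ℓ 0ℓ

  open CommutativeRing commutativeRing public
    using (Carrier; _≈_; _+_; _*_; -_; _-_; 0#; 1#; semiring)

  infix 4 _≤_
  infix 8 _⁻¹
  field
    _≤_             : Rel Carrier 0ℓ
    isDecTotalOrder : IsDecTotalOrder _≈_ _≤_
    +-monoˡ-≤       : ∀ z {x y} → x ≤ y → x + z ≤ y + z
    *-nonNegative   : ∀ {x y} → 0# ≤ x → 0# ≤ y → 0# ≤ x * y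
    1≉0             : ¬ (1# ≈ 0#)
    _⁻¹             : Carrier → Carrier
    ⁻¹-inverseʳ     : ∀ {x} → ¬ (x ≈ 0#) → x * x ⁻¹ ≈ 1#

  open ToStrict _≈_ _≤_ public using (_<_)

  IsUpperBound : Pred Carrier 0ℓ → Carrier → Set
  IsUpperBound P s = ∀ x → P x → x ≤ s

  -- Leastness in its positive form: nothing smaller is an upper bound.
  IsSupremum : Pred Carrier 0ℓ → Carrier → Set
  IsSupremum P s =
    IsUpperBound P s × (∀ y → y < s → ∃[ x ] (P x × y < x))

  field
    sup            : Pred Carrier 0ℓ → Carrier
    sup-isSupremum : ∀ P → ∃ P → ∃ (IsUpperBound P) → IsSupremum P (sup P)

  decTotalOrder : DecTotalOrder 0ℓ 0ℓ 0ℓ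
  decTotalOrder = record { isDecTotalOrder = isDecTotalOrder }

  open IsDecTotalOrder isDecTotalOrder public using (_≟_; _≤?_)
  open Max (DecTotalOrder.totalOrder decTotalOrder) public using (_⊔_)
  open RawSemiringDefinitions (Semiring.rawSemiring semiring) public
    using (_^_; sum) renaming (_×_ to _·_)

  fromℕ : ℕ → Carrier
  fromℕ n = n · 1#

  inf : Pred Carrier 0ℓ → Carrier
  inf P = - sup (λ y → P (- y))

  infix 8 √_
  √_ : Carrier → Carrier
  √ x = sup (λ y → y * y ≤ x)

  -- For x > 0 the rationals (u - v) / (q + 1) that satisfy
  -- 2 ^ ((u - v) / (q + 1)) ≤ x.
  LowerCutOfLog : Carrier → Pred Carrier 0ℓ
  LowerCutOfLog x y = ∃[ u ] ∃[ v ] ∃[ q ]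
    ( fromℕ 2 ^ u ≤ fromℕ 2 ^ v * x ^ suc q
    × y * fromℕ (suc q) ≈ fromℕ u - fromℕ v )

  -- Logarithm to base 2, meaningful for x > 0.
  log : Carrier → Carrier
  log x = sup (LowerCutOfLog x)

  -- k = ⌈x⌉, for x ≥ 0.
  IsCeiling : Carrier → ℕ → Set
  IsCeiling x k = x ≤ fromℕ k × (∀ m → x ≤ fromℕ m → k ℕ.≤ m)

-- Cost accounting for a real RAM.  `unit` charges one time unit for a
-- bounded number of machine operations: array accesses, list-cell
-- operations, and arithmetic (including √) and comparisons on ℕ and ℝ.
-- `pure` and `_>>=_` charge nothing; each recursive function and each
-- loop below charges at least one unit per call or iteration.

record RAM (X : Set) : Set where
  constructor _costing_
  field
    value : X
    time  : ℕ

open RAM public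

private
  variable
    X Y : Set
    d n : ℕ

infixl 1 _>>=_

pure : X → RAM X
pure x = x costing 0

_>>=_ : RAM X → (X → RAM Y) → RAM Y
m >>= f = value (f (value m)) costing (time m ℕ.+ time (f (value m)))

unit : X → RAM X
unit x = x costing 1

step : RAM X → RAM X
step m = value m costing suc (time m)

forEach : (Fin d → RAM X) → RAM (Vector X d)
forEach f =
  (λ l → value (f l)) costing foldr ℕ._+_ 1 (λ l → suc (time (f l)))

collect : (X → RAM Y) → List X → RAM (List Y)
collect f []       = unit []
collect f (x ∷ xs) = step do
  y  ← f x
  ys ← collect f xs
  pure (y ∷ ys)

accumulate : (Y → X → RAM Y) → Y → List X → RAM Y
accumulate f y []       = unit y
accumulate f y (x ∷ xs) = step do
  y′ ← f y x
  accumulate f y′ xs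

count : List X → RAM ℕ
count = accumulate (λ k _ → unit (suc k)) 0

-- The uniform distribution on a finite sample space, listed without
-- repetition.

tuples : ℕ → List X → List (List X)
tuples zero    xs = [] ∷ []
tuples (suc m) xs = cartesianProductWith _∷_ xs (tuples m xs)

-- k independent samples, each of s independent uniform indices into a
-- multiset of n points.
samples : (n s k : ℕ) → List (List (List (Fin n)))
samples n s k = tuples k (tuples s (allFin n))

module MeanEstimation (ℝ : Reals) where
  open Reals ℝ

  Point : ℕ → Set
  Point d = Vector Carrier d

  Multiset : ℕ → ℕ → Set
  Multiset d n = Vector (Point d) n

  ‖_‖² : Point d → Carrier
  ‖ p ‖² = sum (λ l → p l * p l)

  cost : Multiset d n → Point d → Carrier
  cost A c = sum (λ i → ‖ (λ l → A i l - c l) ‖²)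

  -- min over c of `cost A c`, the minimum being attained at the mean of A.
  Opt : Multiset d n → Carrier
  Opt A = inf (λ y → ∃[ c ] y ≈ cost A c)

  ApproximateMean : Multiset d n → Carrier → Pred (Point d) 0ℓ
  ApproximateMean A ε c = cost A c ≤ (1# + ε) * Opt A

  approximateMean? : (A : Multiset d n) (ε : Carrier) →
                     Decidable (ApproximateMean A ε)
  approximateMean? A ε c = cost A c ≤? (1# + ε) * Opt A

  probability : {E : Pred X 0ℓ} → List X → Decidable E → Carrier
  probability Ω E? = fromℕ (length (filter E? Ω)) * fromℕ (length Ω) ⁻¹

  -- Both the lower and the upper median, and all points between, qualify
  -- when the number of values is even.
  IsMedian : List Carrier → Carrier → Set
  IsMedian xs m = (length xs ℕ.≤ 2 ℕ.* length (filter (_≤? m) xs))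
                × (length xs ℕ.≤ 2 ℕ.* length (filter (m ≤?_) xs))

  MedianRoutine : (List Carrier → RAM Carrier) → Set
  MedianRoutine median = ∀ xs → xs ≢ [] → IsMedian xs (value (median xs))

  insert : Carrier → List Carrier → RAM (List Carrier)
  insert x []       = unit (x ∷ [])
  insert x (y ∷ ys) = step (
    if does (x ≤? y) then pure (x ∷ y ∷ ys) else do
      zs ← insert x ys
      pure (y ∷ zs))

  insertionSort : List Carrier → RAM (List Carrier)
  insertionSort []       = unit []
  insertionSort (x ∷ xs) = step do
    ys ← insertionSort xs
    insert x ys

  -- Zero-based; 0# when out of range.
  nth : ℕ → List Carrier → RAM Carrier
  nth _       []       = unit 0#
  nth zero    (x ∷ _)  = unit x
  nth (suc i) (_ ∷ xs) = step (nth i xs)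

  -- Medians of consecutive blocks of five; an incomplete block is dropped.
  blockMedians : List Carrier → RAM (List Carrier)
  blockMedians (x₁ ∷ x₂ ∷ x₃ ∷ x₄ ∷ x₅ ∷ xs) = step do
    ys ← insertionSort (x₁ ∷ x₂ ∷ x₃ ∷ x₄ ∷ x₅ ∷ [])
    m  ← nth 2 ys
    ms ← blockMedians xs
    pure (m ∷ ms)
  blockMedians _ = unit []

  partition : Carrier → List Carrier →
              RAM (List Carrier × List Carrier × List Carrier)
  partition p []       = unit ([] , [] , [])
  partition p (x ∷ xs) = step do
    (below , equal , above) ← partition p xs
    pure (if does (x ≟ p)
            then (below , x ∷ equal , above)
            else if does (x ≤? p)
              then (x ∷ below , equal , above)
              else (below , equal , x ∷ above))

  -- Median-of-medians selection of the i-th smallest (zero-based) element.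
  -- The first argument bounds the recursion depth; `length xs` suffices.
  select : ℕ → ℕ → List Carrier → RAM Carrier
  select zero       _ _  = unit 0#
  select (suc fuel) i xs = step do
    n ← count xs
    if n ≤ᵇ 5
      then (do
        ys ← insertionSort xs
        nth i ys)
      else (do
        ms ← blockMedians xs
        m  ← count ms
        p  ← select fuel ⌊ m /2⌋ ms
        (below , equal , above) ← partition p xs
        b  ← count below
        e  ← count equal
        if i <ᵇ b
          then select fuel i below
          else if i <ᵇ b ℕ.+ e
            then pure p
            else select fuel (i ∸ (b ℕ.+ e)) above)

  linearTimeMedian : List Carrier → RAM Carrier
  linearTimeMedian xs = do
    n ← count xs
    select n ⌊ n ∸ 1 /2⌋ xs

  difference : Point d → Point d → RAM (Point d)
  difference p q = forEach λ l → unit (p l - q l)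

  innerProduct : Point d → Point d → RAM Carrier
  innerProduct {d} p q = sum (λ l → p l * q l) costing suc d

  norm : Point d → RAM Carrier
  norm p = do
    pp ← innerProduct p p
    unit (√ pp)

  origin : RAM (Point d)
  origin = forEach λ _ → unit 0#

  sampleMean : List (Point d) → RAM (Point d)
  sampleMean S = do
    o     ← origin
    total ← accumulate (λ q p → forEach λ l → unit (q l + p l)) o S
    s     ← count S
    r     ← unit (fromℕ s ⁻¹)
    forEach λ l → unit (r * total l)

  coordinatewiseMedian : (List Carrier → RAM Carrier) →
                         List (Point d) → RAM (Point d)
  coordinatewiseMedian median P = forEach λ l → do
    xs ← collect (λ p → unit (p l)) P
    median xs

  gradient : List (Point d) → Point d → RAM (Point d)
  gradient {d} P q = do
    o ← origin
    accumulate add o P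
    where
    add : Point d → Point d → RAM (Point d)
    add g p = do
      u ← difference q p
      r ← norm u
      if does (r ≟ 0#)
        then unit g
        else forEach λ l → unit (g l + u l * r ⁻¹)

  -- The projection of p onto {c - t g} has t = ⟨c - p , g⟩ / ⟨g , g⟩.
  -- If g = 0 this line is the single point c.
  descend : (List Carrier → RAM Carrier) →
            List (Point d) → Point d → RAM (Point d)
  descend median P c = do
    g  ← gradient P c
    gg ← innerProduct g g
    if does (gg ≟ 0#)
      then unit c
      else (do
        ts ← collect (λ p → do
          u  ← difference c p
          ug ← innerProduct u g
          unit (ug * gg ⁻¹)) P
        t ← median ts
        forEach λ l → unit (c l - t * g l))

  fastGD : (List Carrier → RAM Carrier) → ℕ →
           List (Point d) → RAM (Point d)
  fastGD {d} median T P = do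
    c₀ ← coordinatewiseMedian median P
    iterate T c₀
    where
    iterate : ℕ → Point d → RAM (Point d)
    iterate zero    c = unit c
    iterate (suc j) c = step do
      c′ ← descend median P c
      iterate j c′

  -- Drawing a sample point takes d + 1 time units.
  draw : Multiset d n → Fin n → RAM (Point d)
  draw {d} A i = A i costing suc d

  -- The last argument holds the outcomes of the random draws.
  meanEstimate : (List (Point d) → RAM (Point d)) → Multiset d n →
                 List (List (Fin n)) → RAM (Point d)
  meanEstimate aggregate A ω = do
    P ← collect (λ is → do
      S ← collect (draw A) is
      sampleMean S) ω
    aggregate P

{-# OPTIONS --safe #-}

-- Let V be the cost of the mean μ and ρ = ε V / (64 n).  A group mean is good
-- if its squared distance to μ is at most ρ.
--
-- Sampling: a group mean has expected squared distance V / (n s) to μ, so by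
-- Markov's inequality it is bad with probability at most 1/256 once
-- s ε ≥ 256 · 64, and by an exponential moment bound at least a quarter of the
-- k group means are bad with probability at most 2⁻ᵏ ≤ δ.
--
-- Aggregation: suppose that less than a quarter of the group means is bad.
-- A median of real projections deviates from any τ by at most twice the root
-- mean square deviation of the good ones, so the coordinate-wise median is
-- within squared distance 4 ρ of μ, and after a descent step the component of
-- c - μ along the gradient has square at most 4 ρ.  If ‖c - μ‖² > 60 ρ, the
-- gradient is so well aligned with c - μ that the step does not increase the
-- distance to μ.  Hence the squared distance never exceeds 64 ρ, whatever the
-- number of iterations, and then cost A c = V + n ‖c - μ‖² ≤ (1 + ε) V.
--
-- Running time: median-of-medians selection takes linear time, and all other
-- steps cost a constant per coordinate of a point.

module Submission where

open import Algebra.Bundles using (CommutativeRing)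
import Algebra.Construct.NaturalChoice.Max as Max
import Algebra.Properties.AbelianGroup as AbelianGroupProperties
import Algebra.Properties.Ring as RingProperties
import Algebra.Properties.Semiring.Exp as SemiringExp
import Algebra.Properties.Semiring.Mult as SemiringMult
import Algebra.Properties.Semiring.Sum as SemiringSum
import Algebra.Solver.Ring as RingSolver
open import Algebra.Solver.Ring.AlmostCommutativeRing using (_-Raw-AlmostCommutative⟶_; fromCommutativeRing)
open import Data.Bool.Base using (true; false; if_then_else_; Bool; T)
open import Data.Fin.Base using (Fin; zero; suc)
open import Data.Integer.Base as ℤ using (ℤ; +_; -[1+_])
import Data.Integer.Properties as ℤ
open import Data.List.Base as List using (List; []; _∷_; length; filter; map; allFin; tabulate; cartesianProductWith; _++_)
import Data.List.Properties as List
open import Data.List.Relation.Binary.Permutation.Propositional as ↭ using (_↭_)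
import Data.List.Relation.Binary.Permutation.Propositional.Properties as ↭
open import Data.List.Relation.Unary.All as All using (All; []; _∷_)
import Data.List.Relation.Unary.All.Properties as All
open import Data.List.Relation.Unary.AllPairs using (AllPairs; []; _∷_)
open import Data.Maybe.Base as Maybe using (Maybe)
open import Data.Nat.Base as ℕ using (ℕ; zero; suc; NonZero; ⌊_/2⌋; _≤ᵇ_; _<ᵇ_; _∸_)
import Data.Nat.Properties as ℕ
open import Data.Nat.Solver using (module +-*-Solver)
open import Data.Product.Base using (_×_; _,_; proj₁; proj₂; ∃-syntax)
open import Data.Sum.Base using (inj₁; inj₂)
open import Data.Unit.Base using (tt)
open import Defs
open import Function.Base using (_∘_; id)
open import Level using (0ℓ)
open import Relation.Binary.Bundles using (DecTotalOrder)
open import Relation.Binary.PropositionalEquality.Core as ≡ using (_≡_; _≢_)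
import Relation.Binary.Reasoning.Setoid as SetoidReasoning
open import Relation.Binary.Structures using (IsDecTotalOrder)
open import Relation.Nullary.Decidable using (Dec; yes; no; dec⇒maybe; does; ¬?)
open import Relation.Nullary.Negation using (¬_; contradiction)
open import Relation.Unary using (Pred; Decidable)

-- The radius 64 ρ balances two regimes. A descent step exchanges the squared component of c - μ
-- along the gradient g for at most 4 ρ, so from within 60 ρ it ends within 64 ρ. Beyond 60 ρ, the
-- removed component must be at least 4 ρ. There a good point contributes a unit vector whose inner
-- product with c - μ is at least 3/4 ‖c - μ‖, and a bad one at least -‖c - μ‖. With three quarters
-- of the k points good, ⟨c - μ , g⟩ ≥ (9/16 - 4/16) k ‖c - μ‖, while ‖g‖ ≤ k. The removed component
-- is thus at least 25/256 · 60 ρ > 4 ρ. The factors of 256 · 64 have separate origins: 64 makes n ·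
-- 64 ρ equal to ε V, and 256 = 4^4 makes a tuple with a quarter of bad entries weigh at least 4^k,
-- against an average of at most 2^k. Probabilities are handled as counts over finite lists, and
-- denominators are cleared wherever possible: each inequality then becomes a ring identity with a
-- manifestly nonnegative remainder.

module OrderedField (ℝ : Reals) where
  open Reals ℝ
  open CommutativeRing commutativeRing using (ring; +-cong; +-congˡ; +-congʳ; +-comm; +-assoc;
      +-identityˡ; +-identityʳ; *-cong; *-congˡ; *-congʳ; *-comm; *-assoc; *-identityˡ; *-identityʳ;
      -‿cong; -‿inverseʳ; -‿inverseˡ; zeroˡ; zeroʳ; distribˡ; distribʳ; setoid; refl; sym; trans;
      reflexive) public
  open AbelianGroupProperties (CommutativeRing.+-abelianGroup commutativeRing) using () renaming
      (⁻¹-∙-comm to -‿+-comm)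
  open RingProperties ring using (-‿distribˡ-*; -‿distribʳ-*; -0#≈0#; -‿involutive)
  open SemiringMult semiring using (×1-homo-*; ×-homo-+)

  open IsDecTotalOrder isDecTotalOrder public
    using (antisym; total)
    renaming (refl to ≤-refl; trans to ≤-trans; reflexive to ≤-reflexive)

  ≤-resp-≈ : ∀ {x x′ y y′} → x ≈ x′ → y ≈ y′ → x ≤ y → x′ ≤ y′
  ≤-resp-≈ e f h = ≤-trans (≤-reflexive (sym e)) (≤-trans h (≤-reflexive f))

  fromℤ : ℤ → Carrier
  fromℤ (+ n)    = fromℕ n
  fromℤ -[1+ n ] = - fromℕ (suc n)

  private
    cancel-suc : ∀ x y → x - y ≈ (1# + x) - (1# + y)
    cancel-suc x y = begin
      x - y                     ≈⟨ +-identityˡ _ ⟨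
      0# + (x - y)              ≈⟨ +-congʳ (-‿inverseʳ 1#) ⟨
      (1# - 1#) + (x - y)       ≈⟨ +-assoc _ _ _ ⟩
      1# + (- 1# + (x - y))     ≈⟨ +-congˡ (+-assoc _ _ _) ⟨
      1# + ((- 1# + x) - y)     ≈⟨ +-congˡ (+-congʳ (+-comm _ _)) ⟩
      1# + ((x - 1#) - y)       ≈⟨ +-congˡ (+-assoc _ _ _) ⟩
      1# + (x + (- 1# - y))     ≈⟨ +-assoc _ _ _ ⟨
      (1# + x) + (- 1# - y)     ≈⟨ +-congˡ (-‿+-comm 1# y) ⟩
      (1# + x) - (1# + y)       ∎
      where open import Relation.Binary.Reasoning.Setoid setoid

    fromℤ-⊖ : ∀ m n → fromℤ (m ℤ.⊖ n) ≈ fromℕ m - fromℕ n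
    fromℤ-⊖ zero    zero    = sym (-‿inverseʳ 0#)
    fromℤ-⊖ zero    (suc n) = sym (+-identityˡ _)
    fromℤ-⊖ (suc m) zero    = trans (sym (+-identityʳ _)) (+-congˡ (sym -0#≈0#))
    fromℤ-⊖ (suc m) (suc n) = trans (reflexive (≡.cong fromℤ (ℤ.[1+m]⊖[1+n]≡m⊖n m n)))
      (trans (fromℤ-⊖ m n) (cancel-suc _ _))

    fromℤ-neg : ∀ i → fromℤ (ℤ.- i) ≈ - fromℤ i
    fromℤ-neg (+ zero)    = sym -0#≈0#
    fromℤ-neg (+ suc n)   = refl
    fromℤ-neg -[1+ n ]    = sym (-‿involutive _)

    fromℤ-+ : ∀ i j → fromℤ (i ℤ.+ j) ≈ fromℤ i + fromℤ j
    fromℤ-+ (+ m)    (+ n)    = ×-homo-+ 1# m n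
    fromℤ-+ (+ m)    -[1+ n ] = fromℤ-⊖ m (suc n)
    fromℤ-+ -[1+ m ] (+ n)    = trans (fromℤ-⊖ n (suc m)) (+-comm _ _)
    fromℤ-+ -[1+ m ] -[1+ n ] = trans (-‿cong
        (trans (reflexive (≡.cong fromℕ (≡.cong suc (≡.sym (ℕ.+-suc m n)))))
      (×-homo-+ 1# (suc m) (suc n)))) (sym (-‿+-comm _ _))

    fromℤ-* : ∀ i j → fromℤ (i ℤ.* j) ≈ fromℤ i * fromℤ j
    fromℤ-* (+ m) (+ n) = trans (reflexive (≡.cong fromℤ (≡.sym (ℤ.pos-* m n)))) (×1-homo-* m n)
    fromℤ-* (+ m) -[1+ n ] = trans (reflexive (≡.cong fromℤ (≡.sym (ℤ.neg-distribʳ-* (+ m) (+ suc n)))))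
      (trans (fromℤ-neg ((+ m) ℤ.* (+ suc n))) (trans (-‿cong (fromℤ-* (+ m) (+ suc n)))
          (-‿distribʳ-* _ _)))
    fromℤ-* -[1+ m ] (+ n) = trans (reflexive (≡.cong fromℤ (≡.sym (ℤ.neg-distribˡ-* (+ suc m) (+ n)))))
      (trans (fromℤ-neg ((+ suc m) ℤ.* (+ n))) (trans (-‿cong (fromℤ-* (+ suc m) (+ n)))
          (-‿distribˡ-* _ _)))
    fromℤ-* -[1+ m ] -[1+ n ] = trans (×1-homo-* (suc m) (suc n))
      (sym (trans (sym (-‿distribˡ-* _ _)) (trans (-‿cong (sym (-‿distribʳ-* _ _))) (-‿involutive _))))

    -- Agrees with fromℤ, but sends + 1 to 1# itself instead of 1# + 0#.
    coefficient : ℤ → Carrier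
    coefficient (+ 1) = 1#
    coefficient i     = fromℤ i

    coefficient≈ : ∀ i → coefficient i ≈ fromℤ i
    coefficient≈ (+ 0)             = refl
    coefficient≈ (+ 1)             = sym (+-identityʳ 1#)
    coefficient≈ (+ suc (suc n))   = refl
    coefficient≈ -[1+ n ]          = refl

    -- Integer coefficients let the solver normalise numerical constants in ℤ. Since `con (+ n)`
    -- evaluates to `1#` for n = 1 and to `fromℕ n` otherwise, literals in goals match the solver's
    -- terms definitionally.
    integers : ℤ.+-*-rawRing -Raw-AlmostCommutative⟶ fromCommutativeRing commutativeRing
    integers = record
      { ⟦_⟧    = coefficient
      ; +-homo = λ i j → trans (coefficient≈ (i ℤ.+ j))
                   (trans (fromℤ-+ i j) (sym (+-cong (coefficient≈ i) (coefficient≈ j))))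
      ; *-homo = λ i j → trans (coefficient≈ (i ℤ.* j))
                   (trans (fromℤ-* i j) (sym (*-cong (coefficient≈ i) (coefficient≈ j))))
      ; -‿homo = λ i → trans (coefficient≈ (ℤ.- i))
                   (trans (fromℤ-neg i) (sym (-‿cong (coefficient≈ i))))
      ; 0-homo = refl
      ; 1-homo = refl
      }

    _≟ℤ_ : ∀ i j → Maybe (coefficient i ≈ coefficient j)
    i ≟ℤ j = Maybe.map (λ e → reflexive (≡.cong coefficient e)) (dec⇒maybe (i ℤ.≟ j))

  open RingSolver ℤ.+-*-rawRing (fromCommutativeRing commutativeRing) integers _≟ℤ_ public
    using (solve; con; _:=_; _:+_; _:*_; _:-_; :-_; Polynomial)

  module ≈-Reasoning = SetoidReasoning setoid

  -- A linear or polynomial inequality x ≤ y is certified by a manifestly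
  -- nonnegative s with y = x + s, the equation being left to the ring solver.
  certify : ∀ {x y s} → 0# ≤ s → y ≈ x + s → x ≤ y
  certify {x} {y} {s} 0≤s e =
    ≤-resp-≈ (+-identityˡ x) (trans (+-comm s x) (sym e)) (+-monoˡ-≤ x 0≤s)

  x≤y⇒0≤y-x : ∀ {x y} → x ≤ y → 0# ≤ y - x
  x≤y⇒0≤y-x {x} h = ≤-resp-≈ (-‿inverseʳ x) refl (+-monoˡ-≤ (- x) h)

  0≤+ : ∀ {x y} → 0# ≤ x → 0# ≤ y → 0# ≤ x + y
  0≤+ {x} {y} hx hy = ≤-trans hx (certify hy refl)

  0≤* : ∀ {x y} → 0# ≤ x → 0# ≤ y → 0# ≤ x * y
  0≤* = *-nonNegative

  infixl 6 _⊕_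
  infixl 7 _⊗_
  _⊕_ : ∀ {x y} → 0# ≤ x → 0# ≤ y → 0# ≤ x + y
  _⊕_ = 0≤+
  _⊗_ : ∀ {x y} → 0# ≤ x → 0# ≤ y → 0# ≤ x * y
  _⊗_ = 0≤*

  +-mono-≤ : ∀ {x y u v} → x ≤ y → u ≤ v → x + u ≤ y + v
  +-mono-≤ {x} {y} {u} {v} h k = certify (x≤y⇒0≤y-x h ⊕ x≤y⇒0≤y-x k)
    (solve 4 (λ x y u v → y :+ v := (x :+ u) :+ ((y :- x) :+ (v :- u))) refl x y u v)

  *-monoˡ-≤ : ∀ {z x y} → 0# ≤ z → x ≤ y → z * x ≤ z * y
  *-monoˡ-≤ {z} {x} {y} 0≤z h = certify (0≤z ⊗ x≤y⇒0≤y-x h)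
    (solve 3 (λ z x y → z :* y := z :* x :+ z :* (y :- x)) refl z x y)

  *-monoʳ-≤ : ∀ {z x y} → 0# ≤ z → x ≤ y → x * z ≤ y * z
  *-monoʳ-≤ {z} {x} {y} 0≤z h = ≤-resp-≈ (*-comm z x) (*-comm z y) (*-monoˡ-≤ 0≤z h)

  *-mono-≤ : ∀ {x y u v} → 0# ≤ x → 0# ≤ v → x ≤ y → u ≤ v → x * u ≤ y * v
  *-mono-≤ 0≤x 0≤v h k = ≤-trans (*-monoˡ-≤ 0≤x k) (*-monoʳ-≤ 0≤v h)

  neg-mono-≤ : ∀ {x y} → x ≤ y → - y ≤ - x
  neg-mono-≤ {x} {y} h = certify (x≤y⇒0≤y-x h) (solve 2 (λ x y → :- x := :- y :+ (y :- x)) refl x y)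

  0≤x² : ∀ x → 0# ≤ x * x
  0≤x² x with total 0# x
  ... | inj₁ h = h ⊗ h
  ... | inj₂ h = ≤-resp-≈ refl (solve 1 (λ x → (con (+ 0) :- x) :* (con (+ 0) :- x) := x :* x) refl x)
                   (x≤y⇒0≤y-x h ⊗ x≤y⇒0≤y-x h)

  ≰⇒> : ∀ {x y} → ¬ (x ≤ y) → y < x
  ≰⇒> {x} {y} h with total x y
  ... | inj₁ k = contradiction k h
  ... | inj₂ k = k , λ e → h (≤-reflexive (sym e))

  <⇒≱ : ∀ {x y} → x < y → ¬ (y ≤ x)
  <⇒≱ (h , x≉y) k = x≉y (antisym h k)

  <-≤-trans : ∀ {x y z} → x < y → y ≤ z → x < z
  <-≤-trans h k = ≰⇒> λ z≤x → <⇒≱ h (≤-trans k z≤x)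

  ≤-<-trans : ∀ {x y z} → x ≤ y → y < z → x < z
  ≤-<-trans h k = ≰⇒> λ z≤x → <⇒≱ k (≤-trans z≤x h)

  <-resp-≈ : ∀ {x x′ y y′} → x ≈ x′ → y ≈ y′ → x < y → x′ < y′
  <-resp-≈ e f h = ≤-<-trans (≤-reflexive (sym e)) (<-≤-trans h (≤-reflexive f))

  pos⇒≉0 : ∀ {x} → 0# < x → ¬ (x ≈ 0#)
  pos⇒≉0 (_ , n) e = n (sym e)

  x*y≈0⇒y≈0 : ∀ {x y} → ¬ (x ≈ 0#) → x * y ≈ 0# → y ≈ 0#
  x*y≈0⇒y≈0 {x} {y} x≉0 e = begin
    y              ≈⟨ *-identityˡ y ⟨
    1# * y         ≈⟨ *-congʳ (⁻¹-inverseʳ x≉0) ⟨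
    x * x ⁻¹ * y   ≈⟨ solve 3 (λ x i y → x :* i :* y := i :* (x :* y)) refl x (x ⁻¹) y ⟩
    x ⁻¹ * (x * y) ≈⟨ *-congˡ e ⟩
    x ⁻¹ * 0#      ≈⟨ zeroʳ _ ⟩
    0#             ∎
    where open ≈-Reasoning

  0<* : ∀ {x y} → 0# < x → 0# < y → 0# < x * y
  0<* hx hy = 0≤* (proj₁ hx) (proj₁ hy) , λ e → pos⇒≉0 hy (x*y≈0⇒y≈0 (pos⇒≉0 hx) (sym e))

  0<+ : ∀ {x y} → 0# < x → 0# ≤ y → 0# < x + y
  0<+ hx hy = <-≤-trans hx (certify hy refl)

  *-cancelˡ-≤ : ∀ {z x y} → 0# < z → z * x ≤ z * y → x ≤ y
  *-cancelˡ-≤ {z} {x} {y} 0<z h with x ≤? y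
  ... | yes k = k
  ... | no ¬k = contradiction h (<⇒≱ (*-monoˡ-≤ (proj₁ 0<z) (proj₁ y<x) , λ e →
        proj₂ y<x (sym (trans (solve 2 (λ x y → x := (x :- y) :+ y) refl x y)
          (trans (+-congʳ (x*y≈0⇒y≈0 {z} {x - y} (pos⇒≉0 0<z) (trans
            (solve 3 (λ z x y → z :* (x :- y) := z :* x :- z :* y) refl z x y)
            (trans (+-congˡ (-‿cong e)) (-‿inverseʳ _))))) (+-identityˡ y))))))
    where y<x = ≰⇒> ¬k

  -- If y < x, then x + y > 0 can be cancelled from (x + y) x ≤ (x + y) y. As x may have either
  -- sign, this turns Cauchy-Schwarz in squared form into a bound on the inner product itself.
  square-≤⇒≤ : ∀ {x y} → 0# ≤ y → x * x ≤ y * y → x ≤ y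
  square-≤⇒≤ {x} {y} 0≤y h with x ≤? y
  ... | yes k = k
  ... | no ¬k = *-cancelˡ-≤ {x + y} (<-≤-trans (≤-<-trans 0≤y y<x) (certify 0≤y refl))
          (certify (x≤y⇒0≤y-x h)
            (solve 2 (λ x y → (x :+ y) :* y := (x :+ y) :* x :+ (y :* y :- x :* x)) refl x y))
    where y<x = ≰⇒> ¬k

  0≤1 : 0# ≤ 1#
  0≤1 = ≤-resp-≈ refl (*-identityˡ 1#) (0≤x² 1#)

  0<1 : 0# < 1#
  0<1 = 0≤1 , λ e → 1≉0 (sym e)

  fromℕ-+ : ∀ m n → fromℕ (m ℕ.+ n) ≈ fromℕ m + fromℕ n
  fromℕ-+ = ×-homo-+ 1#

  fromℕ-* : ∀ m n → fromℕ (m ℕ.* n) ≈ fromℕ m * fromℕ n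
  fromℕ-* = ×1-homo-*

  0≤fromℕ : ∀ n → 0# ≤ fromℕ n
  0≤fromℕ zero    = ≤-refl
  0≤fromℕ (suc n) = 0≤1 ⊕ 0≤fromℕ n

  0<fromℕ-suc : ∀ n → 0# < fromℕ (suc n)
  0<fromℕ-suc n = 0<+ 0<1 (0≤fromℕ n)

  0<fromℕ : ∀ n → .{{_ : ℕ.NonZero n}} → 0# < fromℕ n
  0<fromℕ (suc n) = 0<fromℕ-suc n

  fromℕ-mono-≤ : ∀ {m n} → m ℕ.≤ n → fromℕ m ≤ fromℕ n
  fromℕ-mono-≤ {n = n} ℕ.z≤n   = 0≤fromℕ n
  fromℕ-mono-≤ (ℕ.s≤s h)       = +-mono-≤ ≤-refl (fromℕ-mono-≤ h)

  x<1+x : ∀ x → x < 1# + x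
  x<1+x x = ≰⇒> λ h → <⇒≱ 0<1 (certify (x≤y⇒0≤y-x h)
      (solve 1 (λ x → con (+ 0) := con (+ 1) :+ (x :- (con (+ 1) :+ x))) refl x ))

  0≤⁻¹ : ∀ {x} → 0# < x → 0# ≤ x ⁻¹
  0≤⁻¹ {x} h = *-cancelˡ-≤ h (≤-resp-≈ (sym (zeroʳ x)) (sym (⁻¹-inverseʳ (pos⇒≉0 h))) 0≤1)

  0<⁻¹ : ∀ {x} → 0# < x → 0# < x ⁻¹
  0<⁻¹ {x} h = 0≤⁻¹ h , λ e → 1≉0 (trans (sym (⁻¹-inverseʳ (pos⇒≉0 h)))
      (trans (*-congˡ (sym e)) (zeroʳ x)))

  0≤^ : ∀ {x} n → 0# ≤ x → 0# ≤ x ^ n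
  0≤^ zero    h = 0≤1
  0≤^ (suc n) h = h ⊗ 0≤^ n h

  0<^ : ∀ {x} n → 0# < x → 0# < x ^ n
  0<^ zero    h = 0<1
  0<^ (suc n) h = 0<* h (0<^ n h)

  ^-mono-≤ : ∀ {x y} n → 0# ≤ x → x ≤ y → x ^ n ≤ y ^ n
  ^-mono-≤ zero    0≤x h = ≤-refl
  ^-mono-≤ (suc n) 0≤x h = *-mono-≤ 0≤x (0≤^ n (≤-trans 0≤x h)) h (^-mono-≤ n 0≤x h)

  ^-distrib-* : ∀ x y n → (x * y) ^ n ≈ x ^ n * y ^ n
  ^-distrib-* x y zero    = sym (*-identityˡ 1#)
  ^-distrib-* x y (suc n) = trans (*-congˡ (^-distrib-* x y n))
    (solve 4 (λ x y u v → x :* y :* (u :* v) := x :* u :* (y :* v)) refl x y (x ^ n) (y ^ n))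

  1^ : ∀ n → 1# ^ n ≈ 1#
  1^ zero    = refl
  1^ (suc n) = trans (*-identityˡ _) (1^ n)

  ≤⁻¹-shift : ∀ {x y z} → 0# < z → x * z ≤ y → x ≤ y * z ⁻¹
  ≤⁻¹-shift {x} {y} {z} 0<z h = *-cancelˡ-≤ 0<z (≤-resp-≈ (*-comm x z)
    (trans (sym (trans (*-congˡ (⁻¹-inverseʳ (pos⇒≉0 0<z))) (trans (*-comm y 1#) (*-identityˡ y))))
       (solve 3 (λ y z i → y :* (z :* i) := z :* (y :* i)) refl y z (z ⁻¹))) h)

-- Consequences of completeness: the Archimedean property, square roots and binary logarithms.

module Completeness (ℝ : Reals) where
  open Reals ℝ
  open OrderedField ℝ
  open SemiringExp semiring using (^-homo-*; ^-assocʳ)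

  -- The supremum s of the naturals below a positive x is exceeded by n + 1 for some such n > s - 1,
  -- so n + 1 cannot itself be below x.
  ∃-fromℕ≥ : ∀ x → ∃[ n ] x ≤ fromℕ n
  ∃-fromℕ≥ x with x ≤? 0#
  ... | yes x≤0 = 0 , x≤0
  ... | no  x≰0 = from-lower (proj₂ isSup (sup P - 1#) sup-1<sup)
    where
    P : Pred Carrier 0ℓ
    P y = ∃[ n ] (fromℕ n ≤ x × y ≈ fromℕ n)

    isSup : IsSupremum P (sup P)
    isSup = sup-isSupremum P (0# , 0 , proj₁ (≰⇒> x≰0) , refl)
      (x , λ { y (n , h , e) → ≤-resp-≈ (sym e) refl h })

    sup-1<sup : sup P - 1# < sup P
    sup-1<sup = <-resp-≈ refl (solve 1 (λ s → con (+ 1) :+ (s :- con (+ 1)) := s) refl (sup P))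
                  (x<1+x (sup P - 1#))

    from-lower : ∃[ y ] (P y × sup P - 1# < y) → ∃[ n ] x ≤ fromℕ n
    from-lower (y , (n , _ , y≈n) , lt) with x ≤? fromℕ (suc n)
    ... | yes h = suc n , h
    ... | no ¬h = contradiction (proj₁ isSup _ (suc n , proj₁ (≰⇒> ¬h) , refl)) (<⇒≱ sup<1+n)
      where
      sup<1+n : sup P < 1# + fromℕ n
      sup<1+n = ≰⇒> λ h → <⇒≱ lt (certify (x≤y⇒0≤y-x h)
        (trans (solve 2 (λ s n → s :- con (+ 1) := n :+ (s :- (con (+ 1) :+ n))) refl (sup P) (fromℕ n))
          (+-congʳ (sym y≈n))))

  -- The supremum s of {y : y² ≤ x} has s² = x: if s² < x, then
  -- s + (x - s²)/(2 s + 1 + x) is still in the set; if s² > x, then the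
  -- Newton iterate (s + x/s)/2 < s still bounds it.
  module _ {x : Carrier} (0≤x : 0# ≤ x) where
    private
      s = √ x

      isSup : IsSupremum (λ y → y * y ≤ x) s
      isSup = sup-isSupremum _ (0# , ≤-resp-≈ (sym (zeroˡ 0#)) refl 0≤x) (1# + x , λ y h →
        square-≤⇒≤ (0≤1 ⊕ 0≤x) (≤-trans h (certify (0≤1 ⊕ 0≤x ⊕ 0≤x² x)
          (solve 1 (λ x → (con (+ 1) :+ x) :* (con (+ 1) :+ x) := x :+ (con (+ 1) :+ x :+ x :* x)) refl
              x))))

    √-nonNegative : 0# ≤ √ x
    √-nonNegative = proj₁ isSup 0# (≤-resp-≈ (sym (zeroˡ 0#)) refl 0≤x)

    private
      ≤s² : x ≤ s * s
      ≤s² with x ≤? s * s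
      ... | yes h = h
      ... | no ¬h = contradiction (proj₁ isSup (s + h′) in-set) (<⇒≱ s<s+h′)
        where
        gap = x≤y⇒0≤y-x (proj₁ (≰⇒> ¬h))
        D = fromℕ 2 * s + 1# + x
        0<D : 0# < D
        0<D = <-resp-≈ refl (solve 2 (λ s x → con (+ 1) :+ (con (+ 2) :* s :+ x) := con (+ 2) :* s :+ con
            (+ 1) :+ x) refl s x)
                (0<+ 0<1 (0≤fromℕ 2 ⊗ √-nonNegative ⊕ 0≤x))
        h′ = (x - s * s) * D ⁻¹
        0≤h′ : 0# ≤ h′
        0≤h′ = gap ⊗ 0≤⁻¹ 0<D
        h′D : h′ * D ≈ x - s * s
        h′D = trans (solve 3 (λ g i d → g :* i :* d := g :* (d :* i)) refl (x - s * s) (D ⁻¹) D)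
                (trans (*-congˡ (⁻¹-inverseʳ (pos⇒≉0 0<D))) (trans (*-comm _ _) (*-identityˡ _)))
        0≤s² = 0≤x² s
        h′≤x : h′ ≤ x
        h′≤x = *-cancelˡ-≤ 0<D (≤-resp-≈ (trans (sym h′D) (*-comm _ _)) refl
          (certify (0≤s² ⊕ (0≤fromℕ 2 ⊗ √-nonNegative ⊕ 0≤x) ⊗ 0≤x)
            (solve 2 (λ s x → (con (+ 2) :* s :+ con (+ 1) :+ x) :* x := x :- s :* s :+
                (s :* s :+ (con (+ 2) :* s :+ x) :* x)) refl s x)))
        -- By h′ ≤ x, the denominator D is larger than 2 s + h′, so the square grows by h′ (2 s +
        -- h′) ≤ h′ D = x - s².
        in-set : (s + h′) * (s + h′) ≤ x
        in-set = certify (0≤h′ ⊗ (0≤1 ⊕ x≤y⇒0≤y-x h′≤x)) (begin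
          x                           ≈⟨ solve 2 (λ x s → x := s :* s :+ (x :- s :* s)) refl x s ⟩
          s * s + (x - s * s)         ≈⟨ +-congˡ h′D ⟨
          s * s + h′ * D              ≈⟨ solve 3 (λ x s h → s :* s :+ h :*
              (con (+ 2) :* s :+ con (+ 1) :+ x)
                                           := (s :+ h) :* (s :+ h) :+ h :* (con (+ 1) :+ (x :- h))) refl
                                               x s h′ ⟩
          (s + h′) * (s + h′) + h′ * (1# + (x - h′)) ∎)
          where open ≈-Reasoning
        s<s+h′ : s < s + h′
        s<s+h′ = ≰⇒> λ k → ¬h (certify (x≤y⇒0≤y-x k ⊗ proj₁ 0<D) (trans (solve 4 (λ x s h d →
            s :* s := x :+ (s :- (s :+ h)) :* d :+ (h :* d :- (x :- s :* s)) ) refl x s h′ D)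
              (trans (+-congˡ (trans (+-congʳ h′D) (-‿inverseʳ _)))
                  (trans (+-comm _ _) (+-identityˡ _)))))

      s²≤ : s * s ≤ x
      s²≤ with s * s ≤? x
      ... | yes h = h
      ... | no ¬h = contradiction y<s λ y<s′ → no-larger (proj₂ isSup y y<s′)
        where
        x<s² = ≰⇒> ¬h
        0<s : 0# < s
        0<s = √-nonNegative , λ e → <⇒≱ x<s² (≤-trans (≤-reflexive (trans (*-congʳ (sym e)) (zeroˡ s)))
            0≤x)
        D = fromℕ 2 * s
        0<D : 0# < D
        0<D = 0<* (0<fromℕ-suc 1) 0<s
        y = (s * s + x) * D ⁻¹
        yD : y * D ≈ s * s + x
        yD = trans (solve 3 (λ g i d → g :* i :* d := g :* (d :* i)) refl (s * s + x) (D ⁻¹) D)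
                (trans (*-congˡ (⁻¹-inverseʳ (pos⇒≉0 0<D))) (trans (*-comm _ _) (*-identityˡ _)))
        0≤y : 0# ≤ y
        0≤y = (0≤x² s ⊕ 0≤x) ⊗ 0≤⁻¹ 0<D
        y<s : y < s
        y<s = ≰⇒> λ h → ¬h (certify (x≤y⇒0≤y-x (*-monoˡ-≤ (proj₁ 0<D) h)) (trans
          (solve 4 (λ s x y d → x := s :* s :+ (d :* y :- d :* s) :+ (d :* s :- con (+ 2) :* s :* s) :-
              (y :* d :- (s :* s :+ x))) refl s x y D)
          (trans (+-cong (trans (+-congˡ (-‿inverseʳ _)) (trans (+-comm _ _) (+-identityˡ _)))
             (-‿cong (trans (+-congʳ yD) (-‿inverseʳ _))))
                 (solve 1 (λ z → z :- con (+ 0) := z) refl _))))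
        -- Arithmetic and geometric mean: (s² + x)² - 4 s² x = (s² - x)².
        x≤y² : x ≤ y * y
        x≤y² = *-cancelˡ-≤ (0<* 0<D 0<D) (certify (0≤x² (s * s - x)) (begin
          D * D * (y * y)             ≈⟨ solve 2 (λ d y → d :* d :* (y :* y) := y :* d :* (y :* d)) refl
              D y ⟩
          y * D * (y * D)             ≈⟨ *-cong yD yD ⟩
          (s * s + x) * (s * s + x)   ≈⟨ solve 2 (λ s x → (s :* s :+ x) :* (s :* s :+ x) := con (+ 2) :*
              s :* (con (+ 2) :* s) :* x
                                            :+ (s :* s :- x) :* (s :* s :- x)) refl s x ⟩
          D * D * x + (s * s - x) * (s * s - x) ∎))
          where open ≈-Reasoning
        no-larger : ¬ (∃[ z ] (z * z ≤ x × y < z))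
        no-larger (z , z²≤x , y<z) = <⇒≱ y<z (square-≤⇒≤ 0≤y (≤-trans z²≤x x≤y²))

    √-square : √ x * √ x ≈ x
    √-square = antisym s²≤ ≤s²

  bernoulli : ∀ {h} m → 0# ≤ h → 1# + fromℕ m * h ≤ (1# + h) ^ m
  bernoulli {h} zero    0≤h = ≤-reflexive (trans (+-congˡ (zeroˡ h)) (+-identityʳ 1#))
  bernoulli {h} (suc m) 0≤h = ≤-trans
    (certify (0≤fromℕ m ⊗ (0≤x² h)) (solve 2 (λ h m → (con (+ 1) :+ h) :* (con (+ 1) :+ m :* h)
       := con (+ 1) :+ (con (+ 1) :+ m) :* h :+ m :* (h :* h)) refl h (fromℕ m)))
    (*-monoˡ-≤ (0≤1 ⊕ 0≤h) (bernoulli m 0≤h))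

  fromℕ≤2^ : ∀ n → fromℕ n ≤ fromℕ 2 ^ n
  fromℕ≤2^ n = ≤-trans (certify 0≤1 (solve 1 (λ n → con (+ 1) :+ n :* con (+ 1) := n :+ con (+ 1)) refl
      (fromℕ n)))
     (≤-trans (bernoulli n 0≤1) (≤-reflexive
         (SemiringExp.^-congˡ semiring n (solve 0 (con (+ 1) :+ con (+ 1) := con (+ 2)) refl))))

  1≤2^ : ∀ n → 1# ≤ fromℕ 2 ^ n
  1≤2^ n = ≤-trans (≤-reflexive (sym (1^ n))) (^-mono-≤ n 0≤1
      (certify 0≤1 (solve 0 (con (+ 2) := con (+ 1) :+ con (+ 1)) refl)))

  2^-reflects-≤ : ∀ {m n} → fromℕ 2 ^ m ≤ fromℕ 2 ^ n → m ℕ.≤ n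
  2^-reflects-≤ {m} {n} h with m ℕ.≤? n
  ... | yes k = k
  ... | no ¬k = contradiction h (<⇒≱ (<-≤-trans 2^n<2^1+n 2^1+n≤2^m))
    where
    2^n<2^1+n : fromℕ 2 ^ n < fromℕ 2 ^ suc n
    2^n<2^1+n = ≰⇒> λ l → <⇒≱ (0<^ n (0<fromℕ-suc 1)) (certify (x≤y⇒0≤y-x l)
      (solve 1 (λ p → con (+ 0) := p :+ (p :- con (+ 2) :* p)) refl (fromℕ 2 ^ n)))
    e = ℕ.≰⇒> ¬k
    2^1+n≤2^m : fromℕ 2 ^ suc n ≤ fromℕ 2 ^ m
    2^1+n≤2^m = ≤-trans (≤-trans (≤-reflexive (sym (*-identityˡ _)))
      (*-monoʳ-≤ (0≤^ (suc n) (0≤fromℕ 2)) (1≤2^ (m ℕ.∸ suc n))))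
      (≤-reflexive (trans (sym (^-homo-* (fromℕ 2) (m ℕ.∸ suc n) (suc n)))
          (reflexive (≡.cong (fromℕ 2 ^_) (ℕ.m∸n+n≡m e)))))

  -- If 2^k < x, then (x/2^k)^m ≥ 2 for some m, so k + 1/m lies in the lower
  -- cut of log x.
  log≤⇒≤2^ : ∀ {x} k → 0# < x → log x ≤ fromℕ k → x ≤ fromℕ 2 ^ k
  log≤⇒≤2^ {x} k 0<x log≤k with x ≤? fromℕ 2 ^ k
  ... | yes h = h
  ... | no ¬h = contradiction (≤-trans y≤log log≤k) (<⇒≱ k<y)
    where
    B = fromℕ 2 ^ k
    0<B : 0# < B
    0<B = 0<^ k (0<fromℕ-suc 1)
    z = x * B ⁻¹
    h = z - 1#
    zB : z * B ≈ x
    zB = trans (solve 3 (λ x i b → x :* i :* b := x :* (b :* i)) refl x (B ⁻¹) B)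
           (trans (*-congˡ (⁻¹-inverseʳ (pos⇒≉0 0<B))) (trans (*-comm _ _) (*-identityˡ _)))
    1<z : 1# < z
    1<z = ≰⇒> λ l → ¬h (≤-resp-≈ zB (*-identityˡ B) (*-monoʳ-≤ (proj₁ 0<B) l))
    0<h : 0# < h
    0<h = ≰⇒> λ l → <⇒≱ 1<z (certify (x≤y⇒0≤y-x l)
        (solve 1 (λ z → con (+ 1) := z :+ (con (+ 0) :- (z :- con (+ 1)))) refl z))
    bound = ∃-fromℕ≥ (h ⁻¹)
    q = proj₁ bound
    m = suc q
    -- Bernoulli's inequality with z = 1 + h and m h ≥ 1.
    2≤z^m : fromℕ 2 ≤ z ^ m
    2≤z^m = ≤-trans (certify (x≤y⇒0≤y-x (*-monoʳ-≤ (proj₁ 0<h) (proj₂ bound)) ⊕ proj₁ 0<h) (trans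
        (solve 3 (λ h i n → con (+ 1) :+ (con (+ 1) :+ n) :* h := con (+ 2) :+ ((n :* h :- i :* h) :+ h)
            :+ (h :* i :- con (+ 1))) refl h (h ⁻¹) (fromℕ q))
        (trans (+-congˡ (trans (+-congʳ (⁻¹-inverseʳ (pos⇒≉0 0<h))) (-‿inverseʳ _))) (+-identityʳ _))))
      (≤-trans (bernoulli m (proj₁ 0<h)) (≤-reflexive
          (SemiringExp.^-congˡ semiring m (solve 1 (λ z → con (+ 1) :+ (z :- con (+ 1)) := z) refl z))))
    power : fromℕ 2 ^ suc (k ℕ.* m) ≤ fromℕ 2 ^ 0 * x ^ m
    power = ≤-resp-≈ (*-congˡ (^-assocʳ (fromℕ 2) k m))
      (trans (sym (^-distrib-* z B m)) (trans (SemiringExp.^-congˡ semiring m zB) (sym (*-identityˡ _))))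
      (*-monoʳ-≤ (0≤^ m (proj₁ 0<B)) 2≤z^m)
    M = fromℕ m
    0<M : 0# < M
    0<M = 0<fromℕ-suc q
    y = (1# + fromℕ (k ℕ.* m)) * M ⁻¹
    yM : y * M ≈ 1# + fromℕ (k ℕ.* m)
    yM = trans (solve 3 (λ x i b → x :* i :* b := x :* (b :* i)) refl _ (M ⁻¹) M)
           (trans (*-congˡ (⁻¹-inverseʳ (pos⇒≉0 0<M))) (trans (*-comm _ _) (*-identityˡ _)))
    in-cut : LowerCutOfLog x y
    in-cut = suc (k ℕ.* m) , 0 , q , power , trans yM (solve 1 (λ a → a := a :- con (+ 0)) refl _)
    k<y : fromℕ k < y
    k<y = ≰⇒> λ l → <⇒≱ (x<1+x (fromℕ (k ℕ.* m)))
        (≤-resp-≈ yM (sym (fromℕ-* k m)) (*-monoʳ-≤ (proj₁ 0<M) l))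
    -- `sup` says something about the cut only once the cut is known to be bounded; any N with x ≤
    -- 2^N is a bound.
    N = proj₁ (∃-fromℕ≥ x)
    x≤2^N : x ≤ fromℕ 2 ^ N
    x≤2^N = ≤-trans (proj₂ (∃-fromℕ≥ x)) (fromℕ≤2^ N)
    upper : IsUpperBound (LowerCutOfLog x) (fromℕ N)
    upper w (u , v , r , pow , e) = *-cancelˡ-≤ (0<fromℕ-suc r)
        (≤-trans (≤-reflexive (trans (*-comm _ _) e))
      (certify (x≤y⇒0≤y-x (≤-resp-≈ refl (trans (fromℕ-+ v (N ℕ.* suc r)) (+-congˡ (fromℕ-* N (suc r))))
          (fromℕ-mono-≤ u≤)))
        (solve 4 (λ u v n r → r :* n := u :- v :+ (v :+ n :* r :- u)) refl (fromℕ u) (fromℕ v) (fromℕ N)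
            (fromℕ (suc r)))))
      where
      u≤ : u ℕ.≤ v ℕ.+ N ℕ.* suc r
      u≤ = 2^-reflects-≤ (≤-trans pow (≤-trans
          (*-monoˡ-≤ (0≤^ v (0≤fromℕ 2)) (^-mono-≤ (suc r) (proj₁ 0<x) x≤2^N))
        (≤-reflexive (trans (*-congˡ (^-assocʳ (fromℕ 2) N (suc r)))
            (sym (^-homo-* (fromℕ 2) v (N ℕ.* suc r)))))))
    y≤log : y ≤ log x
    y≤log = proj₁ (sup-isSupremum (LowerCutOfLog x) (y , in-cut) (fromℕ N , upper)) y in-cut

-- Sums over lists and indicators of decidable events.

module ListSum (ℝ : Reals) where
  open Reals ℝ
  open OrderedField ℝ
  open ≈-Reasoning

  private
    variable
      X Y : Set

  ∑ : (X → Carrier) → List X → Carrier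
  ∑ f []       = 0#
  ∑ f (x ∷ xs) = f x + ∑ f xs

  ∑-cong : {f g : X → Carrier} → (∀ x → f x ≈ g x) → ∀ xs → ∑ f xs ≈ ∑ g xs
  ∑-cong h []       = refl
  ∑-cong h (x ∷ xs) = +-cong (h x) (∑-cong h xs)

  ∑-mono-All : {f g : X → Carrier} → ∀ {xs} → All (λ x → f x ≤ g x) xs → ∑ f xs ≤ ∑ g xs
  ∑-mono-All []       = ≤-refl
  ∑-mono-All (h ∷ hs) = +-mono-≤ h (∑-mono-All hs)

  ∑-mono : {f g : X → Carrier} → (∀ x → f x ≤ g x) → ∀ xs → ∑ f xs ≤ ∑ g xs
  ∑-mono h xs = ∑-mono-All (All.universal h xs)

  ∑-nonNegative : {f : X → Carrier} → (∀ x → 0# ≤ f x) → ∀ xs → 0# ≤ ∑ f xs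
  ∑-nonNegative h []       = ≤-refl
  ∑-nonNegative h (x ∷ xs) = h x ⊕ ∑-nonNegative h xs

  ∑-+ : (f g : X → Carrier) → ∀ xs → ∑ (λ x → f x + g x) xs ≈ ∑ f xs + ∑ g xs
  ∑-+ f g []       = sym (+-identityˡ 0#)
  ∑-+ f g (x ∷ xs) = trans (+-congˡ (∑-+ f g xs))
    (solve 4 (λ a b c d → (a :+ b) :+ (c :+ d) := (a :+ c) :+ (b :+ d)) refl (f x) (g x) (∑ f xs)
        (∑ g xs))

  ∑-*ˡ : ∀ c (f : X → Carrier) xs → ∑ (λ x → c * f x) xs ≈ c * ∑ f xs
  ∑-*ˡ c f []       = sym (zeroʳ c)
  ∑-*ˡ c f (x ∷ xs) = trans (+-congˡ (∑-*ˡ c f xs)) (sym (distribˡ c _ _))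

  ∑-const : ∀ c (xs : List X) → ∑ (λ _ → c) xs ≈ fromℕ (length xs) * c
  ∑-const c []       = sym (zeroˡ c)
  ∑-const c (x ∷ xs) = trans (+-congˡ (∑-const c xs))
    (solve 2 (λ c n → c :+ n :* c := (con (+ 1) :+ n) :* c) refl c (fromℕ (length xs)))

  ∑-map : (f : Y → Carrier) (h : X → Y) → ∀ xs → ∑ f (map h xs) ≡ ∑ (f ∘ h) xs
  ∑-map f h []       = ≡.refl
  ∑-map f h (x ∷ xs) = ≡.cong (λ a → _ + a) (∑-map f h xs)

  ∑-++ : (f : X → Carrier) → ∀ xs ys → ∑ f (xs List.++ ys) ≈ ∑ f xs + ∑ f ys
  ∑-++ f []       ys = sym (+-identityˡ _)
  ∑-++ f (x ∷ xs) ys = trans (+-congˡ (∑-++ f xs ys)) (sym (+-assoc _ _ _))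

  ∑-sum : ∀ {n} (f : Fin n → X → Carrier) xs → ∑ (λ x → sum (λ l → f l x)) xs ≈ sum (λ l → ∑ (f l) xs)
  ∑-sum {n = n} f []       = sym (trans (SemiringSum.sum-replicate semiring n) (zero-multiple n))
    where
    zero-multiple : ∀ n → n · 0# ≈ 0#
    zero-multiple zero    = refl
    zero-multiple (suc n) = trans (+-identityˡ _) (zero-multiple n)
  ∑-sum f (x ∷ xs) = trans (+-congˡ (∑-sum f xs))
      (sym (SemiringSum.∑-distrib-+ semiring (λ l → f l x) (λ l → ∑ (f l) xs)))

  ∑-tabulate : ∀ {n} (f : X → Carrier) (g : Fin n → X) → ∑ f (tabulate g) ≡ sum (f ∘ g)
  ∑-tabulate {n = zero}  f g = ≡.refl
  ∑-tabulate {n = suc n} f g = ≡.cong (λ a → _ + a) (∑-tabulate f (g ∘ suc))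

  indicator : {A : Set} → Dec A → Carrier
  indicator d = if does d then 1# else 0#

  0≤indicator : {A : Set} (d : Dec A) → 0# ≤ indicator d
  0≤indicator (yes _) = 0≤1
  0≤indicator (no _)  = ≤-refl

  0≤1-indicator : {A : Set} (d : Dec A) → 0# ≤ 1# - indicator d
  0≤1-indicator (yes _) = ≤-reflexive (sym (-‿inverseʳ 1#))
  0≤1-indicator (no _)  = ≤-resp-≈ refl (solve 0 (con (+ 1) := con (+ 1) :- con (+ 0)) refl) 0≤1

  ∑-indicator : {P : Pred X 0ℓ} (P? : Decidable P) → ∀ xs →
                fromℕ (length (filter P? xs)) ≈ ∑ (λ x → indicator (P? x)) xs
  ∑-indicator P? []       = refl
  ∑-indicator P? (x ∷ xs) with does (P? x)
  ... | true  = +-congˡ (∑-indicator P? xs)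
  ... | false = trans (∑-indicator P? xs) (sym (+-identityˡ _))

-- Inner products, squared norms and the Cauchy-Schwarz inequality.

module InnerProduct (ℝ : Reals) where
  open Reals ℝ
  open OrderedField ℝ
  open MeanEstimation ℝ
  open ≈-Reasoning

  sum-cong : ∀ {n} {f g : Fin n → Carrier} → (∀ i → f i ≈ g i) → sum f ≈ sum g
  sum-cong h = SemiringSum.sum-cong-≋ semiring h

  sum-+ : ∀ {n} (f g : Fin n → Carrier) → sum (λ i → f i + g i) ≈ sum f + sum g
  sum-+ = SemiringSum.∑-distrib-+ semiring

  sum-*ˡ : ∀ {n} c (f : Fin n → Carrier) → sum (λ i → c * f i) ≈ c * sum f
  sum-*ˡ c f = sym (SemiringSum.*-distribˡ-sum semiring c f)

  sum-const : ∀ n c → sum {n} (λ _ → c) ≈ fromℕ n * c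
  sum-const zero    c = sym (zeroˡ c)
  sum-const (suc n) c = trans (+-congˡ (sum-const n c))
    (solve 2 (λ c n → c :+ n :* c := (con (+ 1) :+ n) :* c) refl c (fromℕ n))

  sum-nonNegative : ∀ {n} {f : Fin n → Carrier} → (∀ i → 0# ≤ f i) → 0# ≤ sum f
  sum-nonNegative {zero}  h = ≤-refl
  sum-nonNegative {suc n} h = h zero ⊕ sum-nonNegative (h ∘ suc)

  sum-mono : ∀ {n} {f g : Fin n → Carrier} → (∀ i → f i ≤ g i) → sum f ≤ sum g
  sum-mono {zero}  h = ≤-refl
  sum-mono {suc n} h = +-mono-≤ (h zero) (sum-mono (h ∘ suc))

  private
    variable
      d : ℕ

  infix 8 ⟨_,_⟩
  ⟨_,_⟩ : Point d → Point d → Carrier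
  ⟨ p , q ⟩ = sum (λ l → p l * q l)

  ⟨⟩-cong : {p p′ q q′ : Point d} → (∀ l → p l ≈ p′ l) → (∀ l → q l ≈ q′ l) → ⟨ p , q ⟩ ≈ ⟨ p′ , q′ ⟩
  ⟨⟩-cong h k = sum-cong λ l → *-cong (h l) (k l)

  ⟨⟩-comm : (p q : Point d) → ⟨ p , q ⟩ ≈ ⟨ q , p ⟩
  ⟨⟩-comm p q = sum-cong λ l → *-comm (p l) (q l)

  ⟨⟩-linearˡ : ∀ a b (p q r : Point d) → ⟨ (λ l → a * p l + b * q l) , r ⟩ ≈ a * ⟨ p , r ⟩ + b * ⟨ q , r
      ⟩
  ⟨⟩-linearˡ a b p q r = begin
    sum (λ l → (a * p l + b * q l) * r l)
      ≈⟨ sum-cong (λ l → solve 5 (λ a b p q r → (a :* p :+ b :* q) :* r := a :* (p :* r) :+ b :*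
          (q :* r)) refl a b (p l) (q l) (r l)) ⟩
    sum (λ l → a * (p l * r l) + b * (q l * r l))
      ≈⟨ sum-+ (λ l → a * (p l * r l)) (λ l → b * (q l * r l)) ⟩
    sum (λ l → a * (p l * r l)) + sum (λ l → b * (q l * r l))
      ≈⟨ +-cong (sum-*ˡ a (λ l → p l * r l)) (sum-*ˡ b (λ l → q l * r l)) ⟩
    a * ⟨ p , r ⟩ + b * ⟨ q , r ⟩ ∎

  -- The common source of all expansions of squared distances below: differences are taken with b =
  -- - 1, and descent steps with b = - t.
  ‖‖²-linear : ∀ a b (p q : Point d) →
    ‖ (λ l → a * p l + b * q l) ‖² ≈ a * a * ‖ p ‖² + fromℕ 2 * a * b * ⟨ p , q ⟩ + b * b * ‖ q ‖²
  ‖‖²-linear a b p q = begin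
    ⟨ w , w ⟩                                   ≈⟨ ⟨⟩-linearˡ a b p q w ⟩
    a * ⟨ p , w ⟩ + b * ⟨ q , w ⟩               ≈⟨ +-cong (*-congˡ (⟨⟩-comm p w)) (*-congˡ (⟨⟩-comm q w))
        ⟩
    a * ⟨ w , p ⟩ + b * ⟨ w , q ⟩               ≈⟨ +-cong (*-congˡ (⟨⟩-linearˡ a b p q p))
        (*-congˡ (⟨⟩-linearˡ a b p q q)) ⟩
    a * (a * ⟨ p , p ⟩ + b * ⟨ q , p ⟩) + b * (a * ⟨ p , q ⟩ + b * ⟨ q , q ⟩)
      ≈⟨ +-congʳ (*-congˡ (+-congˡ (*-congˡ (⟨⟩-comm q p)))) ⟩
    a * (a * ⟨ p , p ⟩ + b * ⟨ p , q ⟩) + b * (a * ⟨ p , q ⟩ + b * ⟨ q , q ⟩)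
      ≈⟨ solve 5 (λ a b x y z → a :* (a :* x :+ b :* y) :+ b :* (a :* y :+ b :* z) := a :* a :* x :+ con
          (+ 2) :* a :* b :* y :+ b :* b :* z) refl a b (⟨ p , p ⟩) (⟨ p , q ⟩) (⟨ q , q ⟩) ⟩
    a * a * ‖ p ‖² + fromℕ 2 * a * b * ⟨ p , q ⟩ + b * b * ‖ q ‖² ∎
    where
    w : Point _
    w l = a * p l + b * q l

  0≤‖‖² : (p : Point d) → 0# ≤ ‖ p ‖²
  0≤‖‖² p = sum-nonNegative (λ l → 0≤x² (p l))

  -- The vector ‖q‖² p - ⟨p , q⟩ q has squared norm ‖q‖² (‖p‖² ‖q‖² - ⟨p , q⟩²), and ‖q‖² cancels.
  cauchy-schwarz : (p q : Point d) → 0# < ‖ q ‖² → ⟨ p , q ⟩ * ⟨ p , q ⟩ ≤ ‖ p ‖² * ‖ q ‖²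
  cauchy-schwarz p q 0<Q = *-cancelˡ-≤ 0<Q (certify (0≤‖‖² (λ l → ‖ q ‖² * p l + (- ⟨ p , q ⟩) * q l))
    (begin
    ‖ q ‖² * (‖ p ‖² * ‖ q ‖²)
      ≈⟨ solve 3 (λ P D Q → Q :* (P :* Q) := Q :* (D :* D) :+
          (Q :* Q :* P :+ con (+ 2) :* Q :* (:- D) :* D :+ (:- D) :* (:- D) :* Q)) refl (‖ p ‖²)
          (⟨ p , q ⟩) (‖ q ‖²) ⟩
    ‖ q ‖² * (⟨ p , q ⟩ * ⟨ p , q ⟩) + (‖ q ‖² * ‖ q ‖² * ‖ p ‖² + fromℕ 2 * ‖ q ‖² * (- ⟨ p , q ⟩) * ⟨ p
        , q ⟩ + (- ⟨ p , q ⟩) * (- ⟨ p , q ⟩) * ‖ q ‖²)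
      ≈⟨ +-congˡ (‖‖²-linear (‖ q ‖²) (- ⟨ p , q ⟩) p q) ⟨
    _ ∎))

private
  variable
    X Y : Set

value-collect : (f : X → RAM Y) → ∀ xs → value (collect f xs) ≡ map (value ∘ f) xs
value-collect f []       = ≡.refl
value-collect f (x ∷ xs) = ≡.cong (λ ys → _ ∷ ys) (value-collect f xs)

-- Robustness of the median of real numbers.

module Robustness (ℝ : Reals) where
  open Reals ℝ
  open OrderedField ℝ
  open Completeness ℝ
  open ListSum ℝ
  open InnerProduct ℝ
  open MeanEstimation ℝ
  open ≈-Reasoning

  indicator-mono : {A B : Set} (a : Dec A) (b : Dec B) → (A → B) → indicator a ≤ indicator b
  indicator-mono (yes _) (yes _) _ = ≤-refl
  indicator-mono (yes x) (no ¬y) h = contradiction (h x) ¬y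
  indicator-mono (no _)  b       _ = 0≤indicator b

  far? : ∀ m τ x → Dec ((m - τ) * (m - τ) ≤ (x - τ) * (x - τ))
  far? m τ x = (m - τ) * (m - τ) ≤? (x - τ) * (x - τ)

  -- If τ ≤ m, every value at least m is as far from τ as m is, and these are half of all values. If
  -- m ≤ τ, the values at most m serve instead.
  half≤far : ∀ xs {m} → IsMedian xs m → ∀ τ →
             fromℕ (length xs) ≤ fromℕ 2 * ∑ (λ x → indicator (far? m τ x)) xs
  half≤far xs {m} (lower , upper) τ with total τ m
  ... | inj₁ τ≤m = ≤-trans (fromℕ-mono-≤ upper) (≤-trans (≤-reflexive
          (trans (fromℕ-* 2 (length (filter (m ≤?_) xs))) (*-congˡ (∑-indicator (m ≤?_) xs))))
          (*-monoˡ-≤ (0≤fromℕ 2) (∑-mono (λ x → indicator-mono (m ≤? x) (far? m τ x) λ m≤x →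
            certify (x≤y⇒0≤y-x m≤x ⊗ (x≤y⇒0≤y-x m≤x ⊕ 0≤fromℕ 2 ⊗ x≤y⇒0≤y-x τ≤m))
              (solve 3 (λ m τ x → (x :- τ) :* (x :- τ) := (m :- τ) :* (m :- τ) :+ (x :- m) :*
                  (x :- m :+ con (+ 2) :* (m :- τ))) refl m τ x)) xs)))
  ... | inj₂ m≤τ = ≤-trans (fromℕ-mono-≤ lower) (≤-trans (≤-reflexive
          (trans (fromℕ-* 2 (length (filter (_≤? m) xs))) (*-congˡ (∑-indicator (_≤? m) xs))))
          (*-monoˡ-≤ (0≤fromℕ 2) (∑-mono (λ x → indicator-mono (x ≤? m) (far? m τ x) λ x≤m →
            certify (x≤y⇒0≤y-x x≤m ⊗ (x≤y⇒0≤y-x x≤m ⊕ 0≤fromℕ 2 ⊗ x≤y⇒0≤y-x m≤τ))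
              (solve 3 (λ m τ x → (x :- τ) :* (x :- τ) := (m :- τ) :* (m :- τ) :+ (m :- x) :*
                  (m :- x :+ con (+ 2) :* (τ :- m))) refl m τ x)) xs)))

  -- At least half of the values are as far from τ as their median m, and at
  -- most a quarter of them is bad.
  median-deviation : {G : Pred X 0ℓ} (good? : Decidable G) (f : X → Carrier) (xs : List X) →
    fromℕ 3 * fromℕ (length xs) ≤ fromℕ 4 * ∑ (λ x → indicator (good? x)) xs →
    ∀ {m} → IsMedian (map f xs) m → ∀ τ →
    fromℕ (length xs) * ((m - τ) * (m - τ))
      ≤ fromℕ 4 * ∑ (λ x → indicator (good? x) * ((f x - τ) * (f x - τ))) xs
  median-deviation {X} good? f xs mostly-good {m} isMedian τ =
    ≤-trans (certify (0≤x² (m - τ) ⊗ (x≤y⇒0≤y-x mostly-good ⊕ 0≤fromℕ 2 ⊗ x≤y⇒0≤y-x half))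
      (solve 4 (λ S F g k → con (+ 4) :* (S :* (F :+ g :+ k :* (:- con (+ 1))))
         := k :* S :+ S :* (con (+ 4) :* g :- con (+ 3) :* k :+ con (+ 2) :* (con (+ 2) :* F :- k)))
        refl S (∑ far xs) (∑ good xs) k))
    (*-monoˡ-≤ (0≤fromℕ 4) (≤-trans (≤-reflexive (sym (begin
      ∑ (λ x → S * (far x + good x + (- 1#))) xs   ≈⟨ ∑-*ˡ S (λ x → far x + good x + (- 1#)) xs ⟩
      S * ∑ (λ x → far x + good x + (- 1#)) xs     ≈⟨ *-congˡ
          (∑-+ (λ x → far x + good x) (λ _ → - 1#) xs) ⟩
      S * (∑ (λ x → far x + good x) xs + ∑ (λ _ → - 1#) xs) ≈⟨ *-congˡ
          (+-cong (∑-+ far good xs) (∑-const (- 1#) xs)) ⟩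
      S * (∑ far xs + ∑ good xs + k * (- 1#)) ∎)))
      (∑-mono termwise xs)))
    where
    S = (m - τ) * (m - τ)
    k = fromℕ (length xs)
    far good : X → Carrier
    far x  = indicator (far? m τ (f x))
    good x = indicator (good? x)
    half : k ≤ fromℕ 2 * ∑ far xs
    half = ≤-resp-≈ (reflexive (≡.cong fromℕ (List.length-map f xs)))
      (*-congˡ (reflexive (∑-map (λ x → indicator (far? m τ x)) f xs))) (half≤far (map f xs) isMedian τ)
    -- far + good - 1 is 1 if x is both far and good, and at most 0 otherwise. Its sum is at least
    -- k/2 + 3k/4 - k = k/4, which is where the factor 4 comes from.
    termwise : ∀ x → S * (far x + good x + (- 1#)) ≤ good x * ((f x - τ) * (f x - τ))
    termwise x with far? m τ (f x) | good? x
    ... | yes h | yes _ = certify (x≤y⇒0≤y-x h) (solve 2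
        (λ S R → con (+ 1) :* R := S :* (con (+ 1) :+ con (+ 1) :+ (:- con (+ 1))) :+ (R :- S)) refl S _)
    ... | yes _ | no  _ = ≤-reflexive (solve 2
        (λ S R → S :* (con (+ 1) :+ con (+ 0) :+ (:- con (+ 1))) := con (+ 0) :* R) refl S _)
    ... | no  _ | yes _ = certify (0≤x² (f x - τ))
        (solve 2 (λ S R → con (+ 1) :* R := S :* (con (+ 0) :+ con (+ 1) :+ (:- con (+ 1))) :+ R) refl S
        _)
    ... | no  _ | no  _ = certify (0≤x² (m - τ)) (solve 2
        (λ S R → con (+ 0) :* R := S :* (con (+ 0) :+ con (+ 0) :+ (:- con (+ 1))) :+ S) refl S _)

-- Gradient descent stays near μ.

module Iteration (ℝ : Reals) where
  open Reals ℝ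
  open OrderedField ℝ
  open Completeness ℝ
  open ListSum ℝ
  open InnerProduct ℝ
  open Robustness ℝ
  open MeanEstimation ℝ
  open ≈-Reasoning

  -- The local function `iterate` of fastGD has no name outside of it; the
  -- underscore is solved to its value by the specification.
  mutual
    iterateValue : ∀ {d} → (List Carrier → RAM Carrier) → List (Point d) → ℕ → ℕ → Point d → Point d
    iterateValue = λ median P T j c → _

    iterateValue-spec : ∀ {d} (median : List Carrier → RAM Carrier) T (P : List (Point d)) →
      value (fastGD median (suc T) P)
        ≡ iterateValue median P (suc T) T (value
            (descend median P (value (coordinatewiseMedian median P))))
    iterateValue-spec median T P
      -- Once the start point and `suc T` are abstracted, the underscore is applied to distinct
      -- variables, so unification determines it.
      with value (descend median P (value (coordinatewiseMedian median P))) | suc T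
    ... | c₁ | T′ = ≡.refl

  module _ {d : ℕ} (μ : Point d) (ρ : Carrier) (0≤ρ : 0# ≤ ρ)
           (P : List (Point d))
           (P≢[] : 0# < fromℕ (length P))
           (mostly-good : fromℕ 3 * fromℕ (length P) ≤ fromℕ 4 * ∑
               (λ p → indicator (‖ (λ l → p l - μ l) ‖² ≤? ρ)) P)
           (median : List Carrier → RAM Carrier) (isMedian : MedianRoutine median) where

    private
      good? : (p : Point d) → Dec (‖ (λ l → p l - μ l) ‖² ≤ ρ)
      good? p = ‖ (λ l → p l - μ l) ‖² ≤? ρ
      k = fromℕ (length P)
      γ : Point d → Carrier
      γ p = indicator (good? p)

      map≢[] : ∀ {X : Set} (f : Point d → X) → map f P ≢ []
      map≢[] f = lemma P P≢[]
        where
        lemma : ∀ P → 0# < fromℕ (length P) → map f P ≢ []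
        lemma []      h _ = pos⇒≉0 h refl
        lemma (_ ∷ _) _ ()

      deviation : (f : Point d → Carrier) → ∀ τ →
        k * ((value (median (map f P)) - τ) * (value (median (map f P)) - τ))
          ≤ fromℕ 4 * ∑ (λ p → γ p * ((f p - τ) * (f p - τ))) P
      deviation f = median-deviation good? f P mostly-good (isMedian (map f P) (map≢[] f))

      Near : Point d → Set
      Near c = ‖ (λ l → c l - μ l) ‖² ≤ fromℕ 64 * ρ

    -- The one-dimensional bound holds in every coordinate with the same set of good points. Squared
    -- distances add over coordinates, so exchanging the two sums loses no factor d.
    coordinatewiseMedian-near : ‖ (λ l → value (coordinatewiseMedian median P) l - μ l) ‖² ≤ fromℕ 4 * ρ
    coordinatewiseMedian-near = *-cancelˡ-≤ P≢[] (≤-trans (≤-trans (≤-trans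
      (≤-reflexive (sym (sum-*ˡ k (λ l → (value (coordinatewiseMedian median P) l - μ l) *
          (value (coordinatewiseMedian median P) l - μ l)))))
      (sum-mono coordinate))
      (≤-reflexive (begin
        sum (λ l → fromℕ 4 * ∑ (λ p → γ p * ((p l - μ l) * (p l - μ l))) P)
          ≈⟨ sum-*ˡ (fromℕ 4) (λ l → ∑ (λ p → γ p * ((p l - μ l) * (p l - μ l))) P) ⟩
        fromℕ 4 * sum (λ l → ∑ (λ p → γ p * ((p l - μ l) * (p l - μ l))) P)
          ≈⟨ *-congˡ (∑-sum (λ l p → γ p * ((p l - μ l) * (p l - μ l))) P) ⟨
        fromℕ 4 * ∑ (λ p → sum (λ l → γ p * ((p l - μ l) * (p l - μ l)))) P
          ≈⟨ *-congˡ (∑-cong (λ p → sum-*ˡ (γ p) (λ l → (p l - μ l) * (p l - μ l))) P) ⟩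
        fromℕ 4 * ∑ (λ p → γ p * ‖ (λ l → p l - μ l) ‖²) P ∎)))
      (≤-trans (*-monoˡ-≤ (0≤fromℕ 4) (≤-trans (∑-mono good-bound P) (≤-reflexive (∑-const ρ P))))
        (≤-reflexive (solve 2 (λ k ρ → con (+ 4) :* (k :* ρ) := k :* (con (+ 4) :* ρ)) refl k ρ))))
      where
      coordinate : ∀ l → k * ((value (coordinatewiseMedian median P) l - μ l) *
          (value (coordinatewiseMedian median P) l - μ l))
                        ≤ fromℕ 4 * ∑ (λ p → γ p * ((p l - μ l) * (p l - μ l))) P
      coordinate l = ≡.subst (λ xs → k * ((value (median xs) - μ l) * (value (median xs) - μ l))
                        ≤ fromℕ 4 * ∑ (λ p → γ p * ((p l - μ l) * (p l - μ l))) P)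
        (≡.sym (value-collect (λ p → unit (p l)) P)) (deviation (λ p → p l) (μ l))
      good-bound : ∀ p → γ p * ‖ (λ l → p l - μ l) ‖² ≤ ρ
      good-bound p with good? p
      ... | yes h = ≤-resp-≈ (sym (*-identityˡ _)) refl h
      ... | no  _ = ≤-resp-≈ (sym (zeroˡ _)) refl 0≤ρ

    -- Invariant of the loop that sums the unit vectors: m is the number of points processed and w
    -- the sum of their weights. The norm is bounded through its square to avoid a root, and the
    -- factor 4 clears the denominator of 3/4.
    record GradientBounds (e : Point d) (m w : Carrier) (g : Point d) : Set where
      constructor bounds
      field
        norm-bound : ‖ g ‖² ≤ m * m
        alignment  : w ≤ fromℕ 4 * ⟨ e , g ⟩

    accumulate-bounds : ∀ {e} {h : Point d → Carrier} (f : Point d → Point d → RAM (Point d)) →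
      (∀ {m w} g p → 0# ≤ m → GradientBounds e m w g → GradientBounds e (1# + m) (h p + w)
          (value (f g p))) →
      ∀ {m w} xs g → 0# ≤ m → GradientBounds e m w g →
      GradientBounds e (fromℕ (length xs) + m) (∑ h xs + w) (value (accumulate f g xs))
    accumulate-bounds f step [] g 0≤m (bounds n a) =
      bounds (≤-resp-≈ refl (*-cong (sym (+-identityˡ _)) (sym (+-identityˡ _))) n)
          (≤-resp-≈ (sym (+-identityˡ _)) refl a)
    accumulate-bounds {h = h} f step {m} {w} (x ∷ xs) g 0≤m b
      with accumulate-bounds {h = h} f step xs (value (f g x)) (0≤1 ⊕ 0≤m) (step g x 0≤m b)
    ... | bounds n a = bounds (≤-resp-≈ refl (*-cong e₁ e₁) n) (≤-resp-≈ e₂ refl a)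
      where
      e₁ = solve 2 (λ n m → n :+ (con (+ 1) :+ m) := con (+ 1) :+ n :+ m) refl (fromℕ (length xs)) m
      e₂ = solve 3 (λ s h w → s :+ (h :+ w) := h :+ s :+ w) refl (∑ h xs) (h x) w

    -- Far from μ, the unit vectors from good points to c make a small angle
    -- with the displacement e of c from μ.
    module _ (c : Point d) (far : fromℕ 60 * ρ < ‖ (λ l → c l - μ l) ‖²) where
      private
        e : Point d
        e l = c l - μ l
        E = ‖ e ‖²
        η = √ E
        0<E : 0# < E
        0<E = ≤-<-trans (0≤fromℕ 60 ⊗ 0≤ρ) far
        0≤η : 0# ≤ η
        0≤η = √-nonNegative (proj₁ 0<E)
        η² : η * η ≈ E
        η² = √-square (proj₁ 0<E)

        -- A copy of the local function of `gradient`, definitionally equal to it.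
        add : Point d → Point d → RAM (Point d)
        add g p = difference c p >>= λ u → norm u >>= λ r →
          if does (r ≟ 0#) then unit g else forEach λ l → unit (g l + u l * r ⁻¹)

        -- 3 η for a good point and - 4 η for a bad one: lower bounds on four times the inner
        -- product of e with the unit vector from the point to c.
        weight : Point d → Carrier
        weight p = η * (fromℕ 7 * γ p - fromℕ 4)

        module _ (p : Point d) where
          u : Point d
          u l = c l - p l
          U = ‖ u ‖²
          -- Expand ‖e - u‖² ≤ ρ, where e - u = p - μ.
          good-inner : ‖ (λ l → p l - μ l) ‖² ≤ ρ → U + E - ρ ≤ fromℕ 2 * ⟨ e , u ⟩
          good-inner good = certify (x≤y⇒0≤y-x good) (begin
            fromℕ 2 * ⟨ e , u ⟩
              ≈⟨ solve 4 (λ E U D ρ → con (+ 2) :* D := U :+ E :- ρ :+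
                  (ρ :- (con (+ 1) :* con (+ 1) :* E :+ con (+ 2) :* con (+ 1) :* (:- con (+ 1)) :* D :+
                  (:- con (+ 1)) :* (:- con (+ 1)) :* U))) refl E U (⟨ e , u ⟩) ρ ⟩
            U + E - ρ + (ρ - (1# * 1# * E + fromℕ 2 * 1# * (- 1#) * ⟨ e , u ⟩ + (- 1#) * (- 1#) * U))
              ≈⟨ +-congˡ (+-congˡ (-‿cong (trans (sym (‖‖²-linear 1# (- 1#) e u)) (⟨⟩-cong x≈ x≈)))) ⟩
            U + E - ρ + (ρ - ‖ (λ l → p l - μ l) ‖²) ∎)
            where
            x≈ : ∀ l → 1# * e l + (- 1#) * u l ≈ p l - μ l
            x≈ l = solve 3 (λ c p μ → con (+ 1) :* (c :- μ) :+ (:- con (+ 1)) :* (c :- p) := p :- μ) refl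
                (c l) (p l) (μ l)

        -- Adding a unit vector v to g changes ‖g‖² by 2 ⟨g , v⟩ + 1 ≤ 2 m + 1. The alignment gains
        -- 4 ⟨e , v⟩, which is compared with the weight of p.
        add-bounds : ∀ {m w} g p → 0# ≤ m → GradientBounds e m w g →
                     GradientBounds e (1# + m) (weight p + w) (value (add g p))
        add-bounds {m} {w} g p 0≤m (bounds n a) = cases (r ≟ 0#)
          where
          r = √ (U p)
          0≤U = 0≤‖‖² (u p)
          r² : r * r ≈ U p
          r² = √-square 0≤U
          cases : (r≟0 : Dec (r ≈ 0#)) → GradientBounds e (1# + m) (weight p + w)
            (value (if does r≟0 then unit g else forEach λ l → unit (g l + u p l * r ⁻¹)))
          cases (yes r≈0) = bounds
            (≤-trans n (certify (0≤1 ⊕ 0≤fromℕ 2 ⊗ 0≤m)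
              (solve 1 (λ m → (con (+ 1) :+ m) :* (con (+ 1) :+ m) := m :* m :+
                  (con (+ 1) :+ con (+ 2) :* m)) refl m)))
            (≤-trans (certify (bad (good? p)) (solve 2 (λ w v → w := v :+ w :+ (:- v)) refl w
                (weight p))) a)
            where
            U≈0 : U p ≈ 0#
            U≈0 = trans (sym r²) (trans (*-congʳ r≈0) (zeroˡ r))
            ⟨e,u⟩≤0 : ⟨ e , u p ⟩ ≤ 0#
            ⟨e,u⟩≤0 = square-≤⇒≤ ≤-refl (≤-resp-≈ (*-cong (⟨⟩-comm (u p) e) (⟨⟩-comm (u p) e))
              (trans (*-congʳ U≈0) (trans (zeroˡ E) (sym (zeroˡ 0#)))) (cauchy-schwarz (u p) e 0<E))
            -- A point at c adds nothing to the gradient, so its weight must not be positive. Such a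
            -- point is indeed bad: if it were good, c would be within squared distance ρ of μ.
            bad : (g? : Dec (‖ (λ l → p l - μ l) ‖² ≤ ρ)) → 0# ≤ -
                (η * (fromℕ 7 * indicator g? - fromℕ 4))
            bad (no _) = ≤-resp-≈ refl (solve 1
                (λ η → con (+ 4) :* η := :- (η :* (con (+ 7) :* con (+ 0) :- con (+ 4)))) refl η)
                (0≤fromℕ 4 ⊗ 0≤η)
            bad (yes good) = contradiction E≤ρ (<⇒≱
                (≤-<-trans (certify (0≤fromℕ 59 ⊗ 0≤ρ) (solve 1
                (λ ρ → con (+ 60) :* ρ := ρ :+ con (+ 59) :* ρ) refl ρ)) far))
              where
              E≤ρ : E ≤ ρ
              E≤ρ = certify (0≤U ⊕ x≤y⇒0≤y-x (good-inner p good) ⊕ 0≤fromℕ 2 ⊗ x≤y⇒0≤y-x ⟨e,u⟩≤0)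
                (trans (solve 4 (λ E ρ D U → ρ := E :+ (U :+ (con (+ 2) :* D :- (U :+ E :- ρ)) :+ con
                    (+ 2) :* (con (+ 0) :- D))) refl E ρ (⟨ e , u p ⟩) (U p)) refl)
          cases (no r≉0) = bounds norm-step align-step
            where
            v : Point d
            v l = u p l * r ⁻¹
            0<r : 0# < r
            0<r = √-nonNegative 0≤U , λ eq → r≉0 (sym eq)
            V≈1 : ‖ v ‖² ≈ 1#
            V≈1 = begin
              ‖ v ‖²                         ≈⟨ sum-cong (λ l → solve 2
                  (λ u i → (u :* i) :* (u :* i) := (i :* i) :* (u :* u)) refl (u p l) (r ⁻¹)) ⟩
              sum (λ l → (r ⁻¹ * r ⁻¹) * (u p l * u p l)) ≈⟨ sum-*ˡ (r ⁻¹ * r ⁻¹) (λ l → u p l * u p l) ⟩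
              r ⁻¹ * r ⁻¹ * U p              ≈⟨ *-congˡ r² ⟨
              r ⁻¹ * r ⁻¹ * (r * r)          ≈⟨ solve 2 (λ r i → i :* i :* (r :* r) := r :* i :*
                  (r :* i)) refl r (r ⁻¹) ⟩
              r * r ⁻¹ * (r * r ⁻¹)          ≈⟨ *-cong (⁻¹-inverseʳ r≉0) (⁻¹-inverseʳ r≉0) ⟩
              1# * 1#                        ≈⟨ *-identityˡ 1# ⟩
              1# ∎
            0<V : 0# < ‖ v ‖²
            0<V = <-resp-≈ refl (sym V≈1) 0<1
            g′ : Point d
            g′ l = g l + v l
            g′≈ : ∀ l → 1# * g l + 1# * v l ≈ g′ l
            g′≈ l = +-cong (*-identityˡ _) (*-identityˡ _)
            ⟨g,v⟩≤m : ⟨ g , v ⟩ ≤ m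
            ⟨g,v⟩≤m = square-≤⇒≤ 0≤m (≤-trans (cauchy-schwarz g v 0<V)
              (≤-resp-≈ (sym (trans (*-congˡ V≈1) (trans (*-comm _ _) (*-identityˡ _)))) refl n))
            norm-step : ‖ g′ ‖² ≤ (1# + m) * (1# + m)
            norm-step = certify (x≤y⇒0≤y-x n ⊕ 0≤fromℕ 2 ⊗ x≤y⇒0≤y-x ⟨g,v⟩≤m) (begin
              (1# + m) * (1# + m)
                ≈⟨ solve 3 (λ m G D → (con (+ 1) :+ m) :* (con (+ 1) :+ m) := con (+ 1) :* con (+ 1) :* G
                    :+ con (+ 2) :* con (+ 1) :* con (+ 1) :* D :+ con (+ 1) :* con (+ 1) :* con (+ 1) :+
                    (m :* m :- G :+ con (+ 2) :* (m :- D))) refl m (‖ g ‖²) (⟨ g , v ⟩) ⟩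
              1# * 1# * ‖ g ‖² + fromℕ 2 * 1# * 1# * ⟨ g , v ⟩ + 1# * 1# * 1# +
                  (m * m - ‖ g ‖² + fromℕ 2 * (m - ⟨ g , v ⟩))
                ≈⟨ +-congʳ (trans (+-congˡ (*-congˡ (sym V≈1)))
                    (trans (sym (‖‖²-linear 1# 1# g v)) (⟨⟩-cong g′≈ g′≈))) ⟩
              ‖ g′ ‖² + (m * m - ‖ g ‖² + fromℕ 2 * (m - ⟨ g , v ⟩)) ∎)
            ⟨e,g′⟩ : ⟨ e , g′ ⟩ ≈ ⟨ e , g ⟩ + ⟨ e , v ⟩
            ⟨e,g′⟩ = begin
              ⟨ e , g′ ⟩                          ≈⟨ ⟨⟩-comm e g′ ⟩
              ⟨ g′ , e ⟩                          ≈⟨ ⟨⟩-cong g′≈ (λ _ → refl) ⟨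
              ⟨ (λ l → 1# * g l + 1# * v l) , e ⟩ ≈⟨ ⟨⟩-linearˡ 1# 1# g v e ⟩
              1# * ⟨ g , e ⟩ + 1# * ⟨ v , e ⟩     ≈⟨ +-cong (*-identityˡ _) (*-identityˡ _) ⟩
              ⟨ g , e ⟩ + ⟨ v , e ⟩               ≈⟨ +-cong (⟨⟩-comm g e) (⟨⟩-comm v e) ⟩
              ⟨ e , g ⟩ + ⟨ e , v ⟩ ∎
            r⟨e,v⟩ : r * ⟨ e , v ⟩ ≈ ⟨ e , u p ⟩
            r⟨e,v⟩ = trans (sym (sum-*ˡ r (λ l → e l * v l))) (sum-cong λ l → trans
              (solve 4 (λ r e u i → r :* (e :* (u :* i)) := (r :* i) :* (e :* u)) refl r (e l) (u p l)
                  (r ⁻¹))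
              (trans (*-congʳ (⁻¹-inverseʳ r≉0)) (*-identityˡ _)))
            direction : (g? : Dec (‖ (λ l → p l - μ l) ‖² ≤ ρ)) →
                        η * (fromℕ 7 * indicator g? - fromℕ 4) ≤ fromℕ 4 * ⟨ e , v ⟩
            direction (no _) = certify (0≤fromℕ 4 ⊗ x≤y⇒0≤y-x -⟨e,v⟩≤η)
              (solve 2 (λ η D → con (+ 4) :* D := η :* (con (+ 7) :* con (+ 0) :- con (+ 4)) :+ con (+ 4)
                  :* (η :- (:- D))) refl η (⟨ e , v ⟩))
              where
              -⟨e,v⟩≤η : - ⟨ e , v ⟩ ≤ η
              -⟨e,v⟩≤η = square-≤⇒≤ 0≤η (≤-resp-≈ (solve 1 (λ x → x :* x := :- x :* :- x) refl _)
                (trans (*-congˡ V≈1) (trans (*-comm _ _) (trans (*-identityˡ _) (sym η²))))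
                    (cauchy-schwarz e v 0<V))
            -- 16 r² + 16 η² - 16 ρ - 24 η r = (4 r - 3 η)² + 7 η² - 16 ρ.
            direction (yes good) = *-cancelˡ-≤ (0<* (0<fromℕ-suc 7) 0<r) (certify
              (0≤fromℕ 16 ⊗ x≤y⇒0≤y-x (good-inner p good) ⊕ 0≤x² (fromℕ 4 * r - fromℕ 3 * η)
                -- 7 η² - 16 ρ = 7 (η² - 60 ρ) + 404 ρ, where 404 = 7 · 60 - 16.
                ⊕ (0≤fromℕ 7 ⊗ x≤y⇒0≤y-x (proj₁ far) ⊕ 0≤fromℕ 404 ⊗ 0≤ρ))
              (begin
                fromℕ 8 * r * (fromℕ 4 * ⟨ e , v ⟩)
                  ≈⟨ solve 2 (λ r D → con (+ 8) :* r :* (con (+ 4) :* D) := con (+ 32) :* (r :* D)) refl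
                      r (⟨ e , v ⟩) ⟩
                fromℕ 32 * (r * ⟨ e , v ⟩)
                  ≈⟨ *-congˡ r⟨e,v⟩ ⟩
                fromℕ 32 * ⟨ e , u p ⟩
                  ≈⟨ solve 4 (λ r η D ρ → con (+ 32) :* D := con (+ 8) :* r :*
                      (η :* (con (+ 7) :* con (+ 1) :- con (+ 4)))
                        :+ (con (+ 16) :* (con (+ 2) :* D :- (r :* r :+ η :* η :- ρ)) :+
                            (con (+ 4) :* r :- con (+ 3) :* η) :* (con (+ 4) :* r :- con (+ 3) :* η)
                          :+ (con (+ 7) :* (η :* η :- con (+ 60) :* ρ) :+ con (+ 404) :* ρ))) refl r η
                              (⟨ e , u p ⟩) ρ ⟩
                _ + (fromℕ 16 * (fromℕ 2 * ⟨ e , u p ⟩ - (r * r + η * η - ρ)) +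
                    (fromℕ 4 * r - fromℕ 3 * η) * (fromℕ 4 * r - fromℕ 3 * η)
                          + (fromℕ 7 * (η * η - fromℕ 60 * ρ) + fromℕ 404 * ρ))
                  ≈⟨ +-congˡ (+-cong (+-congʳ (*-congˡ (+-congˡ (-‿cong (+-congʳ (+-cong r² η²))))))
                      (+-congʳ (*-congˡ (+-congʳ η²)))) ⟩
                _ ∎))
            align-step : weight p + w ≤ fromℕ 4 * ⟨ e , g′ ⟩
            align-step = ≤-trans (+-mono-≤ (direction (good? p)) a) (≤-reflexive (trans
              (solve 2 (λ x y → con (+ 4) :* y :+ con (+ 4) :* x := con (+ 4) :* (x :+ y)) refl
                  (⟨ e , g ⟩) (⟨ e , v ⟩))
              (*-congˡ (sym ⟨e,g′⟩))))

      -- The weights sum to at least (7 · 3/4 - 4) η k = 5/4 η k, hence 16 ⟨e , g⟩ ≥ 5 η k, and ‖g‖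
      -- ≤ k. The cosine of the angle between e and g is therefore at least 5/16.
      gradient-aligned : fromℕ 25 * E * ‖ value (gradient P c) ‖²
        ≤ fromℕ 256 * (⟨ e , value (gradient P c) ⟩ * ⟨ e , value (gradient P c) ⟩)
      gradient-aligned = conclude (accumulate-bounds add add-bounds P (λ _ → 0#) ≤-refl initial)
        where
        g = value (gradient P c)
        initial : GradientBounds e 0# 0# (λ _ → 0#)
        initial = bounds (≤-reflexive (trans (sum-const d (0# * 0#))
            (trans (*-congˡ (zeroˡ 0#)) (trans (zeroʳ _) (sym (zeroˡ 0#))))))
          (≤-reflexive (sym (trans (*-congˡ (trans
              (sum-cong (λ l → trans (zeroʳ (e l)) (sym (zeroˡ (e l)))))
              (trans (sum-*ˡ 0# e) (zeroˡ (sum e))))) (zeroʳ _))))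
        conclude : GradientBounds e (k + 0#) (∑ weight P + 0#) g →
          fromℕ 25 * E * ‖ g ‖² ≤ fromℕ 256 * (⟨ e , g ⟩ * ⟨ e , g ⟩)
        conclude (bounds n a) = ≤-trans (*-monoˡ-≤ (0≤fromℕ 25 ⊗ proj₁ 0<E) n) (≤-resp-≈
          (trans (solve 2 (λ η k → (con (+ 5) :* η :* k) :* (con (+ 5) :* η :* k) := con (+ 25) :*
              (η :* η) :* ((k :+ con (+ 0)) :* (k :+ con (+ 0)))) refl η k)
            (*-congʳ (*-congˡ η²)))
          (solve 1 (λ D → (con (+ 16) :* D) :* (con (+ 16) :* D) := con (+ 256) :* (D :* D)) refl
              (⟨ e , g ⟩))
          (*-mono-≤ (0≤fromℕ 5 ⊗ 0≤η ⊗ 0≤fromℕ (length P))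
              (≤-trans (0≤fromℕ 5 ⊗ 0≤η ⊗ 0≤fromℕ (length P)) lower) lower lower))
          where
          ∑weight : ∑ weight P ≈ η * (fromℕ 7 * ∑ γ P + k * (- fromℕ 4))
          ∑weight = trans (∑-*ˡ η (λ p → fromℕ 7 * γ p - fromℕ 4) P)
              (*-congˡ (trans (∑-+ (λ p → fromℕ 7 * γ p) (λ _ → - fromℕ 4) P)
            (+-cong (∑-*ˡ (fromℕ 7) γ P) (∑-const (- fromℕ 4) P))))
          lower : fromℕ 5 * η * k ≤ fromℕ 16 * ⟨ e , g ⟩
          lower = certify (0≤fromℕ 4 ⊗ x≤y⇒0≤y-x a ⊕ 0≤fromℕ 7 ⊗ (0≤η ⊗ x≤y⇒0≤y-x mostly-good)) (begin
            fromℕ 16 * ⟨ e , g ⟩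
              ≈⟨ solve 4 (λ D η k s → con (+ 16) :* D := con (+ 5) :* η :* k :+
                  (con (+ 4) :* (con (+ 4) :* D :- (η :* (con (+ 7) :* s :+ k :* (:- con (+ 4))) :+ con
                  (+ 0))) :+ con (+ 7) :* (η :* (con (+ 4) :* s :- con (+ 3) :* k)))) refl (⟨ e , g ⟩) η
                  k (∑ γ P) ⟩
            _ + (fromℕ 4 * (fromℕ 4 * ⟨ e , g ⟩ - (η * (fromℕ 7 * ∑ γ P + k * (- fromℕ 4)) + 0#)) + _)
              ≈⟨ +-congˡ (+-congʳ (*-congˡ (+-congˡ (-‿cong (+-congʳ (sym ∑weight)))))) ⟩
            _ ∎)

    descend-near : ∀ c → Near c → Near (value (descend median P c))
    descend-near c near = cases (⟨ g , g ⟩ ≟ 0#)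
      where
      g : Point d
      g = value (gradient P c)
      G = ⟨ g , g ⟩
      e : Point d
      e l = c l - μ l
      E = ‖ e ‖²
      coefficientOf : Point d → Carrier
      coefficientOf p = ⟨ (λ l → c l - p l) , g ⟩ * G ⁻¹
      cases : (G≟0 : Dec (G ≈ 0#)) → Near (value (if does G≟0
        then unit c
        else (collect (λ p → difference c p >>= λ u → innerProduct u g >>= λ ug → unit (ug * G ⁻¹)) P >>=
            λ ts →
              median ts >>= λ t → forEach λ l → unit (c l - t * g l))))
      cases (yes _)  = near
      cases (no G≉0) = ≡.subst (λ ts → Near (λ l → c l - value (median ts) * g l))
          (≡.sym (value-collect (λ p → difference c p >>= λ u → innerProduct u g >>= λ ug → unit
              (ug * G ⁻¹)) P))
          moved
        where
        t = value (median (map coefficientOf P))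
        -- The parameter at which μ projects onto the line.
        τ = ⟨ e , g ⟩ * G ⁻¹
        0<G : 0# < G
        0<G = 0≤‖‖² g , λ eq → G≉0 (sym eq)
        *G : ∀ x → x * G ⁻¹ * G ≈ x
        *G x = trans (solve 3 (λ x i b → x :* i :* b := x :* (b :* i)) refl x (G ⁻¹) G)
          (trans (*-congˡ (⁻¹-inverseʳ G≉0)) (trans (*-comm _ _) (*-identityˡ _)))
        S = (t - τ) * (t - τ)

        -- The projections of p and μ differ in parameter by ⟨p - μ , g⟩ / G up to sign, and
        -- Cauchy-Schwarz bounds its square by ρ G / G².
        good-bound : ∀ p → γ p * ((coefficientOf p - τ) * (coefficientOf p - τ)) ≤ ρ * G ⁻¹
        good-bound p = good-case (good? p)
          where
          x : Point d
          x l = p l - μ l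
          offset : (coefficientOf p - τ) * G ≈ - ⟨ x , g ⟩
          offset = begin
            (coefficientOf p - τ) * G
              ≈⟨ solve 3 (λ a b G → (a :- b) :* G := a :* G :- b :* G) refl (coefficientOf p) τ G ⟩
            coefficientOf p * G - τ * G
              ≈⟨ +-cong (*G ⟨ (λ l → c l - p l) , g ⟩) (-‿cong (*G ⟨ e , g ⟩)) ⟩
            ⟨ (λ l → c l - p l) , g ⟩ - ⟨ e , g ⟩
              ≈⟨ +-congʳ (trans (⟨⟩-cong {q = g} (λ l → solve 3
                  (λ c p μ → c :- p := con (+ 1) :* (c :- μ) :+ (:- con (+ 1)) :* (p :- μ)) refl (c l)
                  (p l) (μ l)) (λ _ → refl))
                   (⟨⟩-linearˡ 1# (- 1#) e x g)) ⟩
            (1# * ⟨ e , g ⟩ + (- 1#) * ⟨ x , g ⟩) - ⟨ e , g ⟩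
              ≈⟨ solve 2 (λ a b → con (+ 1) :* a :+ (:- con (+ 1)) :* b :- a := :- b) refl (⟨ e , g ⟩)
                  (⟨ x , g ⟩) ⟩
            - ⟨ x , g ⟩ ∎
          good-case : (g? : Dec (‖ x ‖² ≤ ρ)) → indicator g? *
              ((coefficientOf p - τ) * (coefficientOf p - τ)) ≤ ρ * G ⁻¹
          good-case (no _)  = ≤-resp-≈ (sym (zeroˡ _)) refl (0≤ρ ⊗ 0≤⁻¹ 0<G)
          good-case (yes h) = ≤⁻¹-shift 0<G (*-cancelˡ-≤ 0<G (≤-resp-≈
            (trans (trans (solve 1 (λ y → y :* y := (:- y) :* (:- y)) refl (⟨ x , g ⟩))
                (sym (*-cong offset offset)))
              (solve 2 (λ z G → (z :* G) :* (z :* G) := G :* (con (+ 1) :* (z :* z) :* G)) refl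
                  (coefficientOf p - τ) G))
            (*-comm _ _)
            (≤-trans (cauchy-schwarz x g 0<G) (*-monoʳ-≤ (proj₁ 0<G) h))))

        near-projection : S * G ≤ fromℕ 4 * ρ
        near-projection = *-cancelˡ-≤ P≢[] (≤-resp-≈ (*-assoc k S G)
          (trans (solve 4 (λ k ρ G i → con (+ 4) :* (k :* (ρ :* i)) :* G := k :*
              (con (+ 4) :* (ρ :* i :* G))) refl k ρ G (G ⁻¹))
            (*-congˡ (*-congˡ (*G ρ))))
          (*-monoʳ-≤ (proj₁ 0<G) (≤-trans (deviation coefficientOf τ)
            (*-monoˡ-≤ (0≤fromℕ 4) (≤-trans (∑-mono good-bound P) (≤-reflexive (∑-const _ P)))))))

        -- Pythagoras: motion along g replaces the squared component τ² G of e in that direction by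
        -- S G and leaves the orthogonal part alone.
        E′ : ‖ (λ l → c l - t * g l - μ l) ‖² ≈ E + S * G - τ * τ * G
        E′ = begin
          ‖ (λ l → c l - t * g l - μ l) ‖²
            ≈⟨ ⟨⟩-cong eq eq ⟩
          ‖ (λ l → 1# * e l + (- t) * g l) ‖²
            ≈⟨ ‖‖²-linear 1# (- t) e g ⟩
          1# * 1# * E + fromℕ 2 * 1# * (- t) * ⟨ e , g ⟩ + (- t) * (- t) * G
            ≈⟨ +-congʳ (+-congˡ (*-congˡ (sym (*G ⟨ e , g ⟩)))) ⟩
          1# * 1# * E + fromℕ 2 * 1# * (- t) * (τ * G) + (- t) * (- t) * G
            ≈⟨ solve 4 (λ E t τ G → con (+ 1) :* con (+ 1) :* E :+ con (+ 2) :* con (+ 1) :* (:- t) :*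
                (τ :* G) :+ (:- t) :* (:- t) :* G
                  := E :+ (t :- τ) :* (t :- τ) :* G :- τ :* τ :* G) refl E t τ G ⟩
          E + S * G - τ * τ * G ∎
          where
          eq : ∀ l → c l - t * g l - μ l ≈ 1# * e l + (- t) * g l
          eq l = solve 4 (λ c t g μ → c :- t :* g :- μ := con (+ 1) :* (c :- μ) :+ (:- t) :* g) refl
              (c l) t (g l) (μ l)

        moved : Near (λ l → c l - t * g l)
        -- Close to μ, the step may lose up to S G ≤ 4 ρ; far from μ, the removed component τ² G
        -- makes up for S G.
        moved with E ≤? fromℕ 60 * ρ
        ... | yes E≤ = ≤-resp-≈ (sym E′) refl (certify
          (x≤y⇒0≤y-x E≤ ⊕ x≤y⇒0≤y-x near-projection ⊕ 0≤x² τ ⊗ proj₁ 0<G)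
          (solve 4 (λ E S T ρ → con (+ 64) :* ρ := E :+ S :- T :+
              (con (+ 60) :* ρ :- E :+ (con (+ 4) :* ρ :- S) :+ T)) refl E (S * G) (τ * τ * G) ρ))
        ... | no E≰ = ≤-trans (≤-resp-≈ (sym E′) refl (certify
            (x≤y⇒0≤y-x near-projection ⊕ x≤y⇒0≤y-x 4ρ≤τ²G)
            (solve 4 (λ E S T ρ → E := E :+ S :- T :+ (con (+ 4) :* ρ :- S :+ (T :- con (+ 4) :* ρ)))
                refl E (S * G) (τ * τ * G) ρ))) near
          where
          60ρ<E = ≰⇒> E≰
          ⟨e,g⟩² : ⟨ e , g ⟩ * ⟨ e , g ⟩ ≈ G * (τ * τ * G)
          ⟨e,g⟩² = trans (sym (*-cong (*G ⟨ e , g ⟩) (*G ⟨ e , g ⟩)))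
            (solve 2 (λ τ G → τ :* G :* (τ :* G) := G :* (τ :* τ :* G)) refl τ G)
          4ρ≤τ²G : fromℕ 4 * ρ ≤ τ * τ * G
          4ρ≤τ²G = *-cancelˡ-≤ (0<* (0<fromℕ-suc 255) 0<G) (certify
            -- Beyond 60 ρ the alignment gives 256 τ² G ≥ 25 · 60 ρ, and 25 · 60 = 256 · 4 + 476.
            ((0≤fromℕ 25 ⊗ x≤y⇒0≤y-x (proj₁ 60ρ<E)) ⊗ proj₁ 0<G ⊕ 0≤fromℕ 476 ⊗ 0≤ρ ⊗ proj₁ 0<G ⊕
                x≤y⇒0≤y-x (gradient-aligned c 60ρ<E))
            (begin
              fromℕ 256 * G * (τ * τ * G)
                ≈⟨ solve 4 (λ G T ρ E → con (+ 256) :* G :* T := con (+ 256) :* G :* (con (+ 4) :* ρ) :+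
                    (con (+ 25) :* (E :- con (+ 60) :* ρ) :* G :+ con (+ 476) :* ρ :* G :+
                    (con (+ 256) :* (G :* T) :- con (+ 25) :* E :* G))) refl G (τ * τ * G) ρ E ⟩
              _ + (_ + (fromℕ 256 * (G * (τ * τ * G)) - fromℕ 25 * E * G))
                ≈⟨ +-congˡ (+-congˡ (+-congʳ (*-congˡ (sym ⟨e,g⟩²)))) ⟩
              _ ∎))

    iterateValue-near : ∀ T j c → Near c → Near (iterateValue median P T j c)
    iterateValue-near T zero    c near = near
    iterateValue-near T (suc j) c near = iterateValue-near T j _ (descend-near c near)

    fastGD-near : ∀ T → Near (value (fastGD median T P))
    fastGD-near T = iterateValue-near T T (value (coordinatewiseMedian median P))
        (≤-trans coordinatewiseMedian-near
      (certify (0≤fromℕ 60 ⊗ 0≤ρ) (solve 1 (λ ρ → con (+ 64) :* ρ := con (+ 4) :* ρ :+ con (+ 60) :* ρ)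
          refl ρ)))

-- Tuples as independent samples: second moments and concentration.

All-cartesianProductWith-∷ : {P : Pred X 0ℓ} {Q R : Pred (List X) 0ℓ} →
  (∀ {x t} → P x → Q t → R (x ∷ t)) → ∀ {xs ts} → All P xs → All Q ts → All R
      (cartesianProductWith _∷_ xs ts)
All-cartesianProductWith-∷ h []       qs = []
All-cartesianProductWith-∷ h (p ∷ ps) qs = All.++⁺ (All.map⁺ (All.map (h p) qs))
    (All-cartesianProductWith-∷ h ps qs)

All-tuples : {P : Pred X 0ℓ} {xs : List X} → All P xs → ∀ m →
             All (λ t → length t ≡ m × All P t) (tuples m xs)
All-tuples ps zero    = (≡.refl , []) ∷ []
All-tuples ps (suc m) = All-cartesianProductWith-∷ (λ { p (e , qs) → ≡.cong suc e , p ∷ qs }) ps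
    (All-tuples ps m)

tuples-length : ∀ m (xs : List X) → All (λ t → length t ≡ m) (tuples m xs)
tuples-length m xs = All.map proj₁ (All-tuples (All.universal (λ _ → tt) xs) m)

length-filter-complement : {P : Pred X 0ℓ} (P? : Decidable P) → ∀ xs →
  length (filter P? xs) ℕ.+ length (filter (λ x → ¬? (P? x)) xs) ≡ length xs
length-filter-complement P? []       = ≡.refl
length-filter-complement P? (x ∷ xs) with does (P? x)
... | true  = ≡.cong suc (length-filter-complement P? xs)
... | false = ≡.trans (ℕ.+-suc _ _) (≡.cong suc (length-filter-complement P? xs))

≰4b⇒3k≤4g : ∀ {g b k} → g ℕ.+ b ≡ k → ¬ (k ℕ.≤ 4 ℕ.* b) → 3 ℕ.* k ℕ.≤ 4 ℕ.* g
≰4b⇒3k≤4g {g} {b} ≡.refl h = ℕ.+-cancelʳ-≤ (g ℕ.+ b) (3 ℕ.* (g ℕ.+ b)) (4 ℕ.* g) (begin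
  3 ℕ.* (g ℕ.+ b) ℕ.+ (g ℕ.+ b) ≡⟨ solve 2 (λ g b → con 3 :* (g :+ b) :+ (g :+ b) := con 4 :* g :+ con 4
      :* b) ≡.refl g b ⟩
  4 ℕ.* g ℕ.+ 4 ℕ.* b           ≤⟨ ℕ.+-monoʳ-≤ (4 ℕ.* g) (ℕ.<⇒≤ (ℕ.≰⇒> h)) ⟩
  4 ℕ.* g ℕ.+ (g ℕ.+ b)         ∎)
  where
  open ℕ.≤-Reasoning
  open +-*-Solver

module Sampling (ℝ : Reals) where
  open Reals ℝ
  open OrderedField ℝ
  open Completeness ℝ
  open ListSum ℝ
  open InnerProduct ℝ
  open Robustness ℝ
  open MeanEstimation ℝ
  open ≈-Reasoning
  open SemiringExp semiring using (^-homo-*; ^-assocʳ; ^-congˡ; ^-congʳ)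

  ∑-cartesianProductWith : (f : List X → Carrier) (xs : List X) (ts : List (List X)) →
    ∑ f (cartesianProductWith _∷_ xs ts) ≈ ∑ (λ x → ∑ (λ t → f (x ∷ t)) ts) xs
  ∑-cartesianProductWith f []       ts = refl
  ∑-cartesianProductWith f (x ∷ xs) ts = trans (∑-++ f (map (x ∷_) ts) _)
    (+-cong (reflexive (∑-map f (x ∷_) ts)) (∑-cartesianProductWith f xs ts))

  size : List X → Carrier
  size xs = fromℕ (length xs)

  size-tuples : ∀ m (xs : List X) → size (tuples m xs) ≈ size xs ^ m
  size-tuples zero    xs = +-identityʳ 1#
  size-tuples (suc m) xs = begin
    size (tuples (suc m) xs)
      ≈⟨ trans (sym (*-identityʳ _)) (sym (∑-const 1# (tuples (suc m) xs))) ⟩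
    ∑ (λ _ → 1#) (tuples (suc m) xs)
      ≈⟨ ∑-cartesianProductWith (λ _ → 1#) xs (tuples m xs) ⟩
    ∑ (λ _ → ∑ (λ _ → 1#) (tuples m xs)) xs
      ≈⟨ ∑-const _ xs ⟩
    size xs * ∑ (λ _ → 1#) (tuples m xs)
      ≈⟨ *-congˡ (trans (∑-const 1# (tuples m xs)) (*-identityʳ _)) ⟩
    size xs * size (tuples m xs)
      ≈⟨ *-congˡ (size-tuples m xs) ⟩
    size xs ^ suc m ∎

  -- The variance of a sum of m independent centred variables is m times a single variance, with the
  -- denominators cleared. Splitting off the first entry, the cross term carries the factor ∑ z = 0.
  second-moment : (z : X → Carrier) (xs : List X) → ∑ z xs ≈ 0# → ∀ m →
    size xs * ∑ (λ t → ∑ z t * ∑ z t) (tuples m xs)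
      ≈ fromℕ m * size (tuples m xs) * ∑ (λ x → z x * z x) xs
  second-moment z xs centred zero = solve 2 (λ n Q → n :* (con (+ 0) :* con (+ 0) :+ con (+ 0)) := con
      (+ 0) :* (con (+ 1) :+ con (+ 0)) :* Q) refl (size xs) _
  second-moment z xs centred (suc m) = begin
    n * ∑ (λ t → ∑ z t * ∑ z t) (tuples (suc m) xs)
      ≈⟨ *-congˡ (∑-cartesianProductWith (λ t → ∑ z t * ∑ z t) xs ts) ⟩
    n * ∑ (λ x → ∑ (λ t → (z x + ∑ z t) * (z x + ∑ z t)) ts) xs
      ≈⟨ *-congˡ (∑-cong inner xs) ⟩
    n * ∑ (λ x → N * (z x * z x) + (fromℕ 2 * S₁) * z x + S₂) xs
      ≈⟨ *-congˡ (trans (∑-+ (λ x → N * (z x * z x) + (fromℕ 2 * S₁) * z x) (λ _ → S₂) xs)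
           (+-cong (trans (∑-+ (λ x → N * (z x * z x)) (λ x → (fromℕ 2 * S₁) * z x) xs)
             (+-cong (∑-*ˡ N (λ x → z x * z x) xs) (trans (∑-*ˡ (fromℕ 2 * S₁) z xs) (*-congˡ centred))))
                 (∑-const S₂ xs))) ⟩
    n * (N * Q + fromℕ 2 * S₁ * 0# + n * S₂)
      ≈⟨ *-congˡ (+-congˡ (second-moment z xs centred m)) ⟩
    n * (N * Q + fromℕ 2 * S₁ * 0# + fromℕ m * N * Q)
      ≈⟨ solve 5 (λ n N Q S m → n :* (N :* Q :+ con (+ 2) :* S :* con (+ 0) :+ m :* N :* Q) :=
          (con (+ 1) :+ m) :* (n :* N) :* Q) refl n N Q S₁ (fromℕ m) ⟩
    fromℕ (suc m) * (n * N) * Q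
      ≈⟨ *-congʳ (*-congˡ (trans (*-congˡ (size-tuples m xs)) (sym (size-tuples (suc m) xs)))) ⟩
    fromℕ (suc m) * size (tuples (suc m) xs) * Q ∎
    where
    n  = size xs
    ts = tuples m xs
    N  = size ts
    Q  = ∑ (λ x → z x * z x) xs
    S₁ = ∑ (∑ z) ts
    S₂ = ∑ (λ t → ∑ z t * ∑ z t) ts
    inner : ∀ x → ∑ (λ t → (z x + ∑ z t) * (z x + ∑ z t)) ts ≈ N * (z x * z x) + (fromℕ 2 * S₁) * z x +
        S₂
    inner x = begin
      ∑ (λ t → (z x + ∑ z t) * (z x + ∑ z t)) ts
        ≈⟨ ∑-cong (λ t → solve 2 (λ a b → (a :+ b) :* (a :+ b) := (a :* a :+ (con (+ 2) :* a) :* b) :+ b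
            :* b) refl (z x) (∑ z t)) ts ⟩
      ∑ (λ t → (z x * z x + (fromℕ 2 * z x) * ∑ z t) + ∑ z t * ∑ z t) ts
        ≈⟨ ∑-+ (λ t → z x * z x + (fromℕ 2 * z x) * ∑ z t) (λ t → ∑ z t * ∑ z t) ts ⟩
      ∑ (λ t → z x * z x + (fromℕ 2 * z x) * ∑ z t) ts + S₂
        ≈⟨ +-congʳ (trans (∑-+ (λ _ → z x * z x) (λ t → (fromℕ 2 * z x) * ∑ z t) ts)
            (+-cong (∑-const _ ts) (∑-*ˡ (fromℕ 2 * z x) (∑ z) ts))) ⟩
      N * (z x * z x) + (fromℕ 2 * z x) * S₁ + S₂
        ≈⟨ solve 4 (λ a b c d → a :+ con (+ 2) :* b :* c :+ d := a :+ con (+ 2) :* c :* b :+ d) refl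
            (N * (z x * z x)) (z x) S₁ S₂ ⟩
      N * (z x * z x) + (fromℕ 2 * S₁) * z x + S₂ ∎

  ∏ : (X → Carrier) → List X → Carrier
  ∏ w []       = 1#
  ∏ w (x ∷ xs) = w x * ∏ w xs

  -- Independence in counting form: the mean of a product over the entries is the product of the
  -- means.
  ∑-∏-tuples : (w : X → Carrier) (xs : List X) → ∀ k → ∑ (∏ w) (tuples k xs) ≈ ∑ w xs ^ k
  ∑-∏-tuples w xs zero    = +-identityʳ 1#
  ∑-∏-tuples w xs (suc k) = begin
    ∑ (∏ w) (tuples (suc k) xs)                            ≈⟨ ∑-cartesianProductWith (∏ w) xs
        (tuples k xs) ⟩
    ∑ (λ x → ∑ (λ t → w x * ∏ w t) (tuples k xs)) xs       ≈⟨ ∑-cong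
        (λ x → trans (∑-*ˡ (w x) (∏ w) (tuples k xs)) (*-comm _ _)) xs ⟩
    ∑ (λ x → ∑ (∏ w) (tuples k xs) * w x) xs               ≈⟨ ∑-*ˡ (∑ (∏ w) (tuples k xs)) w xs ⟩
    ∑ (∏ w) (tuples k xs) * ∑ w xs                         ≈⟨ *-comm _ _ ⟩
    ∑ w xs * ∑ (∏ w) (tuples k xs)                         ≈⟨ *-congˡ (∑-∏-tuples w xs k) ⟩
    ∑ w xs ^ suc k ∎

  -- Exponential Markov inequality: give good elements weight 1 and bad ones
  -- weight 256.  A tuple with more than a quarter of bad entries has weight
  -- at least 4ᵏ, and the weights of all tuples sum to at most (2 |xs|)ᵏ.
  module _ {G : Pred X 0ℓ} (good? : Decidable G) (xs : List X)
           (few-bad : fromℕ 256 * ∑ (λ x → 1# - indicator (good? x)) xs ≤ size xs) where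

    private
      w : X → Carrier
      w x = 1# + fromℕ 255 * (1# - indicator (good? x))

      #bad : List X → ℕ
      #bad ω = length (filter (λ x → ¬? (good? x)) ω)

      -- Because 256 = 4^4, a quarter of bad entries turns into the integral exponent k of 4.
      ∏w : ∀ ω → ∏ w ω ≈ fromℕ 4 ^ (4 ℕ.* #bad ω)
      ∏w []      = refl
      ∏w (x ∷ ω) with good? x
      ... | yes _ = trans (solve 1 (λ p → (con (+ 1) :+ con (+ 255) :* (con (+ 1) :- con (+ 1))) :* p :=
          p) refl _) (∏w ω)
      ... | no  _ = trans (*-congˡ (∏w ω)) (trans
          (solve 1 (λ p → (con (+ 1) :+ con (+ 255) :* (con (+ 1) :- con (+ 0))) :* p
                       := con (+ 4) :* (con (+ 4) :* (con (+ 4) :* (con (+ 4) :* p)))) refl _)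
                     (^-congʳ (fromℕ 4) (≡.sym (ℕ.*-suc 4 (#bad ω)))))

      1≤w : ∀ x → 1# ≤ w x
      1≤w x = certify (0≤fromℕ 255 ⊗ 0≤1-indicator (good? x)) refl

      1≤4^ : ∀ n → 1# ≤ fromℕ 4 ^ n
      1≤4^ n = ≤-trans (≤-reflexive (sym (1^ n))) (^-mono-≤ n 0≤1
          (certify (0≤fromℕ 3) (solve 0 (con (+ 4) := con (+ 1) :+ con (+ 3)) refl)))

      4^-mono : ∀ {m n} → m ℕ.≤ n → fromℕ 4 ^ m ≤ fromℕ 4 ^ n
      4^-mono {m} {n} h = ≤-trans (≤-trans (≤-reflexive (sym (*-identityˡ _)))
          (*-monoʳ-≤ (0≤^ m (0≤fromℕ 4)) (1≤4^ (n ℕ.∸ m))))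
        (≤-reflexive (trans (sym (^-homo-* (fromℕ 4) (n ℕ.∸ m) m)) (^-congʳ (fromℕ 4) (ℕ.m∸n+n≡m h))))

      many-bad : ∀ ω → ¬ (fromℕ 3 * size ω ≤ fromℕ 4 * ∑ (λ x → indicator (good? x)) ω) → length ω ℕ.≤ 4
          ℕ.* #bad ω
      many-bad ω ¬mostly-good with length ω ℕ.≤? 4 ℕ.* #bad ω
      ... | yes h = h
      ... | no ¬h = contradiction (≤-resp-≈ (fromℕ-* 3 (length ω))
          (trans (fromℕ-* 4 g) (*-congˡ (∑-indicator good? ω))) (fromℕ-mono-≤ 3k≤4g)) ¬mostly-good
        where
        g = length (filter good? ω)
        3k≤4g : 3 ℕ.* length ω ℕ.≤ 4 ℕ.* g
        3k≤4g = ≰4b⇒3k≤4g {g} {#bad ω} (length-filter-complement good? ω) ¬h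

    concentration : ∀ k {E : Pred (List X) 0ℓ} (E? : Decidable E) →
      All (λ ω → fromℕ 3 * size ω ≤ fromℕ 4 * ∑ (λ x → indicator (good? x)) ω → E ω) (tuples k xs) →
      fromℕ 2 ^ k * ∑ (λ ω → 1# - indicator (E? ω)) (tuples k xs) ≤ size (tuples k xs)
    -- Multiplied by 2^k, the claim reads 4^k F ≤ (2 N)^k for F failures and N = `size xs`; the
    -- total weight of all tuples lies between the two sides.
    concentration k {E} E? success = *-cancelˡ-≤ (0<^ k (0<fromℕ-suc 1)) (≤-trans (≤-trans
      (≤-reflexive (trans (sym (*-assoc _ _ _)) (trans
          (*-congʳ (trans (sym (^-distrib-* (fromℕ 2) (fromℕ 2) k))
        (^-congˡ k (solve 0 (con (+ 2) :* con (+ 2) := con (+ 4)) refl))))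
            (sym (∑-*ˡ (fromℕ 4 ^ k) (λ ω → 1# - indicator (E? ω)) Ω)))))
      (∑-mono-All (All.zipWith (λ { {ω} (h , e) → termwise ω h e }) (success , tuples-length k xs))))
      (≤-trans (≤-reflexive (∑-∏-tuples w xs k)) (≤-trans (^-mono-≤ k 0≤∑w ∑w≤2N)
        (≤-reflexive (trans (^-distrib-* (fromℕ 2) (size xs) k) (*-congˡ (sym (size-tuples k xs))))))))
      where
      Ω = tuples k xs
      0≤w : ∀ x → 0# ≤ w x
      0≤w x = ≤-trans 0≤1 (1≤w x)
      0≤∑w : 0# ≤ ∑ w xs
      0≤∑w = ∑-nonNegative 0≤w xs
      0≤∏w : ∀ ω → 0# ≤ ∏ w ω
      0≤∏w ω = ≤-resp-≈ refl (sym (∏w ω)) (0≤^ (4 ℕ.* #bad ω) (0≤fromℕ 4))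
      ∑w≤2N : ∑ w xs ≤ fromℕ 2 * size xs
      ∑w≤2N = ≤-trans (≤-reflexive (trans
          (∑-+ (λ _ → 1#) (λ x → fromℕ 255 * (1# - indicator (good? x))) xs)
          (+-cong (trans (∑-const 1# xs) (*-identityʳ _))
              (∑-*ˡ (fromℕ 255) (λ x → 1# - indicator (good? x)) xs))))
        (*-cancelˡ-≤ (0<fromℕ-suc 255) (certify (0≤fromℕ 255 ⊗ x≤y⇒0≤y-x few-bad ⊕ 0≤fromℕ (length xs))
          (solve 2 (λ N B → con (+ 256) :* (con (+ 2) :* N) := con (+ 256) :* (N :+ con (+ 255) :* B) :+
              (con (+ 255) :* (N :- con (+ 256) :* B) :+ N)) refl (size xs)
              (∑ (λ x → 1# - indicator (good? x)) xs))))
      termwise : ∀ ω → (fromℕ 3 * size ω ≤ fromℕ 4 * ∑ (λ x → indicator (good? x)) ω → E ω) → length ω ≡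
          k →
        fromℕ 4 ^ k * (1# - indicator (E? ω)) ≤ ∏ w ω
      termwise ω h e with E? ω
      ... | yes _ = ≤-resp-≈ (solve 1 (λ p → con (+ 0) := p :* (con (+ 1) :- con (+ 1))) refl
          (fromℕ 4 ^ k)) refl (0≤∏w ω)
      ... | no ¬E = ≤-resp-≈ (solve 1 (λ p → p := p :* (con (+ 1) :- con (+ 0))) refl (fromℕ 4 ^ k))
          (sym (∏w ω))
        (≤-trans (≤-reflexive (^-congʳ (fromℕ 4) (≡.sym e))) (4^-mono (many-bad ω λ m → ¬E (h m))))

value-count : (xs : List X) → value (count xs) ≡ length xs
value-count xs = ≡.trans (from 0 xs) (ℕ.+-identityʳ _)
  where
  from : ∀ k (xs : List X) → value (accumulate (λ k _ → unit (suc k)) k xs) ≡ length xs ℕ.+ k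
  from k []       = ≡.refl
  from k (x ∷ xs) = ≡.trans (from (suc k) xs) (ℕ.+-suc _ _)

-- Group means under uniform sampling and the probability of success.

module SuccessProbability (ℝ : Reals) where
  open Reals ℝ
  open OrderedField ℝ
  open Completeness ℝ
  open ListSum ℝ
  open InnerProduct ℝ
  open Robustness ℝ
  open Iteration ℝ
  open Sampling ℝ
  open MeanEstimation ℝ
  open ≈-Reasoning

  sampleMean-coordinate : ∀ {d} (S : List (Point d)) l →
    value (sampleMean S) l ≈ size S ⁻¹ * ∑ (λ p → p l) S
  sampleMean-coordinate {d} S l = *-cong (reflexive (≡.cong (λ s → fromℕ s ⁻¹) (value-count S)))
    (trans (running S (λ _ → 0#)) (+-identityˡ _))
    where
    running : ∀ S (o : Point d) → value (accumulate (λ q p → forEach λ l → unit (q l + p l)) o S) l ≈ o l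
        + ∑ (λ p → p l) S
    running []      o = sym (+-identityʳ _)
    running (p ∷ S) o = trans (running S (λ l → o l + p l)) (+-assoc _ _ _)

  ∑-allFin : ∀ {n} (f : Fin n → Carrier) → ∑ f (allFin n) ≈ sum f
  ∑-allFin f = reflexive (∑-tabulate f id)

  -- Serves the degenerate case V = 0, where a vanishing total forces every deviation to vanish.
  All-≤-∑ : (f : X → Carrier) → (∀ x → 0# ≤ f x) → ∀ xs → All (λ x → f x ≤ ∑ f xs) xs
  All-≤-∑ f 0≤f []       = []
  All-≤-∑ f 0≤f (x ∷ xs) = certify (∑-nonNegative 0≤f xs) refl
    ∷ All.map (λ h → ≤-trans h (certify (0≤f x) (+-comm _ _))) (All-≤-∑ f 0≤f xs)

  module _ (d n : ℕ) .{{_ : NonZero n}} (A : Multiset d n) where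

    μ : Point d
    μ l = fromℕ n ⁻¹ * sum (λ i → A i l)

    0<n : 0# < fromℕ n
    0<n = 0<fromℕ n

    V : Carrier
    V = cost A μ

    0≤V : 0# ≤ V
    0≤V = sum-nonNegative (λ i → 0≤‖‖² (λ l → A i l - μ l))

    centred : ∀ l → sum (λ i → A i l - μ l) ≈ 0#
    centred l = begin
      sum (λ i → A i l - μ l)                          ≈⟨ sum-+ (λ i → A i l) (λ _ → - μ l) ⟩
      sum (λ i → A i l) + sum {n} (λ _ → - μ l)        ≈⟨ +-congˡ (sum-const n (- μ l)) ⟩
      a + fromℕ n * - (fromℕ n ⁻¹ * a)                 ≈⟨ solve 3
          (λ a n i → a :+ n :* (:- (i :* a)) := a :- n :* i :* a) refl a (fromℕ n) (fromℕ n ⁻¹) ⟩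
      a - fromℕ n * fromℕ n ⁻¹ * a                     ≈⟨ +-congˡ
          (-‿cong (trans (*-congʳ (⁻¹-inverseʳ (pos⇒≉0 0<n))) (*-identityˡ a))) ⟩
      a - a                                            ≈⟨ -‿inverseʳ a ⟩
      0# ∎
      where a = sum (λ i → A i l)

    -- The parallel axis theorem: write A i - c as (A i - μ) - (c - μ) and expand; the cross terms
    -- cancel because the residuals A i - μ sum to zero in each coordinate.
    cost-decomposition : ∀ c → cost A c ≈ V + fromℕ n * ‖ (λ l → c l - μ l) ‖²
    cost-decomposition c = begin
      sum (λ i → ‖ (λ l → A i l - c l) ‖²)
        ≈⟨ sum-cong (λ i → trans (⟨⟩-cong (shift i) (shift i)) (‖‖²-linear 1# (- 1#) (x i) e)) ⟩
      sum (λ i → 1# * 1# * ‖ x i ‖² + fromℕ 2 * 1# * (- 1#) * ⟨ x i , e ⟩ + (- 1#) * (- 1#) * ‖ e ‖²)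
        ≈⟨ trans (sum-+ (λ i → 1# * 1# * ‖ x i ‖² + fromℕ 2 * 1# * (- 1#) * ⟨ x i , e ⟩)
            (λ _ → (- 1#) * (- 1#) * ‖ e ‖²))
             (+-congʳ (sum-+ (λ i → 1# * 1# * ‖ x i ‖²) (λ i → fromℕ 2 * 1# * (- 1#) * ⟨ x i , e ⟩))) ⟩
      sum (λ i → 1# * 1# * ‖ x i ‖²) + sum (λ i → fromℕ 2 * 1# * (- 1#) * ⟨ x i , e ⟩) + sum {n}
          (λ _ → (- 1#) * (- 1#) * ‖ e ‖²)
        ≈⟨ +-cong (+-cong (sum-*ˡ (1# * 1#) (λ i → ‖ x i ‖²))
            (sum-*ˡ (fromℕ 2 * 1# * (- 1#)) (λ i → ⟨ x i , e ⟩))) (sum-const n _) ⟩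
      1# * 1# * V + fromℕ 2 * 1# * (- 1#) * sum (λ i → ⟨ x i , e ⟩) + fromℕ n *
          ((- 1#) * (- 1#) * ‖ e ‖²)
        ≈⟨ +-congʳ (+-congˡ (*-congˡ orthogonal)) ⟩
      1# * 1# * V + fromℕ 2 * 1# * (- 1#) * 0# + fromℕ n * ((- 1#) * (- 1#) * ‖ e ‖²)
        ≈⟨ solve 3 (λ V n E → con (+ 1) :* con (+ 1) :* V :+ con (+ 2) :* con (+ 1) :* (:- con (+ 1)) :*
            con (+ 0) :+ n :* ((:- con (+ 1)) :* (:- con (+ 1)) :* E) := V :+ n :* E) refl V (fromℕ n)
            (‖ e ‖²) ⟩
      V + fromℕ n * ‖ e ‖² ∎
      where
      e : Point d
      e l = c l - μ l
      x : Fin n → Point d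
      x i l = A i l - μ l
      shift : ∀ i l → A i l - c l ≈ 1# * x i l + (- 1#) * e l
      shift i l = solve 3 (λ a c μ → a :- c := con (+ 1) :* (a :- μ) :+ (:- con (+ 1)) :* (c :- μ)) refl
          (A i l) (c l) (μ l)
      orthogonal : sum (λ i → ⟨ x i , e ⟩) ≈ 0#
      orthogonal = begin
        sum (λ i → sum (λ l → x i l * e l))   ≈⟨ SemiringSum.∑-comm semiring (λ i l → x i l * e l) ⟩
        sum (λ l → sum (λ i → x i l * e l))   ≈⟨ sum-cong
            (λ l → trans (sum-cong (λ i → *-comm (x i l) (e l)))
            (trans (sum-*ˡ (e l) (λ i → x i l)) (*-congˡ (centred l)))) ⟩
        sum (λ l → e l * 0#)                  ≈⟨ sum-cong (λ l → *-comm (e l) 0#) ⟩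
        sum (λ l → 0# * e l)                  ≈⟨ sum-*ˡ 0# e ⟩
        0# * sum e                            ≈⟨ zeroˡ _ ⟩
        0# ∎

    -- `Opt` is the negated supremum of the negated costs. If that supremum exceeded - V, its
    -- leastness would produce a point of cost below V, against the decomposition.
    V≤Opt : V ≤ Opt A
    V≤Opt = ≤-resp-≈ (solve 1 (λ v → :- (:- v) := v) refl V) refl (neg-mono-≤ sup≤-V)
      where
      P : Pred Carrier 0ℓ
      P y = ∃[ c ] (- y) ≈ cost A c
      V≤cost : ∀ c → V ≤ cost A c
      V≤cost c = certify (proj₁ 0<n ⊗ 0≤‖‖² (λ l → c l - μ l)) (cost-decomposition c)
      isSup : IsSupremum P (sup P)
      isSup = sup-isSupremum P (- V , μ , solve 1 (λ v → :- (:- v) := v) refl V)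
        (- V , λ { y (c , e) → below y c e })
        where
        below : ∀ y c → (- y) ≈ cost A c → y ≤ - V
        below y c e = certify (x≤y⇒0≤y-x (≤-trans (V≤cost c) (≤-reflexive (sym e))))
          (solve 2 (λ y v → :- v := y :+ (:- y :- v)) refl y V)
      sup≤-V : sup P ≤ - V
      sup≤-V with sup P ≤? - V
      ... | yes h = h
      ... | no ¬h = contradiction (proj₂ isSup (- V) (≰⇒> ¬h)) λ { (y , (c , e) , lt) → <⇒≱ lt
        (certify (x≤y⇒0≤y-x (≤-trans (V≤cost c) (≤-reflexive (sym e))))
          (solve 2 (λ y v → :- v := y :+ (:- y :- v)) refl y V)) }

    groupMean : List (Fin n) → Point d
    groupMean is = value (collect (draw A) is >>= sampleMean)

    -- For a sample of s indices this is s² times the squared distance from the group mean to μ.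
    -- Without the division by s, it is a sum of squares of list sums, to which `second-moment`
    -- applies.
    deviation : List (Fin n) → Carrier
    deviation is = sum (λ l → ∑ (λ i → A i l - μ l) is * ∑ (λ i → A i l - μ l) is)

    groupMean-deviation : ∀ s → 0# < fromℕ s → ∀ is → length is ≡ s →
      fromℕ s * fromℕ s * ‖ (λ l → groupMean is l - μ l) ‖² ≈ deviation is
    groupMean-deviation s 0<s is ≡.refl = trans (sym
        (sum-*ˡ (fromℕ s * fromℕ s) (λ l → (groupMean is l - μ l) * (groupMean is l - μ l))))
      (sum-cong λ l → trans (solve 2 (λ s x → s :* s :* (x :* x) := s :* x :* (s :* x)) refl (fromℕ s)
          (groupMean is l - μ l))
        (*-cong (coordinate l) (coordinate l)))
      where
      coordinate : ∀ l → fromℕ s * (groupMean is l - μ l) ≈ ∑ (λ i → A i l - μ l) is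
      coordinate l = begin
        fromℕ s * (groupMean is l - μ l)
          ≈⟨ *-congˡ (+-congʳ (trans (sampleMean-coordinate (value (collect (draw A) is)) l)
               (*-cong (reflexive (≡.cong (λ S → fromℕ (length S) ⁻¹) (value-collect (draw A) is)))
                 (reflexive (≡.cong (∑ (λ p → p l)) (value-collect (draw A) is)))))) ⟩
        fromℕ s * (size (map A is) ⁻¹ * ∑ (λ p → p l) (map A is) - μ l)
          ≈⟨ *-congˡ (+-congʳ (*-cong (reflexive (≡.cong (λ m → fromℕ m ⁻¹) (List.length-map A is)))
              (reflexive (∑-map (λ p → p l) A is)))) ⟩
        fromℕ s * (fromℕ s ⁻¹ * ∑ (λ i → A i l) is - μ l)
          ≈⟨ solve 4 (λ s i a m → s :* (i :* a :- m) := s :* i :* a :+ s :* (:- m)) refl (fromℕ s)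
              (fromℕ s ⁻¹) (∑ (λ i → A i l) is) (μ l) ⟩
        fromℕ s * fromℕ s ⁻¹ * ∑ (λ i → A i l) is + fromℕ s * - μ l
          ≈⟨ +-cong (trans (*-congʳ (⁻¹-inverseʳ (pos⇒≉0 0<s))) (*-identityˡ _))
              (sym (∑-const (- μ l) is)) ⟩
        ∑ (λ i → A i l) is + ∑ (λ _ → - μ l) is
          ≈⟨ ∑-+ (λ i → A i l) (λ _ → - μ l) is ⟨
        ∑ (λ i → A i l - μ l) is ∎

    -- Divided by n s² |Ω|, this is the mean squared distance V / (n s) of a group mean to μ. The
    -- second moment is taken in each coordinate, where A i - μ is centred.
    total-deviation : ∀ s → fromℕ n * ∑ deviation (tuples s (allFin n)) ≈ fromℕ s * size
        (tuples s (allFin n)) * V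
    total-deviation s = begin
      fromℕ n * ∑ deviation Ω
        ≈⟨ *-congˡ (∑-sum (λ l is → ∑ (z l) is * ∑ (z l) is) Ω) ⟩
      fromℕ n * sum (λ l → ∑ (λ is → ∑ (z l) is * ∑ (z l) is) Ω)
        ≈⟨ sum-*ˡ (fromℕ n) (λ l → ∑ (λ is → ∑ (z l) is * ∑ (z l) is) Ω) ⟨
      sum (λ l → fromℕ n * ∑ (λ is → ∑ (z l) is * ∑ (z l) is) Ω)
        ≈⟨ sum-cong (λ l → trans (*-congʳ (reflexive
            (≡.cong fromℕ (≡.sym (List.length-tabulate {n = n} id)))))
             (trans (second-moment (z l) (allFin n) (trans (∑-allFin (z l)) (centred l)) s)
                 (*-congˡ (∑-allFin (λ i → z l i * z l i))))) ⟩
      sum (λ l → fromℕ s * size Ω * sum (λ i → z l i * z l i))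
        ≈⟨ sum-*ˡ (fromℕ s * size Ω) (λ l → sum (λ i → z l i * z l i)) ⟩
      fromℕ s * size Ω * sum (λ l → sum (λ i → z l i * z l i))
        ≈⟨ *-congˡ (SemiringSum.∑-comm semiring (λ l i → z l i * z l i)) ⟩
      fromℕ s * size Ω * V ∎
      where
      Ω = tuples s (allFin n)
      z : Fin d → Fin n → Carrier
      z l i = A i l - μ l

    module _ (ε : Carrier) (0<ε : 0# < ε) (s : ℕ) (large : fromℕ 256 * fromℕ 64 ≤ fromℕ s * ε) where

      ρ : Carrier
      ρ = ε * V * (fromℕ 64 * fromℕ n) ⁻¹

      private
        0<64n : 0# < fromℕ 64 * fromℕ n
        0<64n = 0<* (0<fromℕ-suc 63) 0<n

        0≤ρ : 0# ≤ ρ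
        0≤ρ = proj₁ 0<ε ⊗ 0≤V ⊗ 0≤⁻¹ 0<64n

        64nρ : fromℕ 64 * fromℕ n * ρ ≈ ε * V
        64nρ = trans (solve 3 (λ m x i → m :* (x :* i) := m :* i :* x) refl (fromℕ 64 * fromℕ n) (ε * V)
            _)
          (trans (*-congʳ (⁻¹-inverseʳ (pos⇒≉0 0<64n))) (*-identityˡ _))

        good? : (is : List (Fin n)) → Dec (‖ (λ l → groupMean is l - μ l) ‖² ≤ ρ)
        good? is = ‖ (λ l → groupMean is l - μ l) ‖² ≤? ρ

        0<s : 0# < fromℕ s
        0<s = ≰⇒> λ h → <⇒≱ (0<* (0<fromℕ-suc 255) (0<fromℕ-suc 63)) (≤-trans large
          (certify (x≤y⇒0≤y-x h ⊗ proj₁ 0<ε) (solve 2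
              (λ s e → con (+ 0) := s :* e :+ (con (+ 0) :- s) :* e) refl (fromℕ s) ε)))

        Ω = tuples s (allFin n)

        #bad : Carrier
        #bad = ∑ (λ is → 1# - indicator (good? is)) Ω

        0≤deviation : ∀ is → 0# ≤ deviation is
        0≤deviation is = sum-nonNegative (λ l → 0≤x² (∑ (λ i → A i l - μ l) is))

      few-bad : fromℕ 256 * #bad ≤ size Ω
      few-bad with V ≤? 0#
      -- Markov's inequality is void for V = 0, as ρ then vanishes too; but in that case every group
      -- mean equals μ, up to distance zero, and none is bad.
      ... | yes V≤0 = ≤-trans (≤-trans (*-monoˡ-≤ (0≤fromℕ 256) (≤-trans
              (∑-mono-All (All.zipWith (λ { {is} (h , e) → never-bad is h e })
                  (All-≤-∑ deviation 0≤deviation Ω , tuples-length s (allFin n))))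
              (≤-reflexive (trans (∑-const 0# Ω) (zeroʳ _))))) (≤-reflexive (zeroʳ _)))
                  (0≤fromℕ (length Ω))
        where
        total≈0 : ∑ deviation Ω ≈ 0#
        total≈0 = x*y≈0⇒y≈0 (pos⇒≉0 0<n) (trans (total-deviation s)
            (trans (*-congˡ (antisym V≤0 0≤V)) (zeroʳ _)))
        never-bad : ∀ is → deviation is ≤ ∑ deviation Ω → length is ≡ s → 1# - indicator (good? is) ≤ 0#
        never-bad is h e with good? is
        ... | yes _ = ≤-reflexive (-‿inverseʳ 1#)
        ... | no ¬g = contradiction (*-cancelˡ-≤ (0<* 0<s 0<s)
            (≤-resp-≈ (sym (groupMean-deviation s 0<s is e)) refl
                (≤-trans h (≤-trans (≤-reflexive total≈0) (proj₁ 0<s ⊗ proj₁ 0<s ⊗ 0≤ρ))))) ¬g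
      -- Markov gives n s² ρ B ≤ s N V for B bad samples out of N. With 64 n ρ = ε V this is s ε B ≤
      -- 64 N after cancelling s V, and s ε ≥ 256 · 64.
      ... | no V≰0 = *-cancelˡ-≤ (0<* (0<fromℕ-suc 63) (0<* 0<s 0<V)) (certify
          (0≤fromℕ 64 ⊗ (x≤y⇒0≤y-x markov) ⊕ x≤y⇒0≤y-x large ⊗ (0≤#bad ⊗ (proj₁ 0<s ⊗ 0≤V)))
          (begin
            fromℕ 64 * (fromℕ s * V) * size Ω
              ≈⟨ solve 6 (λ s V N B e q → con (+ 64) :* (s :* V) :* N := con (+ 64) :* (s :* V) :*
                  (con (+ 256) :* B)
                   :+ (con (+ 64) :* (s :* N :* V :- q :* B) :+ (s :* e :- con (+ 256) :* con (+ 64)) :*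
                       (B :* (s :* V)) :+ (con (+ 64) :* q :- s :* s :* (e :* V)) :* B)) refl (fromℕ s) V
                       (size Ω) #bad ε q ⟩
            _ + (_ + (fromℕ 64 * q - fromℕ s * fromℕ s * (ε * V)) * #bad)
              ≈⟨ +-congˡ (trans (+-congˡ (trans (*-congʳ q-eq) (zeroˡ _))) (+-identityʳ _)) ⟩
            _ ∎))
        where
        0<V = ≰⇒> V≰0
        q = fromℕ n * (fromℕ s * fromℕ s * ρ)
        q-eq : fromℕ 64 * q - fromℕ s * fromℕ s * (ε * V) ≈ 0#
        q-eq = trans (+-congʳ (trans (solve 3
            (λ s n r → con (+ 64) :* (n :* (s :* s :* r)) := s :* s :* (con (+ 64) :* n :* r)) refl
            (fromℕ s) (fromℕ n) ρ)
          (*-congˡ 64nρ))) (-‿inverseʳ _)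
        0≤#bad : 0# ≤ #bad
        0≤#bad = ∑-nonNegative (λ is → 0≤1-indicator (good? is)) Ω
        termwise : ∀ is → length is ≡ s → fromℕ s * fromℕ s * ρ * (1# - indicator (good? is)) ≤ deviation
            is
        termwise is e with good? is
        ... | yes _ = ≤-resp-≈ (solve 1 (λ x → con (+ 0) := x :* (con (+ 1) :- con (+ 1))) refl
            (fromℕ s * fromℕ s * ρ)) refl (0≤deviation is)
        ... | no ¬g = ≤-resp-≈ (solve 1 (λ x → x := x :* (con (+ 1) :- con (+ 0))) refl
            (fromℕ s * fromℕ s * ρ)) (groupMean-deviation s 0<s is e)
                        (*-monoˡ-≤ (proj₁ 0<s ⊗ proj₁ 0<s) (proj₁ (≰⇒> ¬g)))
        markov : q * #bad ≤ fromℕ s * size Ω * V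
        markov = ≤-trans (≤-reflexive (trans (*-assoc _ _ _)
            (*-congˡ (sym (∑-*ˡ (fromℕ s * fromℕ s * ρ) (λ is → 1# - indicator (good? is)) Ω)))))
          (≤-trans (*-monoˡ-≤ (proj₁ 0<n) (∑-mono-All
              (All.map (λ {is} → termwise is) (tuples-length s (allFin n)))))
            (≤-reflexive (total-deviation s)))

      success-probability : ∀ k δ → 0# < δ → 0# < fromℕ k → δ ⁻¹ ≤ fromℕ 2 ^ k →
        ∀ median → MedianRoutine median → ∀ T →
        1# - δ ≤ probability (samples n s k) (λ ω → approximateMean? A ε
            (value (meanEstimate (fastGD median T) A ω)))
      success-probability k δ 0<δ 0<k small median isMedian T = ≤⁻¹-shift 0<Ω
          (≤-resp-≈ refl (sym (∑-indicator success? Ω′)) (certify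
          -- F ≤ δ 2^k F ≤ δ N for F failures among N outcomes.
          (proj₁ 0<δ ⊗ x≤y⇒0≤y-x tail ⊕ x≤y⇒0≤y-x 1≤δ2^k ⊗ 0≤fails)
          (begin
            ∑ (indicator ∘ success?) Ω′
              ≈⟨ solve 5 (λ S F N d p → S := (con (+ 1) :- d) :* N :+
                  (d :* (N :- p :* F) :+ (d :* p :- con (+ 1)) :* F) :+ (F :- (N :- S))) refl
                  (∑ (indicator ∘ success?) Ω′) fails (size Ω′) δ (fromℕ 2 ^ k) ⟩
            _ + (fails - (size Ω′ - ∑ (indicator ∘ success?) Ω′))
              ≈⟨ trans (+-congˡ (trans (+-congʳ fails-eq) (-‿inverseʳ _))) (+-identityʳ _) ⟩
            _ ∎)))
        where
        Ω′ = samples n s k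
        estimate : List (List (Fin n)) → Point d
        estimate ω = value (meanEstimate (fastGD median T) A ω)
        success? : ∀ ω → Dec (ApproximateMean A ε (estimate ω))
        success? ω = approximateMean? A ε (estimate ω)
        fails : Carrier
        fails = ∑ (λ ω → 1# - indicator (success? ω)) Ω′

        0≤fails : 0# ≤ fails
        0≤fails = ∑-nonNegative (λ ω → 0≤1-indicator (success? ω)) Ω′

        fails-eq : fails ≈ size Ω′ - ∑ (indicator ∘ success?) Ω′
        fails-eq = trans (∑-+ (λ _ → 1#) (λ ω → - indicator (success? ω)) Ω′)
          (+-cong (trans (∑-const 1# Ω′) (*-identityʳ _))
              (trans (∑-cong (λ ω → solve 1 (λ x → :- x := :- con (+ 1) :* x) refl
              (indicator (success? ω))) Ω′)
            (trans (∑-*ˡ (- 1#) (indicator ∘ success?) Ω′)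
                (solve 1 (λ x → :- con (+ 1) :* x := :- x) refl _))))

        0<Ω : 0# < size Ω′
        0<Ω = <-resp-≈ refl (sym (size-tuples k Ω)) (0<^ k
            (<-resp-≈ refl (sym (size-tuples s (allFin n)))
          (0<^ s (<-resp-≈ refl (reflexive (≡.cong fromℕ (≡.sym (List.length-tabulate {n = n} id))))
              0<n))))

        1≤δ2^k : 1# ≤ δ * fromℕ 2 ^ k
        1≤δ2^k = ≤-trans (≤-reflexive (sym (⁻¹-inverseʳ (pos⇒≉0 0<δ)))) (*-monoˡ-≤ (proj₁ 0<δ) small)

        succeeds : ∀ ω → length ω ≡ k → fromℕ 3 * size ω ≤ fromℕ 4 * ∑ (λ is → indicator (good? is)) ω →
                   ApproximateMean A ε (estimate ω)
        succeeds ω e mostly-good = ≤-trans (≤-reflexive (cost-decomposition (estimate ω)))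
          (≤-trans (certify (x≤y⇒0≤y-x (*-monoˡ-≤ (proj₁ 0<n) near))
            (trans (solve 2 (λ V E → (con (+ 1) :+ E) :* V := V :+ E :* V) refl V ε)
            (trans (+-congˡ (trans (sym 64nρ) (solve 3
                (λ n r D → con (+ 64) :* n :* r := n :* D :+ (n :* (con (+ 64) :* r) :- n :* D)) refl
                (fromℕ n) ρ (‖ (λ l → estimate ω l - μ l) ‖²))))
              (sym (+-assoc _ _ _)))))
            (*-monoˡ-≤ (0≤1 ⊕ proj₁ 0<ε) V≤Opt))
          where
          length≡ : length (map groupMean ω) ≡ length ω
          length≡ = List.length-map groupMean ω
          near : ‖ (λ l → estimate ω l - μ l) ‖² ≤ fromℕ 64 * ρ
          near = ≡.subst (λ P → ‖ (λ l → value (fastGD median T P) l - μ l) ‖² ≤ fromℕ 64 * ρ)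
            (≡.sym (value-collect (λ is → collect (draw A) is >>= sampleMean) ω))
            (fastGD-near μ ρ 0≤ρ (map groupMean ω)
              (<-resp-≈ refl (reflexive (≡.cong fromℕ (≡.trans (≡.sym e) (≡.sym length≡)))) 0<k)
              (≤-resp-≈ (*-congˡ (reflexive (≡.cong fromℕ (≡.sym length≡))))
                (*-congˡ (reflexive (≡.sym (∑-map (λ p → indicator (‖ (λ l → p l - μ l) ‖² ≤? ρ))
                    groupMean ω)))) mostly-good)
              median isMedian T)

        tail : fromℕ 2 ^ k * fails ≤ size Ω′
        tail = concentration good? Ω few-bad k success?
          (All.map (λ {ω} → succeeds ω) (tuples-length k Ω))

-- Natural number arithmetic and the cost of the basic loops.

if-elim : {Q : X → Set} (b : Bool) {x y : X} → (T b → Q x) → (¬ T b → Q y) → Q (if b then x else y)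
if-elim true  hx hy = hx _
if-elim false hx hy = hy λ ()

-- Linear arithmetic over ℕ: the hypothesis x ≤ y and the slack s prove
-- m ≤ n, the equation being left to the semiring solver.
certify-ℕ : ∀ {x y m n s} → x ℕ.≤ y → n ℕ.+ x ≡ m ℕ.+ y ℕ.+ s → m ℕ.≤ n
certify-ℕ {x} {y} {m} {n} {s} h e = ℕ.+-cancelʳ-≤ x m n
  (ℕ.≤-trans (ℕ.+-monoʳ-≤ m h) (ℕ.≤-trans (ℕ.m≤m+n (m ℕ.+ y) s) (ℕ.≤-reflexive (≡.sym e))))

n≤1+2⌊n/2⌋ : ∀ n → n ℕ.≤ 1 ℕ.+ 2 ℕ.* ⌊ n /2⌋
n≤1+2⌊n/2⌋ zero          = ℕ.z≤n
n≤1+2⌊n/2⌋ (suc zero)    = ℕ.s≤s ℕ.z≤n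
n≤1+2⌊n/2⌋ (suc (suc n)) = certify-ℕ (n≤1+2⌊n/2⌋ n)
  (solve 2 (λ n h → con 1 :+ con 2 :* (con 1 :+ h) :+ n := con 2 :+ n :+ (con 1 :+ con 2 :* h) :+ con 0)
      ≡.refl n ⌊ n /2⌋)
  where open +-*-Solver

2⌊n/2⌋≤n : ∀ n → 2 ℕ.* ⌊ n /2⌋ ℕ.≤ n
2⌊n/2⌋≤n zero          = ℕ.z≤n
2⌊n/2⌋≤n (suc zero)    = ℕ.z≤n
2⌊n/2⌋≤n (suc (suc n)) = certify-ℕ (2⌊n/2⌋≤n n)
  (solve 2 (λ n h → con 2 :+ n :+ con 2 :* h := con 2 :* (con 1 :+ h) :+ n :+ con 0) ≡.refl n ⌊ n /2⌋)
  where open +-*-Solver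

time-accumulate : ∀ {c} {f : Y → X → RAM Y} → (∀ y x → time (f y x) ℕ.≤ c) → ∀ y xs →
                  time (accumulate f y xs) ℕ.≤ suc c ℕ.* length xs ℕ.+ 1
time-accumulate {c = c} h y []       = ℕ.m≤n+m 1 (suc c ℕ.* 0)
time-accumulate {c = c} {f} h y (x ∷ xs) = certify-ℕ
    (ℕ.+-mono-≤ (h y x) (time-accumulate {f = f} h (value (f y x)) xs))
  (solve 4 (λ c l a b → ((con 1 :+ c) :* (con 1 :+ l) :+ con 1) :+ (a :+ b) := (con 1 :+ (a :+ b)) :+
      (c :+ ((con 1 :+ c) :* l :+ con 1)) :+ con 0) ≡.refl
    c (length xs) (time (f y x)) (time (accumulate f (value (f y x)) xs)))
  where open +-*-Solver

time-collect : ∀ {c} {f : X → RAM Y} {xs} → All (λ x → time (f x) ℕ.≤ c) xs →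
               time (collect f xs) ℕ.≤ suc c ℕ.* length xs ℕ.+ 1
time-collect {c = c} []       = ℕ.m≤n+m 1 (suc c ℕ.* 0)
time-collect {c = c} {f} {x ∷ xs} (h ∷ hs) = certify-ℕ (ℕ.+-mono-≤ h (time-collect {f = f} hs))
  (solve 4 (λ c l a b → ((con 1 :+ c) :* (con 1 :+ l) :+ con 1) :+ (a :+ b) :=
      (con 1 :+ (a :+ (b :+ con 0))) :+ (c :+ ((con 1 :+ c) :* l :+ con 1)) :+ con 0) ≡.refl
    c (length xs) (time (f x)) (time (collect f xs)))
  where open +-*-Solver

time-count : (xs : List X) → time (count xs) ℕ.≤ 2 ℕ.* length xs ℕ.+ 1
time-count = time-accumulate {f = λ k _ → unit (suc k)} (λ _ _ → ℕ.≤-refl) 0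

-- Ranks, sorting of short lists, block medians and partitioning.

module Selection (ℝ : Reals) where
  open Reals ℝ
  open OrderedField ℝ using (≤-refl; ≤-trans; ≤-reflexive; total; sym; <⇒≱; ≰⇒>)
  open MeanEstimation ℝ

  #≤ #≥ : Carrier → List Carrier → ℕ
  #≤ v xs = length (filter (_≤? v) xs)
  #≥ v xs = length (filter (v ≤?_) xs)

  -- v can stand at the zero-based position i after sorting xs.
  IsRank : ℕ → List Carrier → Carrier → Set
  IsRank i xs v = i ℕ.< #≤ v xs × length xs ℕ.≤ i ℕ.+ #≥ v xs

  private
    variable
      P Q : Pred Carrier 0ℓ

  #-++ : (P? : Decidable P) → ∀ xs ys → length (filter P? (xs ++ ys)) ≡ length (filter P? xs) ℕ.+ length
      (filter P? ys)
  #-++ P? xs ys = ≡.trans (≡.cong length (List.filter-++ P? xs ys)) (List.length-++ (filter P? xs))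

  #-↭ : (P? : Decidable P) → ∀ {xs ys} → xs ↭ ys → length (filter P? xs) ≡ length (filter P? ys)
  #-↭ P? h = ↭.↭-length (↭.filter-↭ P? h)

  #-all : (P? : Decidable P) → ∀ {xs} → All P xs → length (filter P? xs) ≡ length xs
  #-all P? h = ≡.cong length (List.filter-all P? h)

  #-none : (P? : Decidable P) → ∀ {xs} → All (λ x → ¬ P x) xs → length (filter P? xs) ≡ 0
  #-none P? h = ≡.cong length (List.filter-none P? h)

  #-mono : (P? : Decidable P) (Q? : Decidable Q) → (∀ x → P x → Q x) → ∀ xs →
           length (filter P? xs) ℕ.≤ length (filter Q? xs)
  #-mono P? Q? h []       = ℕ.z≤n
  #-mono P? Q? h (x ∷ xs) with P? x | Q? x
  ... | yes _ | yes _ = ℕ.s≤s (#-mono P? Q? h xs)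
  ... | yes p | no ¬q = contradiction (h x p) ¬q
  ... | no _  | yes _ = ℕ.m≤n⇒m≤1+n (#-mono P? Q? h xs)
  ... | no _  | no _  = #-mono P? Q? h xs

  IsRank-↭ : ∀ {i xs ys v} → xs ↭ ys → IsRank i xs v → IsRank i ys v
  IsRank-↭ {i} {v = v} h (a , b) = ≡.subst (i ℕ.<_) (#-↭ (_≤? v) h) a ,
    ≡.subst₂ (λ m n → m ℕ.≤ i ℕ.+ n) (↭.↭-length h) (#-↭ (v ≤?_) h) b

  insert-↭ : ∀ x ys → value (insert x ys) ↭ x ∷ ys
  insert-↭ x []       = ↭.↭-refl
  insert-↭ x (y ∷ ys) with x ≤? y
  ... | yes _ = ↭.↭-refl
  ... | no  _ = ↭.trans (↭.prep y (insert-↭ x ys)) (↭.swap y x ↭.↭-refl)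

  insert-sorted : ∀ x {ys} → AllPairs _≤_ ys → AllPairs _≤_ (value (insert x ys))
  insert-sorted x []              = [] ∷ []
  insert-sorted x {y ∷ ys} (h ∷ s) with x ≤? y
  ... | yes x≤y = (x≤y ∷ All.map (≤-trans x≤y) h) ∷ h ∷ s
  ... | no  x≰y = ↭.All-resp-↭ (↭.↭-sym (insert-↭ x ys)) (proj₁ (≰⇒> x≰y) ∷ h) ∷ insert-sorted x s

  insertionSort-↭ : ∀ xs → value (insertionSort xs) ↭ xs
  insertionSort-↭ []       = ↭.↭-refl
  insertionSort-↭ (x ∷ xs) = ↭.trans (insert-↭ x _) (↭.prep x (insertionSort-↭ xs))

  insertionSort-sorted : ∀ xs → AllPairs _≤_ (value (insertionSort xs))
  insertionSort-sorted []       = []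
  insertionSort-sorted (x ∷ xs) = insert-sorted x (insertionSort-sorted xs)

  nth-All : ∀ {i xs} → All P xs → i ℕ.< length xs → P (value (nth i xs))
  nth-All {i = zero}  (p ∷ _) _ = p
  nth-All {i = suc i} (_ ∷ ps) (ℕ.s≤s h) = nth-All ps h

  #-∷ : (P? : Decidable P) → ∀ {x} xs → P x → length (filter P? (x ∷ xs)) ≡ suc (length (filter P? xs))
  #-∷ P? xs p = ≡.cong length (List.filter-accept P? p)

  nth-sorted : ∀ {i xs} → AllPairs _≤_ xs → i ℕ.< length xs → IsRank i xs (value (nth i xs))
  nth-sorted {zero}  {x ∷ xs} (h ∷ s) _ =
    ≡.subst (1 ℕ.≤_) (≡.sym (#-∷ (_≤? x) xs ≤-refl)) (ℕ.s≤s ℕ.z≤n) ,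
    ℕ.≤-reflexive (≡.sym (#-all (x ≤?_) (≤-refl ∷ h)))
  nth-sorted {suc i} {x ∷ xs} (h ∷ s) (ℕ.s≤s lt) with nth-sorted s lt
  ... | a , b = ≡.subst (suc i ℕ.<_) (≡.sym (#-∷ (_≤? v) {x} xs (nth-All {P = x ≤_} h lt))) (ℕ.s≤s a) ,
                ℕ.s≤s (ℕ.≤-trans b (ℕ.+-monoʳ-≤ i (≡.subst (#≥ v xs ℕ.≤_)
                    (≡.sym (#-++ (v ≤?_) (x ∷ []) xs)) (ℕ.m≤n+m (#≥ v xs) (#≥ v (x ∷ []))))))
    where v = value (nth i xs)

  sort-nth : ∀ {i} xs → i ℕ.< length xs → IsRank i xs (value (insertionSort xs >>= nth i))
  sort-nth xs lt = IsRank-↭ (insertionSort-↭ xs)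
    (nth-sorted (insertionSort-sorted xs) (≡.subst (_ ℕ.<_) (≡.sym (↭.↭-length (insertionSort-↭ xs)))
        lt))

  time-insert : ∀ x ys → time (insert x ys) ℕ.≤ suc (length ys)
  time-insert x []       = ℕ.≤-refl
  time-insert x (y ∷ ys) with x ≤? y
  ... | yes _ = ℕ.s≤s ℕ.z≤n
  ... | no  _ = ℕ.s≤s (≡.subst (ℕ._≤ suc (length ys)) (≡.sym (ℕ.+-identityʳ _)) (time-insert x ys))

  time-insertionSort : ∀ xs → time (insertionSort xs) ℕ.≤ suc (length xs) ℕ.* suc (length xs)
  time-insertionSort []       = ℕ.≤-refl
  time-insertionSort (x ∷ xs) = certify-ℕ
    (ℕ.+-mono-≤ (time-insertionSort xs) (≡.subst
        (λ n → time (insert x (value (insertionSort xs))) ℕ.≤ suc n) (↭.↭-length (insertionSort-↭ xs))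
        (time-insert x (value (insertionSort xs)))))
    (solve 3 (λ l a b → (con 2 :+ l) :* (con 2 :+ l) :+ (a :+ b) := (con 1 :+ (a :+ b)) :+
        ((con 1 :+ l) :* (con 1 :+ l) :+ (con 1 :+ l)) :+ (l :+ con 1)) ≡.refl
      (length xs) (time (insertionSort xs)) (time (insert x (value (insertionSort xs)))))
    where open +-*-Solver

  time-nth : ∀ i xs → time (nth i xs) ℕ.≤ suc (length xs)
  time-nth i       []       = ℕ.≤-refl
  time-nth zero    (x ∷ xs) = ℕ.s≤s ℕ.z≤n
  time-nth (suc i) (x ∷ xs) = ℕ.s≤s (time-nth i xs)

  time-sort-nth : ∀ i xs → length xs ℕ.≤ 5 → time (insertionSort xs >>= nth i) ℕ.≤ 42
  -- 42 = 6 · 6 for sorting at most five elements, plus 6 for the lookup.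
  time-sort-nth i xs h = ℕ.+-mono-≤ (ℕ.≤-trans (time-insertionSort xs) (ℕ.*-mono-≤ (ℕ.s≤s h) (ℕ.s≤s h)))
    (ℕ.≤-trans (time-nth i (value (insertionSort xs)))
        (ℕ.s≤s (≡.subst (ℕ._≤ 5) (≡.sym (↭.↭-length (insertionSort-↭ xs))) h)))

  -- The 4 accounts for a dropped incomplete block. In `lower` and `upper`, each block median on one
  -- side of p brings along three elements of its block on the same side, for every p at once, since
  -- the pivot is found only later.
  record Blocks (xs ms : List Carrier) : Set where
    field
      5*length≤ : 5 ℕ.* length ms ℕ.≤ length xs
      length≤   : length xs ℕ.≤ 5 ℕ.* length ms ℕ.+ 4
      lower     : ∀ p → 3 ℕ.* #≤ p ms ℕ.≤ #≤ p xs
      upper     : ∀ p → 3 ℕ.* #≥ p ms ℕ.≤ #≥ p xs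

  -- For R = (_≤ m) and P = (_≤ p), or both reversed: if the median m of a block
  -- of five satisfies P, then so do at least three of its elements.
  block-majority : {P R : Pred Carrier 0ℓ} (P? : Decidable P) (R? : Decidable R) → ∀ block m xs ms →
    (P m → ∀ x → R x → P x) → 3 ℕ.≤ length (filter R? block) →
    3 ℕ.* length (filter P? ms) ℕ.≤ length (filter P? xs) →
    3 ℕ.* length (filter P? (m ∷ ms)) ℕ.≤ length (filter P? (block ++ xs))
  block-majority {P} P? R? block m xs ms closed three h = ≡.subst
      (3 ℕ.* length (filter P? (m ∷ ms)) ℕ.≤_)
    (≡.sym (#-++ P? block xs)) (go (P? m))
    where
    go : Dec (P m) → 3 ℕ.* length (filter P? (m ∷ ms)) ℕ.≤ length (filter P? block) ℕ.+ length
        (filter P? xs)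
    go (yes p) = ≡.subst (ℕ._≤ length (filter P? block) ℕ.+ length (filter P? xs))
      (≡.sym (≡.trans (≡.cong (3 ℕ.*_) (#-∷ P? ms p)) (ℕ.*-suc 3 _)))
      (ℕ.+-mono-≤ (ℕ.≤-trans three (#-mono R? P? (closed p) block)) h)
    go (no ¬p) = ≡.subst (λ l → 3 ℕ.* l ℕ.≤ length (filter P? block) ℕ.+ length (filter P? xs))
      (≡.sym (≡.cong length (List.filter-reject P? ¬p))) (ℕ.≤-trans h (ℕ.m≤n+m _ _))

  blockMedians-blocks : ∀ xs → Blocks xs (value (blockMedians xs))
  blockMedians-blocks (x₁ ∷ x₂ ∷ x₃ ∷ x₄ ∷ x₅ ∷ xs) = record
    { 5*length≤ = ≡.subst (ℕ._≤ 5 ℕ.+ length xs) (≡.sym (ℕ.*-suc 5 (length ms)))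
        (ℕ.+-monoʳ-≤ 5 5*length≤)
    ; length≤   = ≡.subst (5 ℕ.+ length xs ℕ.≤_) (≡.cong (ℕ._+ 4) (≡.sym (ℕ.*-suc 5 (length ms))))
        (ℕ.+-monoʳ-≤ 5 length≤)
    ; lower     = λ p → block-majority (_≤? p) (_≤? m) block m xs ms (λ m≤p x x≤m → ≤-trans x≤m m≤p)
        (proj₁ rank) (lower p)
    ; upper     = λ p → block-majority (p ≤?_) (m ≤?_) block m xs ms (λ p≤m x m≤x → ≤-trans p≤m m≤x)
        (ℕ.+-cancelˡ-≤ 2 3 (#≥ m block) (proj₂ rank)) (upper p)
    }
    where
    open Blocks (blockMedians-blocks xs)
    block = x₁ ∷ x₂ ∷ x₃ ∷ x₄ ∷ x₅ ∷ []
    ms = value (blockMedians xs)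
    m = value (insertionSort block >>= nth 2)
    -- Rank 2 among five elements: at least three are at most m, and at least three are at least m.
    rank : IsRank 2 block m
    rank = sort-nth block (ℕ.s≤s (ℕ.s≤s (ℕ.s≤s ℕ.z≤n)))
  blockMedians-blocks [] = record { 5*length≤ = ℕ.z≤n ; length≤ = ℕ.z≤n ; lower = λ _ → ℕ.z≤n ; upper = λ
      _ → ℕ.z≤n }
  blockMedians-blocks (_ ∷ []) = record { 5*length≤ = ℕ.z≤n ; length≤ = ℕ.s≤s ℕ.z≤n ; lower = λ _ → ℕ.z≤n
      ; upper = λ _ → ℕ.z≤n }
  blockMedians-blocks (_ ∷ _ ∷ []) = record { 5*length≤ = ℕ.z≤n ; length≤ = ℕ.s≤s (ℕ.s≤s ℕ.z≤n) ; lower =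
      λ _ → ℕ.z≤n ; upper = λ _ → ℕ.z≤n }
  blockMedians-blocks (_ ∷ _ ∷ _ ∷ []) = record
      { 5*length≤ = ℕ.z≤n ; length≤ = ℕ.s≤s (ℕ.s≤s (ℕ.s≤s ℕ.z≤n)) ; lower = λ _ → ℕ.z≤n ; upper = λ _ →
      ℕ.z≤n }
  blockMedians-blocks (_ ∷ _ ∷ _ ∷ _ ∷ []) = record
      { 5*length≤ = ℕ.z≤n ; length≤ = ℕ.s≤s (ℕ.s≤s (ℕ.s≤s (ℕ.s≤s ℕ.z≤n))) ; lower = λ _ → ℕ.z≤n ; upper =
      λ _ → ℕ.z≤n }

  time-blockMedians : ∀ xs → time (blockMedians xs) ℕ.≤ 43 ℕ.* length xs ℕ.+ 1
  time-blockMedians (x₁ ∷ x₂ ∷ x₃ ∷ x₄ ∷ x₅ ∷ xs) = certify-ℕ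
    (ℕ.+-mono-≤ (time-sort-nth 2 block ℕ.≤-refl) (time-blockMedians xs))
    (solve 4 (λ l a b c → (con 43 :* (con 5 :+ l) :+ con 1) :+ ((a :+ b) :+ c) :=
        (con 1 :+ (a :+ (b :+ (c :+ con 0)))) :+ (con 42 :+ (con 43 :* l :+ con 1)) :+ con 172) ≡.refl
      (length xs) (time (insertionSort block)) (time (nth 2 (value (insertionSort block))))
          (time (blockMedians xs)))
    where
    block = x₁ ∷ x₂ ∷ x₃ ∷ x₄ ∷ x₅ ∷ []
    open +-*-Solver
  time-blockMedians [] = ℕ.m≤n+m 1 (43 ℕ.* 0)
  time-blockMedians (_ ∷ []) = ℕ.m≤n+m 1 (43 ℕ.* 1)
  time-blockMedians (_ ∷ _ ∷ []) = ℕ.m≤n+m 1 (43 ℕ.* 2)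
  time-blockMedians (_ ∷ _ ∷ _ ∷ []) = ℕ.m≤n+m 1 (43 ℕ.* 3)
  time-blockMedians (_ ∷ _ ∷ _ ∷ _ ∷ []) = ℕ.m≤n+m 1 (43 ℕ.* 4)

  -- Strict comparisons appear as negations, the form in which a filter by the opposite comparison
  -- is seen to be empty.
  record Partition (p : Carrier) (xs : List Carrier) (parts : List Carrier × List Carrier × List Carrier)
      : Set where
    constructor partitioned
    below = proj₁ parts
    equal = proj₁ (proj₂ parts)
    above = proj₂ (proj₂ parts)
    field
      permutation : xs ↭ below ++ equal ++ above
      below<      : All (λ x → ¬ p ≤ x) below
      equal≈      : All (λ x → x ≤ p × p ≤ x) equal
      above>      : All (λ x → ¬ x ≤ p) above

  partition-partitions : ∀ p xs → Partition p xs (value (partition p xs))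
  partition-partitions p []       = partitioned ↭.↭-refl [] [] []
  partition-partitions p (x ∷ xs) with partition-partitions p xs
  ... | partitioned perm b e a with x ≟ p
  ...   | yes x≈p = partitioned (↭.trans (↭.prep x perm) (↭.↭-sym (↭.shift x _ _))) b
                      ((≤-reflexive x≈p , ≤-reflexive (sym x≈p)) ∷ e) a
  ...   | no  x≉p with x ≤? p
  ...     | yes x≤p = partitioned (↭.prep x perm) (<⇒≱ (x≤p , x≉p) ∷ b) e a
  ...     | no  x≰p = partitioned (↭.trans (↭.prep x perm) (↭.↭-sym (shift₂ (value (partition p xs))))) b
      e (x≰p ∷ a)
    where
    shift₂ : (t : List Carrier × List Carrier × List Carrier) →
      proj₁ t ++ proj₁ (proj₂ t) ++ x ∷ proj₂ (proj₂ t) ↭ x ∷ proj₁ t ++ proj₁ (proj₂ t) ++ proj₂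
          (proj₂ t)
    shift₂ (b , e , a) = ↭.trans (↭.++⁺ˡ b (↭.shift x e a)) (↭.shift x b (e ++ a))

  time-partition : ∀ p xs → time (partition p xs) ℕ.≤ length xs ℕ.+ 1
  time-partition p []       = ℕ.≤-refl
  time-partition p (x ∷ xs) = ℕ.s≤s (≡.subst (ℕ._≤ length xs ℕ.+ 1) (≡.sym (ℕ.+-identityʳ _))
      (time-partition p xs))

-- Correctness and linear running time of median-of-medians selection.

5<n≤5m+4⇒1≤m : ∀ {n} m → 5 ℕ.< n → n ℕ.≤ 5 ℕ.* m ℕ.+ 4 → 1 ℕ.≤ m
5<n≤5m+4⇒1≤m zero    5<n n≤ = contradiction (ℕ.≤-trans 5<n n≤) λ { (ℕ.s≤s (ℕ.s≤s (ℕ.s≤s (ℕ.s≤s ())))) }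
5<n≤5m+4⇒1≤m (suc m) _   _  = ℕ.s≤s ℕ.z≤n

-- The recurrence t(n) ≤ 52 n + 60 + t(m) + t(r) for m medians of blocks of
-- five and a remainder r ≤ n - 3 m / 2.
select-recurrence : ∀ K → 1056 ℕ.≤ K → ∀ {n m r β η t₁ t₂ t₃ t₄ t₅ t₆ t₇ t₈} →
  5 ℕ.< n → n ℕ.≤ 5 ℕ.* m ℕ.+ 4 → m ℕ.≤ n → β ℕ.≤ n → η ℕ.≤ n → 2 ℕ.* r ℕ.+ 3 ℕ.* m ℕ.≤ 2 ℕ.* n →
  t₁ ℕ.≤ 2 ℕ.* n ℕ.+ 1 → t₂ ℕ.≤ 43 ℕ.* n ℕ.+ 1 → t₃ ℕ.≤ 2 ℕ.* m ℕ.+ 1 → t₄ ℕ.≤ K ℕ.* m ℕ.+ 53 →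
  t₅ ℕ.≤ n ℕ.+ 1 → t₆ ℕ.≤ 2 ℕ.* β ℕ.+ 1 → t₇ ℕ.≤ 2 ℕ.* η ℕ.+ 1 → t₈ ℕ.≤ K ℕ.* r ℕ.+ 53 →
  suc (t₁ ℕ.+ (t₂ ℕ.+ (t₃ ℕ.+ (t₄ ℕ.+ (t₅ ℕ.+ (t₆ ℕ.+ (t₇ ℕ.+ t₈))))))) ℕ.≤ K ℕ.* n ℕ.+ 53
select-recurrence K 1056≤K {n} {m} {r} {β} {η} 5<n n≤ m≤n β≤n η≤n r≤ h₁ h₂ h₃ h₄ h₅ h₆ h₇ h₈ =
  ℕ.≤-trans (ℕ.s≤s (ℕ.+-mono-≤ h₁ (ℕ.+-mono-≤ h₂ (ℕ.+-mono-≤ (ℕ.≤-trans h₃ (double m≤n)) (ℕ.+-mono-≤ h₄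
      (ℕ.+-mono-≤ h₅ (ℕ.+-mono-≤ (ℕ.≤-trans h₆ (double β≤n))
          (ℕ.+-mono-≤ (ℕ.≤-trans h₇ (double η≤n)) h₈))))))))
    (ℕ.*-cancelˡ-≤ 2 (certify-ℕ (ℕ.+-mono-≤ (ℕ.*-monoʳ-≤ K r≤) 104n+120≤Km)
      (solve 4 (λ K n m r → con 2 :* (K :* n :+ con 53) :+
          (K :* (con 2 :* r :+ con 3 :* m) :+ (con 104 :* n :+ con 120))
          := con 2 :* (con 1 :+ ((con 2 :* n :+ con 1) :+
              ((con 43 :* n :+ con 1) :+ ((con 2 :* n :+ con 1) :+ ((K :* m :+ con 53)
             :+ ((n :+ con 1) :+ ((con 2 :* n :+ con 1) :+
                 ((con 2 :* n :+ con 1) :+ (K :* r :+ con 53))))))))) :+ (K :* (con 2 :* n) :+ K :* m) :+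
                 con 0)
        ≡.refl K n m r)))
  where
  open +-*-Solver
  double : ∀ {x} → x ℕ.≤ n → 2 ℕ.* x ℕ.+ 1 ℕ.≤ 2 ℕ.* n ℕ.+ 1
  double h = ℕ.+-monoˡ-≤ 1 (ℕ.*-monoʳ-≤ 2 h)
  1≤m : 1 ℕ.≤ m
  1≤m = 5<n≤5m+4⇒1≤m m 5<n n≤
  -- After doubling, the recursive calls cost K (2 m + 2 r) ≤ 2 K n - K m, up to constants, so K m
  -- has to pay for 2 (52 n + 60). By n ≤ 5 m + 4 and m ≥ 1, the latter is at most 520 m + 536 ≤
  -- 1056 m.
  104n+120≤Km : 104 ℕ.* n ℕ.+ 120 ℕ.≤ K ℕ.* m
  104n+120≤Km = ℕ.≤-trans (certify-ℕ (ℕ.+-mono-≤ (ℕ.*-monoʳ-≤ 104 n≤) (ℕ.*-monoʳ-≤ 536 1≤m))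
    (solve 2 (λ n m → con 1056 :* m :+ (con 104 :* n :+ con 536 :* con 1) := (con 104 :* n :+ con 120) :+
        (con 104 :* (con 5 :* m :+ con 4) :+ con 536 :* m) :+ con 0) ≡.refl n m))
    (ℕ.*-monoˡ-≤ m 1056≤K)

module MedianOfMedians (ℝ : Reals) where
  open Reals ℝ
  open OrderedField ℝ using (≤-refl; ≤-trans; ≤-reflexive; total; sym; <⇒≱; ≰⇒>)
  open MeanEstimation ℝ
  open Selection ℝ

  module _ {p xs t} (partitioning : Partition p xs t) where
    open Partition partitioning

    #-parts : {P : Pred Carrier 0ℓ} (P? : Decidable P) → length (filter P? xs)
      ≡ length (filter P? below) ℕ.+ (length (filter P? equal) ℕ.+ length (filter P? above))
    #-parts P? = ≡.trans (#-↭ P? permutation) (≡.trans (#-++ P? below (equal ++ above))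
      (≡.cong (length (filter P? below) ℕ.+_) (#-++ P? equal above)))

    length-parts : length xs ≡ length below ℕ.+ (length equal ℕ.+ length above)
    length-parts = ≡.trans (↭.↭-length permutation) (≡.trans (List.length-++ below)
      (≡.cong (length below ℕ.+_) (List.length-++ equal)))

    private
      B E A : ℕ
      B = length below
      E = length equal
      A = length above

      below≤p : All (_≤ p) below
      below≤p = All.map (λ h → proj₁ (≰⇒> h)) below<

      p≤above : All (p ≤_) above
      p≤above = All.map (λ h → proj₁ (≰⇒> h)) above>

    -- No element of `below` is at least p, so every element that is at least p lies outside it. A
    -- pivot with many such elements leaves a short remainder.
    below-small : B ℕ.+ #≥ p xs ℕ.≤ length xs
    below-small = ≡.subst₂ (λ m n → B ℕ.+ m ℕ.≤ n)
        (≡.sym (≡.trans (#-parts (p ≤?_)) (≡.cong₂ ℕ._+_ (#-none (p ≤?_) below<)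
      (≡.cong₂ ℕ._+_ (#-all (p ≤?_) (All.map proj₂ equal≈)) (#-all (p ≤?_) p≤above)))))
          (≡.sym length-parts) ℕ.≤-refl

    above-small : A ℕ.+ #≤ p xs ℕ.≤ length xs
    above-small = ≡.subst₂ (λ m n → A ℕ.+ m ℕ.≤ n)
        (≡.sym (≡.trans (#-parts (_≤? p)) (≡.cong₂ ℕ._+_ (#-all (_≤? p) below≤p)
      (≡.cong₂ ℕ._+_ (#-all (_≤? p) (All.map proj₁ equal≈)) (#-none (_≤? p) above>)))))
          (≡.sym length-parts)
      (ℕ.≤-reflexive (solve 3 (λ b e a → a :+ (b :+ (e :+ con 0)) := b :+ (e :+ a)) ≡.refl B E A))
      where open +-*-Solver

    -- `IsRank` does not say that v occurs in the list, so v ≤ p is read off the counts: otherwise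
    -- nothing in `below` would be at least v, forcing B ≤ i. Then all of `equal` and `above` count
    -- as at least v.
    IsRank-below : ∀ {i v} → i ℕ.< B → IsRank i below v → IsRank i xs v
    IsRank-below {i} {v} i<B (lo , hi) =
      ≡.subst (i ℕ.<_) (≡.sym (#-parts (_≤? v))) (ℕ.≤-trans lo (ℕ.m≤m+n _ _)) ,
      ≡.subst₂ (λ m n → m ℕ.≤ i ℕ.+ n) (≡.sym length-parts)
          (≡.sym (≡.trans (#-parts (v ≤?_)) (≡.cong (#≥ v below ℕ.+_)
        (≡.cong₂ ℕ._+_ (#-all (v ≤?_) (All.map (λ h → ≤-trans v≤p (proj₂ h)) equal≈))
            (#-all (v ≤?_) (All.map (≤-trans v≤p) p≤above))))))
        (≡.subst (B ℕ.+ (E ℕ.+ A) ℕ.≤_) (ℕ.+-assoc i _ _) (ℕ.+-monoˡ-≤ (E ℕ.+ A) hi))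
      where
      v≤p : v ≤ p
      v≤p with v ≤? p
      ... | yes h = h
      ... | no ¬h = contradiction (ℕ.≤-trans hi (ℕ.≤-reflexive (≡.trans (≡.cong (i ℕ.+_) (#-none (v ≤?_)
                      (All.map (λ x≤p v≤x → ¬h (≤-trans v≤x x≤p)) below≤p))) (ℕ.+-identityʳ i))))
                          (ℕ.<⇒≱ i<B)

    IsRank-equal : ∀ {i} → B ℕ.≤ i → i ℕ.< B ℕ.+ E → IsRank i xs p
    IsRank-equal {i} B≤i i<B+E =
      ≡.subst (i ℕ.<_) (≡.sym (#-parts (_≤? p))) (ℕ.≤-trans i<B+E
          (ℕ.+-mono-≤ (ℕ.≤-reflexive (≡.sym (#-all (_≤? p) below≤p)))
        (ℕ.≤-trans (ℕ.≤-reflexive (≡.sym (#-all (_≤? p) (All.map proj₁ equal≈)))) (ℕ.m≤m+n _ _)))) ,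
      ≡.subst₂ (λ m n → m ℕ.≤ i ℕ.+ n) (≡.sym length-parts) (≡.sym (#-parts (p ≤?_)))
        (ℕ.+-mono-≤ B≤i (ℕ.≤-trans (ℕ.+-mono-≤
            (ℕ.≤-reflexive (≡.sym (#-all (p ≤?_) (All.map proj₂ equal≈))))
          (ℕ.≤-reflexive (≡.sym (#-all (p ≤?_) p≤above)))) (ℕ.m≤n+m _ (#≥ p below))))

    IsRank-above : ∀ {i v} → B ℕ.+ E ℕ.≤ i → IsRank (i ∸ (B ℕ.+ E)) above v → IsRank i xs v
    IsRank-above {i} {v} B+E≤i (lo , hi) =
      ≡.subst₂ ℕ._<_ shifted (≡.sym (≡.trans (#-parts (_≤? v)) (≡.trans
          (≡.cong₂ ℕ._+_ (#-all (_≤? v) (All.map (λ h → ≤-trans h p≤v) below≤p))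
              (≡.cong (ℕ._+ #≤ v above) (#-all (_≤? v) (All.map (λ h → ≤-trans (proj₁ h) p≤v) equal≈))))
          (≡.sym (ℕ.+-assoc B E _)))))
        (ℕ.+-monoʳ-< (B ℕ.+ E) lo) ,
      ≡.subst (length xs ℕ.≤_) (≡.cong (i ℕ.+_) (≡.sym (#-parts (v ≤?_)))) (ℕ.≤-trans
        (≡.subst₂ (λ m n → m ℕ.≤ n) (≡.trans (ℕ.+-assoc B E A) (≡.sym length-parts))
            (≡.trans (≡.sym (ℕ.+-assoc (B ℕ.+ E) _ _)) (≡.cong (ℕ._+ #≥ v above) shifted))
            (ℕ.+-monoʳ-≤ (B ℕ.+ E) hi))
        (ℕ.+-monoʳ-≤ i (ℕ.≤-trans (ℕ.m≤n+m _ (#≥ v equal)) (ℕ.m≤n+m _ (#≥ v below)))))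
      where
      shifted : B ℕ.+ E ℕ.+ (i ∸ (B ℕ.+ E)) ≡ i
      shifted = ℕ.m+[n∸m]≡n B+E≤i
      p≤v : p ≤ v
      p≤v with p ≤? v
      ... | yes h = h
      ... | no ¬h = contradiction (≡.subst (i ∸ (B ℕ.+ E) ℕ.<_)
          (#-none (_≤? v) (All.map (λ p≤x x≤v → ¬h (≤-trans p≤x x≤v)) p≤above)) lo) λ ()

  module _ (K : ℕ) (1056≤K : 1056 ℕ.≤ K) where

    Selects : ℕ → List Carrier → RAM Carrier → Set
    Selects i xs r = IsRank i xs (value r) × time r ℕ.≤ K ℕ.* length xs ℕ.+ 53

    -- The block medians and the retained part are both strictly shorter than `xs`, so the fuel does
    -- not run out. Rank and time are proved together, because the length of the retained part is
    -- controlled by the rank of the pivot.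
    select-selects : ∀ fuel {i} xs → length xs ℕ.≤ fuel → i ℕ.< length xs → Selects i xs
        (select fuel i xs)
    select-selects zero       xs enough i<n = contradiction (ℕ.≤-trans i<n enough) λ ()
    select-selects (suc fuel) {i} xs enough i<n = if-elim
      {Q = λ r → IsRank i xs (value r) × suc (time (count xs) ℕ.+ time r) ℕ.≤ K ℕ.* length xs ℕ.+ 53}
      (value (count xs) ≤ᵇ 5) short long
      where
      n = length xs
      short : T (value (count xs) ≤ᵇ 5) → IsRank i xs (value (insertionSort xs >>= nth i))
        × suc (time (count xs) ℕ.+ time (insertionSort xs >>= nth i)) ℕ.≤ K ℕ.* n ℕ.+ 53
      short h = sort-nth xs i<n , ℕ.≤-trans
        (ℕ.s≤s (ℕ.+-mono-≤ (ℕ.≤-trans (time-count xs) (ℕ.+-monoˡ-≤ 1 (ℕ.*-monoʳ-≤ 2 n≤5)))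
            (time-sort-nth i xs n≤5)))
        (positive K n 1056≤K i<n)
        where
        n≤5 : n ℕ.≤ 5
        n≤5 = ≡.subst (ℕ._≤ 5) (value-count xs) (ℕ.≤ᵇ⇒≤ _ 5 h)
        -- 1 + 11 + 42 = 54 units for the call, the count and the sort; one of them is covered by K
        -- n, as n ≥ 1.
        positive : ∀ K n → 1056 ℕ.≤ K → i ℕ.< n → 54 ℕ.≤ K ℕ.* n ℕ.+ 53
        positive K n hK hn = ℕ.+-monoˡ-≤ 53 (ℕ.*-mono-≤ (ℕ.≤-trans (ℕ.s≤s ℕ.z≤n) hK)
            (ℕ.≤-trans (ℕ.s≤s ℕ.z≤n) hn))
      ms = value (blockMedians xs)
      m = length ms
      h = ⌊ value (count ms) /2⌋
      p = value (select fuel h ms)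
      parts = value (partition p xs)
      open Partition (partition-partitions p xs) using (below; equal; above)
      partitioning = partition-partitions p xs
      open Blocks (blockMedians-blocks xs)
      h≡ : h ≡ ⌊ m /2⌋
      h≡ = ≡.cong ⌊_/2⌋ (value-count ms)
      finish : RAM Carrier
      finish = if i <ᵇ value (count below) then select fuel i below else
        if i <ᵇ value (count below) ℕ.+ value (count equal) then pure p
        else select fuel (i ∸ (value (count below) ℕ.+ value (count equal))) above
      Finishes : RAM Carrier → Set
      Finishes r = IsRank i xs (value r) × suc (time (count xs) ℕ.+
          (time (blockMedians xs) ℕ.+ (time (count ms) ℕ.+
        (time (select fuel h ms) ℕ.+ (time (partition p xs) ℕ.+
            (time (count below) ℕ.+ (time (count equal) ℕ.+ time r)))))))
          ℕ.≤ K ℕ.* n ℕ.+ 53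
      long : ¬ T (value (count xs) ≤ᵇ 5) → Finishes finish
      long n≰5 = if-elim {Q = Finishes} (i <ᵇ value (count below)) go-below λ i≮B →
          if-elim {Q = Finishes} (i <ᵇ value (count below) ℕ.+ value (count equal)) (go-equal (≮ᵇ i≮B))
              (λ i≮B+E → go-above (≮ᵇ i≮B+E))
        where
        5<n : 5 ℕ.< n
        5<n = ℕ.≰⇒> λ h → n≰5 (ℕ.≤⇒≤ᵇ (≡.subst (ℕ._≤ 5) (≡.sym (value-count xs)) h))
        ≮ᵇ : ∀ {a b} → ¬ T (a <ᵇ b) → b ℕ.≤ a
        ≮ᵇ h = ℕ.≮⇒≥ λ lt → h (ℕ.<⇒<ᵇ lt)
        1≤m : 1 ℕ.≤ m
        1≤m = 5<n≤5m+4⇒1≤m m 5<n length≤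
        m<n : m ℕ.< n
        m<n = ℕ.≤-trans (certify-ℕ 1≤m (solve 1
            (λ m → con 5 :* m :+ con 1 := con 1 :+ m :+ m :+ con 3 :* m) ≡.refl m)) 5*length≤
          where open +-*-Solver
        shorter : ∀ {l} → l ℕ.< n → l ℕ.≤ fuel
        shorter lt = ℕ.≤-pred (ℕ.≤-trans lt enough)
        h<m : h ℕ.< m
        h<m = ≡.subst (ℕ._< m) (≡.sym h≡) (half< m 1≤m)
          where
          half< : ∀ m → 1 ℕ.≤ m → ⌊ m /2⌋ ℕ.< m
          half< (suc m) _ = ℕ.⌊n/2⌋<n m
        pivot : Selects h ms (select fuel h ms)
        pivot = select-selects fuel ms (shorter m<n) h<m
        -- At least ⌊m/2⌋ + 1 block medians are at most p, each accounting for three elements of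
        -- `xs`. The mirrored bound below uses the m - ⌊m/2⌋ medians that are at least p.
        3m≤2#≤ : 3 ℕ.* m ℕ.≤ 2 ℕ.* #≤ p xs
        3m≤2#≤ = certify-ℕ (ℕ.+-mono-≤ (ℕ.*-monoʳ-≤ 3
            (ℕ.+-mono-≤ (n≤1+2⌊n/2⌋ m) (ℕ.*-monoʳ-≤ 2
            (≡.subst (ℕ._< #≤ p ms) h≡ (proj₁ (proj₁ pivot)))))) (ℕ.*-monoʳ-≤ 2 (lower p)))
          (solve 4 (λ m h a b → con 2 :* b :+ (con 3 :* (m :+ con 2 :* (con 1 :+ h)) :+ con 2 :*
              (con 3 :* a)) := con 3 :* m :+ (con 3 :* ((con 1 :+ con 2 :* h) :+ con 2 :* a) :+ con 2 :*
              b) :+ con 3) ≡.refl m ⌊ m /2⌋ (#≤ p ms) (#≤ p xs))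
          where open +-*-Solver
        3m≤2#≥ : 3 ℕ.* m ℕ.≤ 2 ℕ.* #≥ p xs
        3m≤2#≥ = certify-ℕ (ℕ.+-mono-≤ (ℕ.*-monoʳ-≤ 3
            (ℕ.+-mono-≤ (2⌊n/2⌋≤n m) (ℕ.*-monoʳ-≤ 2 (≡.subst (λ h → m ℕ.≤ h ℕ.+ #≥ p ms) h≡
            (proj₂ (proj₁ pivot)))))) (ℕ.*-monoʳ-≤ 2 (upper p)))
          (solve 4 (λ m h a b → con 2 :* b :+ (con 3 :* (con 2 :* h :+ con 2 :* m) :+ con 2 :*
              (con 3 :* a)) := con 3 :* m :+ (con 3 :* (m :+ con 2 :* (h :+ a)) :+ con 2 :* b) :+ con 0)
              ≡.refl m ⌊ m /2⌋ (#≥ p ms) (#≥ p xs))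
          where open +-*-Solver
        remainder : ∀ {l c} → 3 ℕ.* m ℕ.≤ 2 ℕ.* c → l ℕ.+ c ℕ.≤ n → 2 ℕ.* l ℕ.+ 3 ℕ.* m ℕ.≤ 2 ℕ.* n
        remainder {l} {c} h₁ h₂ = certify-ℕ (ℕ.+-mono-≤ h₁ (ℕ.*-monoʳ-≤ 2 h₂))
          (solve 4 (λ m c l n → con 2 :* n :+ (con 3 :* m :+ con 2 :* (l :+ c)) := con 2 :* l :+ con 3 :*
              m :+ (con 2 :* c :+ con 2 :* n) :+ con 0) ≡.refl m c l n)
          where open +-*-Solver
        remainder< : ∀ {l} → 2 ℕ.* l ℕ.+ 3 ℕ.* m ℕ.≤ 2 ℕ.* n → l ℕ.< n
        remainder< {l} h₁ = ℕ.*-cancelˡ-≤ 2 (certify-ℕ (ℕ.+-mono-≤ h₁ (ℕ.*-monoʳ-≤ 3 1≤m))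
          (solve 3 (λ l m n → con 2 :* n :+ (con 2 :* l :+ con 3 :* m :+ con 3 :* con 1) := con 2 :*
              (con 1 :+ l) :+ (con 2 :* n :+ con 3 :* m) :+ con 1) ≡.refl l m n))
          where open +-*-Solver
        B≤n : length below ℕ.≤ n
        B≤n = ≡.subst (length below ℕ.≤_) (≡.sym (length-parts partitioning)) (ℕ.m≤m+n _ _)
        E≤n : length equal ℕ.≤ n
        E≤n = ≡.subst (length equal ℕ.≤_) (≡.sym (length-parts partitioning))
            (ℕ.≤-trans (ℕ.m≤m+n _ _) (ℕ.m≤n+m _ (length below)))
        timed : ∀ {r t} → 2 ℕ.* r ℕ.+ 3 ℕ.* m ℕ.≤ 2 ℕ.* n → t ℕ.≤ K ℕ.* r ℕ.+ 53 →
          suc (time (count xs) ℕ.+ (time (blockMedians xs) ℕ.+ (time (count ms) ℕ.+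
            (time (select fuel h ms) ℕ.+ (time (partition p xs) ℕ.+
                (time (count below) ℕ.+ (time (count equal) ℕ.+ t)))))))
            ℕ.≤ K ℕ.* n ℕ.+ 53
        timed r≤ t≤ = select-recurrence K 1056≤K 5<n length≤ (ℕ.<⇒≤ m<n) B≤n E≤n r≤
          (time-count xs) (time-blockMedians xs) (time-count ms) (proj₂ pivot) (time-partition p xs)
              (time-count below) (time-count equal) t≤
        go-below : T (i <ᵇ value (count below)) → Finishes (select fuel i below)
        go-below lt = IsRank-below partitioning i<B (proj₁ rec) , timed {length below}
            {time (select fuel i below)} rem (proj₂ rec)
          where
          i<B : i ℕ.< length below
          i<B = ≡.subst (i ℕ.<_) (value-count below) (ℕ.<ᵇ⇒< i _ lt)
          rem = remainder {length below} {#≥ p xs} 3m≤2#≥ (below-small partitioning)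
          rec = select-selects fuel below (shorter (remainder< {length below} rem)) i<B
        go-equal : value (count below) ℕ.≤ i → T (i <ᵇ value (count below) ℕ.+ value (count equal)) →
            Finishes (pure p)
        go-equal B≤i lt = IsRank-equal partitioning (≡.subst (ℕ._≤ i) (value-count below) B≤i)
            (≡.subst (i ℕ.<_) (≡.cong₂ ℕ._+_ (value-count below) (value-count equal)) (ℕ.<ᵇ⇒< i _ lt)) ,
          -- When the pivot is the answer, there is no second recursive call; the recurrence is used
          -- with an empty remainder, for which 3 m ≤ 10 m ≤ 2 n.
          timed {0} {0} (ℕ.≤-trans (certify-ℕ (ℕ.≤-refl {0})
              (solve 1 (λ m → con 2 :* (con 5 :* m) :+ con 0 := con 3 :* m :+ con 0 :+ con 7 :* m) ≡.refl
              m)) (ℕ.*-monoʳ-≤ 2 5*length≤)) ℕ.z≤n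
          where open +-*-Solver
        go-above : value (count below) ℕ.+ value (count equal) ℕ.≤ i →
          Finishes (select fuel (i ∸ (value (count below) ℕ.+ value (count equal))) above)
        go-above B+E≤ = IsRank-above partitioning B+E≤i
            (≡.subst (λ j → IsRank (i ∸ j) above (value last)) B+E≡ (proj₁ rec)) , timed {length above}
            {time last} rem (proj₂ rec)
          where
          last = select fuel (i ∸ (value (count below) ℕ.+ value (count equal))) above
          B+E≡ = ≡.cong₂ ℕ._+_ (value-count below) (value-count equal)
          B+E≤i : length below ℕ.+ length equal ℕ.≤ i
          B+E≤i = ≡.subst (ℕ._≤ i) B+E≡ B+E≤
          rem = remainder {length above} {#≤ p xs} 3m≤2#≤ (above-small partitioning)
          rec : Selects (i ∸ (value (count below) ℕ.+ value (count equal))) above last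
          rec = select-selects fuel above (shorter (remainder< {length above} rem))
            (≡.subst (λ j → i ∸ j ℕ.< length above) (≡.sym B+E≡)
                (ℕ.+-cancelˡ-< (length below ℕ.+ length equal) _ _
              (≡.subst₂ ℕ._<_ (≡.sym (ℕ.m+[n∸m]≡n B+E≤i)) (≡.trans (length-parts partitioning)
                  (≡.sym (ℕ.+-assoc (length below) _ _))) i<n)))

-- Running time of the estimator and its subroutines.

time-forEach : ∀ {X : Set} {c d} {f : Fin d → RAM X} → (∀ l → time (f l) ℕ.≤ c) →
               time (forEach f) ℕ.≤ suc c ℕ.* d ℕ.+ 1
time-forEach {c = c} {zero}      h = ℕ.m≤n+m 1 (suc c ℕ.* 0)
time-forEach {c = c} {suc d} {f} h = certify-ℕ
    (ℕ.+-mono-≤ (h zero) (time-forEach {f = f ∘ suc} (h ∘ suc)))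
  (solve 4 (λ c d a b → ((con 1 :+ c) :* (con 1 :+ d) :+ con 1) :+ (a :+ b) := (con 1 :+ a :+ b) :+
      (c :+ ((con 1 :+ c) :* d :+ con 1)) :+ con 0) ≡.refl
    c d (time (f zero)) (time (forEach (f ∘ suc))))
  where open +-*-Solver

module RunningTime (ℝ : Reals) where
  open Reals ℝ
  open MeanEstimation ℝ
  open Selection ℝ
  open MedianOfMedians ℝ

  private
    variable
      d n : ℕ

  -- For l + 1 values, the lower median has zero-based rank ⌊l/2⌋: both ⌊l/2⌋ + 1 and l + 1 - ⌊l/2⌋
  -- are at least (l + 1)/2.
  IsRank⇒IsMedian : ∀ x xs {v} → IsRank ⌊ length xs /2⌋ (x ∷ xs) v → IsMedian (x ∷ xs) v
  IsRank⇒IsMedian x xs {v} (lo , hi) =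
    certify-ℕ (ℕ.+-mono-≤ (n≤1+2⌊n/2⌋ (length xs)) (ℕ.*-monoʳ-≤ 2 lo))
      (solve 3 (λ l h a → con 2 :* a :+ (l :+ con 2 :* (con 1 :+ h)) := (con 1 :+ l) :+
          ((con 1 :+ con 2 :* h) :+ con 2 :* a) :+ con 0) ≡.refl (length xs) ⌊ length xs /2⌋
          (#≤ v (x ∷ xs))) ,
    certify-ℕ (ℕ.+-mono-≤ (2⌊n/2⌋≤n (length xs)) (ℕ.*-monoʳ-≤ 2 hi))
      (solve 3 (λ l h a → con 2 :* a :+ (con 2 :* h :+ con 2 :* (con 1 :+ l)) := (con 1 :+ l) :+
          (l :+ con 2 :* (h :+ a)) :+ con 1) ≡.refl (length xs) ⌊ length xs /2⌋ (#≥ v (x ∷ xs)))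
    where open +-*-Solver

  module _ (K : ℕ) (1056≤K : 1056 ℕ.≤ K) where

    linearTimeMedian-select : ∀ {x} xs → Selects K 1056≤K ⌊ length xs /2⌋ (x ∷ xs)
      (select (value (count (x ∷ xs))) ⌊ value (count (x ∷ xs)) ∸ 1 /2⌋ (x ∷ xs))
    linearTimeMedian-select {x} xs = ≡.subst (λ n → Selects K 1056≤K ⌊ length xs /2⌋ (x ∷ xs)
        (select n ⌊ n ∸ 1 /2⌋ (x ∷ xs)))
      (≡.sym (value-count (x ∷ xs))) (select-selects K 1056≤K (suc (length xs)) (x ∷ xs) ℕ.≤-refl
          (ℕ.s≤s (ℕ.⌊n/2⌋≤n (length xs))))

    linearTimeMedian-median : MedianRoutine linearTimeMedian
    linearTimeMedian-median []       xs≢[] = contradiction ≡.refl xs≢[]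
    linearTimeMedian-median (x ∷ xs) _     = IsRank⇒IsMedian x xs
        (proj₁ (linearTimeMedian-select {x} xs))

    time-linearTimeMedian : ∀ xs → time (linearTimeMedian xs) ℕ.≤ (54 ℕ.+ K) ℕ.* length xs ℕ.+ (54 ℕ.+ K)
    time-linearTimeMedian []       = ℕ.≤-trans (ℕ.m≤m+n 2 (52 ℕ.+ K))
        (ℕ.m≤n+m (54 ℕ.+ K) ((54 ℕ.+ K) ℕ.* 0))
    time-linearTimeMedian (x ∷ xs) = ℕ.≤-trans (ℕ.+-mono-≤ (time-count (x ∷ xs))
        (proj₂ (linearTimeMedian-select {x} xs)))
      (certify-ℕ (ℕ.≤-refl {0}) (solve 2 (λ K n → (con 54 :+ K) :* n :+ (con 54 :+ K) :+ con 0 := con 2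
          :* n :+ con 1 :+ (K :* n :+ con 53) :+ con 0 :+ (con 52 :* n :+ K)) ≡.refl K
          (suc (length xs))))
      where open +-*-Solver

  linearTimeMedian-isMedian : MedianRoutine linearTimeMedian
  linearTimeMedian-isMedian = linearTimeMedian-median 1056 ℕ.≤-refl

  linearTimeMedian-linear : ∃[ D ] (∀ xs → time (linearTimeMedian xs) ℕ.≤ D ℕ.* length xs ℕ.+ D)
  linearTimeMedian-linear = 54 ℕ.+ 1056 , time-linearTimeMedian 1056 ℕ.≤-refl

  -- The time of the local loop of `fastGD`, named by the same device as `iterateValue`; the time of
  -- the first descent step is abstracted as well.
  mutual
    iterateTime : ∀ {d} → (List Carrier → RAM Carrier) → List (Point d) → ℕ → ℕ → Point d → ℕ
    iterateTime = λ median P T j c → _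

    iterateTime-spec : ∀ {d} (median : List Carrier → RAM Carrier) T (P : List (Point d)) →
      time (fastGD median (suc T) P)
        ≡ time (coordinatewiseMedian median P) ℕ.+ suc
            (time (descend median P (value (coordinatewiseMedian median P)))
            ℕ.+ iterateTime median P (suc T) T (value
                (descend median P (value (coordinatewiseMedian median P)))))
    iterateTime-spec median T P
      with value (descend median P (value (coordinatewiseMedian median P))) | suc T
         | time (descend median P (value (coordinatewiseMedian median P)))
    ... | c₁ | T′ | _ = ≡.refl

  time-difference : ∀ (p q : Point d) → time (difference p q) ℕ.≤ 2 ℕ.* d ℕ.+ 1
  time-difference p q = time-forEach {f = λ l → unit (p l - q l)} (λ _ → ℕ.≤-refl)

  -- Products of successors such as (d + 1)(s + 1) absorb all lower order terms, so that the bounds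
  -- compose without separate treatment of empty lists or dimension zero.
  time-sampleMean : ∀ (S : List (Point d)) → time (sampleMean S) ℕ.≤ 5 ℕ.* (suc d ℕ.* suc (length S))
  time-sampleMean {d} S = ℕ.≤-trans
    (ℕ.+-mono-≤ (time-forEach {f = λ (_ : Fin d) → unit 0#} (λ _ → ℕ.≤-refl)) (ℕ.+-mono-≤
      (time-accumulate {f = λ (q p : Point d) → forEach λ l → unit (q l + p l)}
        (λ q p → time-forEach {f = λ l → unit (q l + p l)} (λ _ → ℕ.≤-refl)) (value (origin {d})) S)
      (ℕ.+-mono-≤ (time-count S) (ℕ.s≤s
          (time-forEach {f = λ l → unit (value (count S >>= λ s → unit (fromℕ s ⁻¹)) * value
          (accumulate (λ (q p : Point d) → forEach λ l → unit (q l + p l)) (value (origin {d})) S) l)}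
          (λ _ → ℕ.≤-refl))))))
    (certify-ℕ (ℕ.≤-refl {0}) (solve 2 (λ d s → con 5 :* ((con 1 :+ d) :* (con 1 :+ s)) :+ con 0 :=
      ((con 2 :* d :+ con 1) :+ (((con 1 :+ (con 2 :* d :+ con 1)) :* s :+ con 1) :+
          ((con 2 :* s :+ con 1) :+ (con 1 :+ (con 2 :* d :+ con 1)))))
        :+ con 0 :+ (con 3 :* d :* s :+ s :+ d)) ≡.refl d (length S)))
    where open +-*-Solver

  time-group : ∀ (A : Multiset d n) is →
    time (collect (draw A) is >>= sampleMean) ℕ.≤ 7 ℕ.* (suc d ℕ.* suc (length is))
  time-group {d} A is = ℕ.≤-trans
    (ℕ.+-mono-≤ (time-collect {f = draw A} {xs = is} (All.universal (λ _ → ℕ.≤-refl) is))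
      (≡.subst (λ l → time (sampleMean S) ℕ.≤ 5 ℕ.* (suc d ℕ.* suc l))
        (≡.trans (≡.cong length (value-collect (draw A) is)) (List.length-map _ is))
            (time-sampleMean S)))
    (certify-ℕ (ℕ.≤-refl {0}) (solve 2 (λ d s → con 7 :* ((con 1 :+ d) :* (con 1 :+ s)) :+ con 0 :=
      (((con 2 :+ d) :* s :+ con 1) :+ con 5 :* ((con 1 :+ d) :* (con 1 :+ s))) :+ con 0 :+
          (con 1 :+ con 2 :* d :+ d :* s)) ≡.refl d (length is)))
    where
    open +-*-Solver
    S = value (collect (draw A) is)

  module _ (median : List Carrier → RAM Carrier) (D : ℕ)
           (linear : ∀ xs → time (median xs) ℕ.≤ D ℕ.* length xs ℕ.+ D) where

    private
      time-median : ∀ {X : Set} (f : X → RAM Carrier) xs →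
        time (median (value (collect f xs))) ℕ.≤ D ℕ.* length xs ℕ.+ D
      time-median f xs = ≡.subst (λ l → time (median (value (collect f xs))) ℕ.≤ D ℕ.* l ℕ.+ D)
        (≡.trans (≡.cong length (value-collect f xs)) (List.length-map _ xs))
            (linear (value (collect f xs)))

    time-coordinatewiseMedian : ∀ (P : List (Point d)) →
      time (coordinatewiseMedian median P) ℕ.≤ (D ℕ.+ 3) ℕ.* (suc (length P) ℕ.* suc d)
    time-coordinatewiseMedian {d} P = ℕ.≤-trans
      (time-forEach {f = λ l → collect (λ p → unit (p l)) P >>= median} λ l →
        ℕ.+-mono-≤ (time-collect {f = λ p → unit (p l)} {xs = P} (All.universal (λ _ → ℕ.≤-refl) P))
            (time-median (λ p → unit (p l)) P))
      (certify-ℕ (ℕ.≤-refl {0}) (solve 3 (λ D k d → (D :+ con 3) :* ((con 1 :+ k) :* (con 1 :+ d)) :+ con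
          0 :=
        ((con 1 :+ ((con 2 :* k :+ con 1) :+ (D :* k :+ D))) :* d :+ con 1) :+ con 0 :+
            (D :* (con 1 :+ k) :+ con 3 :* k :+ con 2 :+ (con 1 :+ k) :* d)) ≡.refl D (length P) d))
      where open +-*-Solver

    time-gradient : ∀ (P : List (Point d)) c → time (gradient P c) ℕ.≤ 5 ℕ.* (suc (length P) ℕ.* suc d)
    time-gradient {d} P c = ℕ.≤-trans
      (ℕ.+-mono-≤ (time-forEach {f = λ (_ : Fin d) → unit 0#} (λ _ → ℕ.≤-refl))
        (time-accumulate time-add (value (origin {d})) P))
      (certify-ℕ (ℕ.≤-refl {0}) (solve 2 (λ d k → con 5 :* ((con 1 :+ k) :* (con 1 :+ d)) :+ con 0 :=
        ((con 2 :* d :+ con 1) :+ ((con 1 :+ ((con 2 :* d :+ con 1) :+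
            ((con 1 :+ d :+ con 1) :+ (con 2 :* d :+ con 1)))) :* k :+ con 1)) :+ con 0 :+
            (con 3 :+ con 3 :* d)) ≡.refl d (length P)))
      where
      open +-*-Solver
      add : Point d → Point d → RAM (Point d)
      add g p = difference c p >>= λ u → norm u >>= λ r →
        if does (r ≟ 0#) then unit g else forEach λ l → unit (g l + u l * r ⁻¹)
      time-add : ∀ g p → time (add g p) ℕ.≤ (2 ℕ.* d ℕ.+ 1) ℕ.+ ((suc d ℕ.+ 1) ℕ.+ (2 ℕ.* d ℕ.+ 1))
      time-add g p = ℕ.+-mono-≤ (time-difference c p) (ℕ.+-monoʳ-≤ (suc d ℕ.+ 1)
        (if-elim {Q = λ r → time r ℕ.≤ 2 ℕ.* d ℕ.+ 1} (does (value (norm u) ≟ 0#))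
            (λ _ → ℕ.m≤n+m 1 (2 ℕ.* d))
          λ _ → time-forEach {f = λ l → unit (g l + u l * value (norm u) ⁻¹)} (λ _ → ℕ.≤-refl)))
        where u = value (difference c p)

    time-descend : ∀ (P : List (Point d)) c → time (descend median P c) ℕ.≤ (D ℕ.+ 12) ℕ.*
        (suc (length P) ℕ.* suc d)
    time-descend {d} P c = ℕ.≤-trans
      (ℕ.+-mono-≤ (time-gradient P c) (ℕ.+-monoʳ-≤ (suc d)
        (if-elim {Q = λ r → time r ℕ.≤ (step-cost ℕ.* k ℕ.+ k ℕ.+ 1) ℕ.+
            ((D ℕ.* k ℕ.+ D) ℕ.+ (2 ℕ.* d ℕ.+ 1))}
          (does (gg ≟ 0#)) (λ _ → ℕ.≤-trans (ℕ.m≤n+m 1 (2 ℕ.* d))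
              (ℕ.≤-trans (ℕ.m≤n+m (2 ℕ.* d ℕ.+ 1) (D ℕ.* k ℕ.+ D))
              (ℕ.m≤n+m ((D ℕ.* k ℕ.+ D) ℕ.+ (2 ℕ.* d ℕ.+ 1)) (step-cost ℕ.* k ℕ.+ k ℕ.+ 1))))
          λ _ → ℕ.+-mono-≤ (ℕ.≤-trans (time-collect {f = project} {xs = P}
              (All.universal time-project P)) (ℕ.≤-reflexive
              (solve 2 (λ c k → (con 1 :+ c) :* k :+ con 1 := c :* k :+ k :+ con 1) ≡.refl step-cost k)))
            (ℕ.+-mono-≤ (time-median project P) (time-forEach
                {f = λ l → unit (c l - value (median (value (collect project P))) * g l)}
                (λ _ → ℕ.≤-refl))))))
      (certify-ℕ (ℕ.≤-refl {0}) (solve 3 (λ D k d → (D :+ con 12) :* ((con 1 :+ k) :* (con 1 :+ d)) :+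
          con 0 :=
        (con 5 :* ((con 1 :+ k) :* (con 1 :+ d)) :+ (con 1 :+ d :+
            ((((con 2 :* d :+ con 1) :+ (con 1 :+ d :+ con 1)) :* k :+ k :+ con 1) :+
            ((D :* k :+ D) :+ (con 2 :* d :+ con 1))))) :+ con 0
          :+ (D :* (con 1 :+ k) :* d :+ con 4 :+ con 4 :* d :+ con 3 :* k :+ con 4 :* d :* k)) ≡.refl D k
              d))
      where
      open +-*-Solver
      k = length P
      g = value (gradient P c)
      gg = value (innerProduct g g)
      project : Point d → RAM Carrier
      project p = difference c p >>= λ u → innerProduct u g >>= λ ug → unit (ug * gg ⁻¹)
      step-cost : ℕ
      step-cost = (2 ℕ.* d ℕ.+ 1) ℕ.+ (suc d ℕ.+ 1)
      time-project : ∀ p → time (project p) ℕ.≤ step-cost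
      time-project p = ℕ.+-monoˡ-≤ (suc d ℕ.+ 1) (time-difference c p)

    time-iterate : ∀ (P : List (Point d)) T j c →
      iterateTime median P T j c ℕ.≤ (D ℕ.+ 13) ℕ.* (suc (length P) ℕ.* suc d) ℕ.* j ℕ.+ 1
    time-iterate {d} P T zero    c = ℕ.m≤n+m 1 ((D ℕ.+ 13) ℕ.* (suc (length P) ℕ.* suc d) ℕ.* 0)
    time-iterate {d} P T (suc j) c = certify-ℕ (ℕ.+-mono-≤ (time-descend P c)
        (time-iterate P T j (value (descend median P c))))
      (solve 6 (λ D k d j a b → ((D :+ con 13) :* ((con 1 :+ k) :* (con 1 :+ d)) :* (con 1 :+ j) :+ con
          1) :+ (a :+ b) :=
        (con 1 :+ (a :+ b)) :+ ((D :+ con 12) :* ((con 1 :+ k) :* (con 1 :+ d)) :+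
            ((D :+ con 13) :* ((con 1 :+ k) :* (con 1 :+ d)) :* j :+ con 1)) :+ (d :+ k :+ d :* k))
        ≡.refl D (length P) d j (time (descend median P c))
            (iterateTime median P T j (value (descend median P c))))
      where open +-*-Solver

    time-fastGD : ∀ (P : List (Point d)) T →
      time (fastGD median T P) ℕ.≤ (D ℕ.+ 13) ℕ.* (suc (length P) ℕ.* suc d) ℕ.* suc T
    time-fastGD {d} P T = ℕ.≤-trans
      (ℕ.+-mono-≤ (time-coordinatewiseMedian P) (time-iterate P T T
          (value (coordinatewiseMedian median P))))
      (certify-ℕ (ℕ.≤-refl {0}) (solve 4 (λ D k d T → (D :+ con 13) :* ((con 1 :+ k) :* (con 1 :+ d)) :*
          (con 1 :+ T) :+ con 0 :=
        ((D :+ con 3) :* ((con 1 :+ k) :* (con 1 :+ d)) :+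
            ((D :+ con 13) :* ((con 1 :+ k) :* (con 1 :+ d)) :* T :+ con 1)) :+ con 0 :+
            (con 9 :+ con 10 :* (d :+ k :+ d :* k))) ≡.refl D (length P) d T))
      where open +-*-Solver

    time-meanEstimate : ∀ (A : Multiset d n) {k s} T ω → length ω ≡ k → All (λ is → length is ≡ s) ω →
      time (meanEstimate (fastGD median T) A ω) ℕ.≤ (D ℕ.+ 13) ℕ.* (suc k ℕ.* suc d) ℕ.* (s ℕ.+ T ℕ.+ 2)
    time-meanEstimate {d} A {s = s} T ω ≡.refl lengths = ℕ.≤-trans
      (ℕ.+-mono-≤ (time-collect {c = 7 ℕ.* (suc d ℕ.* suc s)} {f = group}
          (All.map (λ { {is} ≡.refl → time-group A is }) lengths))
        (≡.subst (λ l → time (fastGD median T P) ℕ.≤ (D ℕ.+ 13) ℕ.* (suc l ℕ.* suc d) ℕ.* suc T)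
          (≡.trans (≡.cong length (value-collect group ω)) (List.length-map _ ω)) (time-fastGD P T)))
      (certify-ℕ (ℕ.≤-refl {0}) (solve 5 (λ D k d s T → (D :+ con 13) :* ((con 1 :+ k) :* (con 1 :+ d))
          :* (s :+ T :+ con 2) :+ con 0 :=
        (((con 1 :+ con 7 :* ((con 1 :+ d) :* (con 1 :+ s))) :* k :+ con 1) :+ (D :+ con 13) :*
            ((con 1 :+ k) :* (con 1 :+ d)) :* (con 1 :+ T)) :+ con 0
          :+ ((D :+ con 5) :* (con 1 :+ s) :* ((con 1 :+ k) :* (con 1 :+ d)) :+ con 7 :+ con 8 :*
              (d :+ s :+ d :* s) :+ (d :+ s :+ d :* s) :* k)) ≡.refl D (length ω) d s T))
      where
      open +-*-Solver
      group : List (Fin _) → RAM (Point d)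
      group is = collect (draw A) is >>= sampleMean
      P = value (collect group ω)

-- From rounded parameters to the claimed bounds.

module Bounds (ℝ : Reals) where
  open Reals ℝ
  open OrderedField ℝ
  open Completeness ℝ
  open SuccessProbability ℝ
  open RunningTime ℝ
  open MeanEstimation ℝ
  open Max (DecTotalOrder.totalOrder decTotalOrder) using (x≤x⊔y; x≤y⊔x)

  a : Carrier
  a = fromℕ 256 * fromℕ 64

  0<a : 0# < a
  0<a = 0<* (0<fromℕ-suc 255) (0<fromℕ-suc 63)

  -- Minimality of a ceiling k + 1 excludes x ≤ k.
  ceiling≤ : ∀ {x y k} → IsCeiling x k → x ≤ y → 0# ≤ y → fromℕ k ≤ 1# + y
  ceiling≤ {k = zero}  _           x≤y 0≤y = 0≤1 ⊕ 0≤y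
  ceiling≤ {x} {k = suc k} (_ , least) x≤y _ with x ≤? fromℕ k
  ... | yes h = contradiction (least k h) (ℕ.<⇒≱ ℕ.≤-refl)
  ... | no ¬h = +-mono-≤ ≤-refl (≤-trans (proj₁ (≰⇒> ¬h)) x≤y)

  1≤⁻¹ : ∀ {x} → 0# < x → x < 1# → 1# ≤ x ⁻¹
  1≤⁻¹ {x} 0<x x<1 = *-cancelˡ-≤ 0<x (≤-resp-≈ (sym (*-identityʳ x)) (sym (⁻¹-inverseʳ (pos⇒≉0 0<x)))
      (proj₁ x<1))

  success : ∀ (d n : ℕ) .{{_ : NonZero d}} .{{_ : NonZero n}} (A : Multiset d n) (ε δ : Carrier) →
    0# < ε → ε < 1# → 0# < δ → δ < 1# →
    ∀ (k s T : ℕ) → IsCeiling (1# * log (δ ⁻¹)) k → IsCeiling (a * ε ⁻¹) s → 1# * log (log (δ ⁻¹)) ≤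
        fromℕ T →
    ∀ median → MedianRoutine median →
    1# - δ ≤ probability (samples n s k) (λ ω → approximateMean? A ε
        (value (meanEstimate (fastGD median T) A ω)))
  success d n A ε δ 0<ε ε<1 0<δ δ<1 k s T (k≥ , _) (s≥ , _) _ median isMedian =
    success-probability d n A ε 0<ε s large k δ 0<δ (0<k k δ⁻¹≤2^k) δ⁻¹≤2^k median isMedian T
    where
    large : a ≤ fromℕ s * ε
    large = ≤-resp-≈ (trans (*-assoc _ _ _) (trans
        (*-congˡ (trans (*-comm _ _) (⁻¹-inverseʳ (pos⇒≉0 0<ε)))) (*-identityʳ a))) refl
      (*-monoʳ-≤ (proj₁ 0<ε) s≥)
    δ⁻¹≤2^k : δ ⁻¹ ≤ fromℕ 2 ^ k
    δ⁻¹≤2^k = log≤⇒≤2^ k (0<⁻¹ 0<δ) (≤-resp-≈ (*-identityˡ _) refl k≥)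
    -- At least one group is drawn: k = 0 would mean δ⁻¹ ≤ 2^0 = 1.
    0<k : ∀ k → δ ⁻¹ ≤ fromℕ 2 ^ k → 0# < fromℕ k
    0<k zero    h = contradiction (≤-resp-≈ (⁻¹-inverseʳ (pos⇒≉0 0<δ)) (*-identityʳ δ)
        (*-monoˡ-≤ (proj₁ 0<δ) h)) (<⇒≱ δ<1)
    0<k (suc k) _ = 0<fromℕ-suc k

  -- To be used for i = ε⁻¹, ℓ = log δ⁻¹ ⊔ 1 and ℓℓ = log log δ⁻¹ ⊔ 0.
  real-bound : ∀ {c₂ i ℓℓ ℓ} (D d k s T : ℕ) .{{_ : NonZero d}} → 0# < c₂ → 1# ≤ i → 0# ≤ ℓℓ → 1# ≤ ℓ →
    fromℕ k ≤ 1# + ℓ → fromℕ s ≤ 1# + a * i → fromℕ T ≤ c₂ * ℓℓ + 1# →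
    fromℕ ((D ℕ.+ 13) ℕ.* (suc k ℕ.* suc d) ℕ.* (s ℕ.+ T ℕ.+ 2))
      ≤ fromℕ (D ℕ.+ 13) * (fromℕ 6 * (a + fromℕ 4 + c₂)) * ((i + ℓℓ) * ℓ * fromℕ d)
  real-bound {c₂} {i} {ℓℓ} {ℓ} D (suc d′) k s T 0<c₂ 1≤i 0≤ℓℓ 1≤ℓ k≤ s≤ T≤ = ≤-resp-≈
    (sym (trans (fromℕ-* ((D ℕ.+ 13) ℕ.* (suc k ℕ.* suc d)) (s ℕ.+ T ℕ.+ 2)) (*-cong
      (trans (fromℕ-* (D ℕ.+ 13) (suc k ℕ.* suc d)) (*-congˡ (fromℕ-* (suc k) (suc d))))
      (trans (fromℕ-+ (s ℕ.+ T) 2) (+-congʳ (fromℕ-+ s T))))))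
    (solve 6 (λ F l x c i m → F :* (con (+ 3) :* l :* (con (+ 2) :* x)) :* (c :* (i :+ m)) := F :*
        (con (+ 6) :* c) :* ((i :+ m) :* l :* x)) refl F ℓ x c i ℓℓ)
    (*-mono-≤ (0≤F ⊗ (0≤fromℕ (suc k) ⊗ 0≤fromℕ (suc d)))
        (≤-trans (0≤fromℕ s ⊕ 0≤fromℕ T ⊕ 0≤fromℕ 2) samples≤)
      (*-monoˡ-≤ 0≤F (*-mono-≤ (0≤fromℕ (suc k)) (≤-trans (0≤fromℕ (suc d)) dimension≤) groups≤
          dimension≤))
      samples≤)
    where
    d = suc d′
    x = fromℕ d
    F = fromℕ (D ℕ.+ 13)
    c = a + fromℕ 4 + c₂
    0≤F : 0# ≤ F
    0≤F = 0≤fromℕ (D ℕ.+ 13)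
    -- 1 + k ≤ 2 + ℓ ≤ 3 ℓ. Together with the factor 2 for the dimension, this makes up the 6 in the
    -- constant.
    groups≤ : 1# + fromℕ k ≤ fromℕ 3 * ℓ
    groups≤ = certify (x≤y⇒0≤y-x k≤ ⊕ 0≤fromℕ 2 ⊗ x≤y⇒0≤y-x 1≤ℓ)
      (solve 2 (λ k l → con (+ 3) :* l := con (+ 1) :+ k :+
          (con (+ 1) :+ l :- k :+ con (+ 2) :* (l :- con (+ 1)))) refl (fromℕ k) ℓ)
    dimension≤ : 1# + x ≤ fromℕ 2 * x
    dimension≤ = certify (0≤fromℕ d′)
      (solve 1 (λ y → con (+ 2) :* (con (+ 1) :+ y) := con (+ 1) :+ (con (+ 1) :+ y) :+ y) refl
          (fromℕ d′))
    -- The additive constants left by rounding and by the loops, 1 + 1 + 2 = 4, are absorbed into 4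
    -- i because i ≥ 1.
    samples≤ : fromℕ s + fromℕ T + fromℕ 2 ≤ c * (i + ℓℓ)
    samples≤ = certify
      (x≤y⇒0≤y-x s≤ ⊕ x≤y⇒0≤y-x T≤ ⊕ (proj₁ 0<a ⊗ 0≤ℓℓ ⊕ 0≤fromℕ 4 ⊗ x≤y⇒0≤y-x 1≤i ⊕ 0≤fromℕ 4 ⊗ 0≤ℓℓ ⊕
          proj₁ 0<c₂ ⊗ ≤-trans 0≤1 1≤i))
      (solve 6 (λ a c i m s T → (a :+ con (+ 4) :+ c) :* (i :+ m) := s :+ T :+ con (+ 2)
          :+ (con (+ 1) :+ a :* i :- s :+ (c :* m :+ con (+ 1) :- T) :+
              (a :* m :+ con (+ 4) :* (i :- con (+ 1)) :+ con (+ 4) :* m :+ c :* i)))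
        refl a c₂ i ℓℓ (fromℕ s) (fromℕ T))

  running-time : ∀ D → (∀ xs → time (linearTimeMedian xs) ℕ.≤ D ℕ.* length xs ℕ.+ D) →
    ∀ (c₁ c₂ : Carrier) → 0# < c₁ → 0# < c₂ → ∃[ C ] (0# < C ×
    (∀ (d n : ℕ) .{{_ : NonZero d}} .{{_ : NonZero n}} (A : Multiset d n) (ε δ : Carrier) →
      0# < ε → ε < 1# → 0# < δ → δ < 1# →
      ∀ (k s T : ℕ) → IsCeiling (1# * log (δ ⁻¹)) k → IsCeiling (a * ε ⁻¹) s →
      c₁ * (log (log (δ ⁻¹)) ⊔ 0#) ≤ fromℕ T → fromℕ T < c₂ * (log (log (δ ⁻¹)) ⊔ 0#) + 1# →
      All (λ ω → fromℕ (time (meanEstimate (fastGD linearTimeMedian T) A ω))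
                   ≤ C * ((ε ⁻¹ + (log (log (δ ⁻¹)) ⊔ 0#)) * (log (δ ⁻¹) ⊔ 1#) * fromℕ d))
          (samples n s k)))
  running-time D linear c₁ c₂ _ 0<c₂ =
      fromℕ (D ℕ.+ 13) * (fromℕ 6 * (a + fromℕ 4 + c₂)) ,
      0<* (<-resp-≈ refl (reflexive (≡.cong fromℕ (ℕ.+-comm 13 D))) (0<fromℕ-suc (12 ℕ.+ D)))
        (0<* (0<fromℕ-suc 5) (0<+ (0<+ 0<a (0≤fromℕ 4)) (proj₁ 0<c₂))) ,
      λ d n A ε δ 0<ε ε<1 0<δ δ<1 k s T k-ceiling s-ceiling _ T< →
        All.map (λ { {ω} (e , lengths) → ≤-trans
            (fromℕ-mono-≤ (time-meanEstimate linearTimeMedian D linear A T ω e lengths))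
            (real-bound D d k s T 0<c₂ (1≤⁻¹ 0<ε ε<1) (x≤y⊔x _ _) (x≤y⊔x _ _)
              (ceiling≤ k-ceiling (≤-resp-≈ (sym (*-identityˡ _)) refl (x≤x⊔y _ _))
                  (≤-trans 0≤1 (x≤y⊔x _ _)))
              (ceiling≤ s-ceiling ≤-refl (proj₁ 0<a ⊗ 0≤⁻¹ 0<ε)) (proj₁ T<)) })
          (All-tuples (tuples-length s (allFin n)) k)

theorem3p1 :
  (ℝ : Reals) →
  let open Reals ℝ
      open MeanEstimation ℝ
  in
  ∃[ a ] ∃[ b ] ∃[ γ ]
    ( 0# < a × 0# < b × 0# < γ
    × -- success probability, for every way of choosing the medians
      ( ∀ (d n : ℕ) .{{_ : NonZero d}} .{{_ : NonZero n}}
          (A : Multiset d n) (ε δ : Carrier) →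
          0# < ε → ε < 1# → 0# < δ → δ < 1# →
        ∀ (k s T : ℕ) →
          IsCeiling (b * log (δ ⁻¹)) k →
          IsCeiling (a * ε ⁻¹) s →
          γ * log (log (δ ⁻¹)) ≤ fromℕ T →
        ∀ median → MedianRoutine median →
          1# - δ ≤
            probability (samples n s k)
              (λ ω → approximateMean? A ε
                       (value (meanEstimate (fastGD median T) A ω))) )
    × -- running time, for every T = Θ(log log δ⁻¹), rounded up to ℕ; the
      -- maxima with 0# and 1# have an effect only when δ > 1/2
      MedianRoutine linearTimeMedian
    × ( ∀ (c₁ c₂ : Carrier) → 0# < c₁ → 0# < c₂ →
        ∃[ C ]
          ( 0# < C
          × ( ∀ (d n : ℕ) .{{_ : NonZero d}} .{{_ : NonZero n}}
                (A : Multiset d n) (ε δ : Carrier) →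
                0# < ε → ε < 1# → 0# < δ → δ < 1# →
              ∀ (k s T : ℕ) →
                IsCeiling (b * log (δ ⁻¹)) k →
                IsCeiling (a * ε ⁻¹) s →
                c₁ * (log (log (δ ⁻¹)) ⊔ 0#) ≤ fromℕ T →
                fromℕ T < c₂ * (log (log (δ ⁻¹)) ⊔ 0#) + 1# →
              All (λ ω →
                     fromℕ (time (meanEstimate (fastGD linearTimeMedian T) A ω))
                       ≤ C * ((ε ⁻¹ + (log (log (δ ⁻¹)) ⊔ 0#))
                              * (log (δ ⁻¹) ⊔ 1#) * fromℕ d))
                  (samples n s k) ) ) ) )
theorem3p1 ℝ = a , 1# , 1# , 0<a , 0<1 , 0<1 , success , linearTimeMedian-isMedian ,
  running-time (proj₁ linearTimeMedian-linear) (proj₂ linearTimeMedian-linear)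
  where
  open Reals ℝ
  open OrderedField ℝ
  open RunningTime ℝ
  open Bounds ℝ
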